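{- Let $q$ be an odd prime power with $q\equiv 0,\pm1\pmod 5$, let $b\in\mathbb{F}_q$ with $b^2+b=1$, and let $g(x)=x^q+x^{q^3}+bx^{q^5}$. The maximum scattered $\mathbb{F}_q$-linear set $L_g$ of $\mathrm{PG}(1,q^6)$ is not $\mathrm{P\Gamma L}(2,q^6)$-equivalent to any of the linear sets $L^{1,6}_s$, $L^{2,6}_{t,\rho}$, $L^{3,6}_{h,\xi}$.
   Context: For an $\mathbb{F}_q$-subspace $U$ of $\mathbb{F}_{q^6}^2$, $L_U=\{\langle u\rangle_{\mathbb{F}_{q^6}} : u\in U\setminus\{0\}\}\subseteq\mathrm{PG}(1,q^6)$, and $L_g=L_{U_g}$ with $U_g=\{(x,g(x)) : x\in\mathbb{F}_{q^6}\}$. $L^{1,6}_s$, $L^{2,6}_{t,\rho}$, $L^{3,6}_{h,\xi}$ are the linear sets defined respectively by $U^{1,6}_s=\{(x,x^{q^s})\}$ with $\gcd(s,6)=1$; $U^{2,6}_{t,\rho}=\{(x,\rho x^{q^t}+x^{q^{6-t}})\}$ with $\gcd(t,6)=1$ and $\mathrm{N}_{q^6/q}(\rho)\notin\{0,1\}$; $U^{3,6}_{h,\xi}=\{(x,\xi x^{q^h}+x^{q^{h+3}})\}$ with $\gcd(h,3)=1$, $\mathrm{N}_{q^6/q^3}(\xi)\notin\{0,1\}$ and $\xi,q$ satisfying the additional conditions under which it is maximum scattered (its linear set has $(q^6-1)/(q-1)$ points); here $x$ ranges over $\mathbb{F}_{q^6}$. Linear sets $L,L'$ are $\mathrm{P\Gamma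 L}(2,q^6)$-equivalent if $L^\phi=L'$ for some $\phi\in\mathrm{P\Gamma L}(2,q^6)$. -}

module Defs where

open import Data.Nat as ℕ using (ℕ; zero; suc; _≤_; _<_)
open import Data.Nat.Primality using (Prime)
open import Data.Fin using (Fin)
open import Data.Vec using (Vec; lookup)
open import Data.Product using (Σ; ∃; ∃-syntax; _×_; _,_)
open import Data.Sum using (_⊎_)
open import Relation.Binary.PropositionalEquality using (_≡_)
open import Relation.Nullary using (¬_)
open import Function.Bundles using (_↔_)
open import Algebra.Structures using (IsCommutativeRing)

IsPrimePower : ℕ → Set
IsPrimePower q = Σ ℕ λ p → Σ ℕ λ k → Prime p × 1 ≤ k × q ≡ p ℕ.^ k

record Field : Set₁ where
  infixl 6 _+_
  infixl 7 _*_
  field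
    K          : Set
    _+_ _*_    : K → K → K
    -_         : K → K
    0# 1#      : K
    isCommutativeRing : IsCommutativeRing _≡_ _+_ _*_ -_ 0# 1#
    inverse    : ∀ x → ¬ x ≡ 0# → ∃[ y ] (x * y ≡ 1#)
    0≢1        : ¬ 0# ≡ 1#

θ : ℕ → ℕ
θ q = 1 ℕ.+ q ℕ.+ q ℕ.^ 2 ℕ.+ q ℕ.^ 3 ℕ.+ q ℕ.^ 4 ℕ.+ q ℕ.^ 5

module _ (F : Field) where
  open Field F

  infixr 8 _^ᶠ_
  _^ᶠ_ : K → ℕ → K
  x ^ᶠ zero  = 1#
  x ^ᶠ suc n = x * (x ^ᶠ n)

  V : Set
  V = K × K

  NonZeroV : V → Set
  NonZeroV (a , b) = ¬ (a ≡ 0# × b ≡ 0#)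

  _·_ : K → V → V
  λ' · (a , b) = (λ' * a , λ' * b)

  SamePoint : V → V → Set
  SamePoint u v = ∃[ λ' ] (¬ λ' ≡ 0# × v ≡ λ' · u)

  -- L_g = L_{U_g}, U_g = {(x, g x)}: the set of vectors representing its points
  -- (membership of a nonzero vector v means ⟨v⟩ ∈ L_g)
  LinSet : (K → K) → V → Set
  LinSet g v = ∃[ x ] (¬ x ≡ 0# × SamePoint (x , g x) v)

  -- the point set described by P (closed under SamePoint) has exactly N points
  HasNPoints : (V → Set) → ℕ → Set
  HasNPoints P N = Σ (Vec V N) λ vs →
      (∀ i → NonZeroV (lookup vs i) × P (lookup vs i))
    × (∀ i j → SamePoint (lookup vs i) (lookup vs j) → i ≡ j)
    × (∀ v → NonZeroV v → P v → ∃[ i ] SamePoint (lookup vs i) v)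

  MaxScattered : ℕ → (K → K) → Set
  MaxScattered q g = HasNPoints (LinSet g) (θ q)

  record Automorphism : Set where
    field
      σ       : K → K
      σ⁻¹     : K → K
      inv₁    : ∀ x → σ (σ⁻¹ x) ≡ x
      inv₂    : ∀ x → σ⁻¹ (σ x) ≡ x
      hom-+   : ∀ x y → σ (x + y) ≡ σ x + σ y
      hom-*   : ∀ x y → σ (x * y) ≡ σ x * σ y
      hom-1   : σ 1# ≡ 1#

  record PΓL2 : Set where
    field
      aut     : Automorphism
      a b c d : K
      det≢0   : ¬ (a * d + - (b * c)) ≡ 0#

    act : V → V
    act (x , y) = let s = Automorphism.σ aut in
      (a * s x + b * s y , c * s x + d * s y)

  Image : PΓL2 → (V → Set) → V → Set
  Image φ P w = ∃[ v ] (P v × w ≡ PΓL2.act φ v)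

  PΓLEquivalent : (V → Set) → (V → Set) → Set
  PΓLEquivalent L L' = ∃[ φ ] (∀ w → NonZeroV w → (Image φ L w → L' w) × (L' w → Image φ L w))

  frob : ℕ → ℕ → K → K
  frob q i x = x ^ᶠ (q ℕ.^ i)

  -- norms N_{q^6/q}(ρ) = ρ^{(q^6-1)/(q-1)} and N_{q^6/q^3}(ξ) = ξ^{q^3+1}
  N6/1 : ℕ → K → K
  N6/1 q ρ = ρ ^ᶠ θ q

  N6/3 : ℕ → K → K
  N6/3 q ξ = ξ ^ᶠ (q ℕ.^ 3 ℕ.+ 1)

  gThm : ℕ → K → K → K
  gThm q b x = frob q 1 x + frob q 3 x + b * frob q 5 x

  g1 : ℕ → ℕ → K → K
  g1 q s x = frob q s x

  g2 : ℕ → ℕ → K → K → K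
  g2 q t ρ x = ρ * frob q t x + frob q (6 ℕ.∸ t) x

  g3 : ℕ → ℕ → K → K → K
  g3 q h ξ x = ξ * frob q h x + frob q (h ℕ.+ 3) x

{-# OPTIONS --safe #-}
-- Write xᵢ for x^{qⁱ}.  The points of L_g are represented by the pairs (x , g x), so a
-- collineation carrying L_g to L_f produces A, B, C, D with AD ≠ BC such that for every x the
-- map z ↦ (A x + B g x) f z - (C x + D g x) z has a non-zero kernel.  Hence the 6 × 6 Dickson
-- determinant of this map vanishes.  Its entries are linear forms Pᵢ, Qᵢ in x₀, …, x₅, and its
-- degree in each xⱼ is 4 < q, so it vanishes as a polynomial: the xⱼ may be replaced by
-- arbitrary elements Xⱼ of the field.  Since b² + b = 1, the values Zᵢ of the conjugates of g at
-- even i can be prescribed independently of the Xᵢ with i even; this freedom allows a choice of X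
-- for which enough Pᵢ vanish to make the matrix triangular, while no Qᵢ vanishes.
--
-- L_g is scattered because g (l x) = l g x gives two 3 × 3 determinantal identities between the
-- lᵢ; their difference and their sum factor as
--   (l₁ - l₄)(l₃ - l₀)(l₅ - l₂) = 0,  (l₁ - l₀)(l₃ - l₂)(l₅ - l₄) = (l₁ - l₂)(l₃ - l₄)(l₅ - l₀),
-- which force l ∈ F_{q³} and then l ∈ F_q.
module Submission where

open import Defs
open import Algebra.Bundles using (CommutativeMonoid; CommutativeRing)
import Algebra.Properties.AbelianGroup as AbelianGroupProperties
import Algebra.Properties.CommutativeMonoid.Sum as MonoidSum
import Algebra.Properties.CommutativeSemiring.Binomial as Binomial
import Algebra.Properties.Monoid.Mult as MonoidMult
import Algebra.Properties.Monoid.Mult.TCOptimised as MonoidMultTC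
import Algebra.Properties.Ring as RingProperties
import Algebra.Properties.Semiring.Exp as SemiringExp
import Algebra.Properties.Semiring.Mult as SemiringMult
import Algebra.Properties.Semiring.Mult.TCOptimised as SemiringMultTC
import Algebra.Solver.Ring as RingSolver
import Algebra.Solver.Ring.AlmostCommutativeRing as ACR
open import Data.Bool using (Bool; true; false)
open import Data.Empty using (⊥; ⊥-elim)
open import Data.Fin as Fin using (Fin; zero; suc; toℕ; fromℕ; inject₁)
open import Data.Fin.Patterns using (0F; 1F; 2F; 3F; 4F; 5F)
open import Data.Fin.Permutation using (Permutation; _⟨$⟩ʳ_; permutation)
import Data.Fin.Properties as Fin
open import Data.Integer as ℤ using (ℤ) renaming (+_ to pos; -[1+_] to negsuc)
import Data.Integer.Properties as ℤ
open import Data.List as List using (List; []; _∷_; length; concatMap)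
open import Data.List.Membership.Propositional using (_∈_)
open import Data.List.Membership.Propositional.Properties using (∈-lookup; ∈-tabulate⁺; ∈-filter⁺; ∈-filter⁻; ∈-map⁺; ∈-map⁻; ∈-concatMap⁺; deduplicate-∈⇔)
import Data.List.Membership.Setoid.Properties as Membership
import Data.List.Properties as List
import Data.List.Relation.Unary.All as ListAll
open import Data.List.Relation.Unary.AllPairs using ([]; _∷_)
open import Data.List.Relation.Unary.Any as Any using (here; there)
import Data.List.Relation.Unary.Any.Properties as Any
open import Data.List.Relation.Unary.Unique.DecPropositional.Properties using (deduplicate-!)
open import Data.List.Relation.Unary.Unique.Propositional using (Unique)
import Data.List.Relation.Unary.Unique.Propositional.Properties as Unique
open import Data.Maybe using (just; nothing)
open import Data.Nat as ℕ using (ℕ; zero; suc; z≤n; s≤s; _!; _%_; _/_; _<_)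
open import Data.Nat.Combinatorics using (nCk≡n!/k![n-k]!; k![n∸k]!∣n!; nCn≡1) renaming (_C_ to _choose_)
open import Data.Nat.Divisibility using (_∣_; _∣?_; divides; ∣⇒≤; m∣m*n; n∣m*n; ∣-trans; ∣m∣n⇒∣m+n; ∣1⇒≡1)
open import Data.Nat.DivMod using (m≡m%n+[m/n]*n; m%n<n; m*[n/m]≡n)
open import Data.Nat.GCD using (gcd; gcd-greatest)
open import Data.Nat.Primality using (Prime; euclidsLemma; prime⇒nonZero; ¬prime[1])
import Data.Nat.Properties as ℕ
import Data.Nat.Solver as ℕSolver
open import Data.Product using (Σ; ∃-syntax; _×_; _,_; proj₁; proj₂)
open import Data.Sum using (_⊎_; inj₁; inj₂)
open import Data.Vec as Vec using (Vec; []; _∷_; _++_; _∷ʳ_; replicate; zipWith; concat; map)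
import Data.Vec.Functional as Functional
import Data.Vec.Properties as Vec
open import Data.Vec.Relation.Binary.Pointwise.Inductive using (Pointwise; []; _∷_)
open import Data.Vec.Relation.Unary.All using (All; []; _∷_)
open import Function.Base using (_∘_)
open import Function.Bundles using (_↔_; Inverse; Equivalence; mk↔ₛ′)
open import Function.Construct.Composition using (_↔-∘_)
open import Function.Construct.Symmetry using (↔-sym)
open import Function.Definitions using (Injective)
open import Relation.Binary.PropositionalEquality
open import Relation.Nullary using (¬_; Dec; yes; no)
open import Relation.Nullary.Decidable using (map′; ¬?; True; toWitness; from-yes)

-- Modulo 6 the exponents of the three families become 1 or 5, the pair {1, 5}, and one of {1, 4},
-- {2, 5}. None has a term in x or x^{q³}, so the diagonal of the matrix is -Qᵢ and its entries (i,
-- i+3) vanish. Rows and columns are permuted alike: indices with Pᵢ = 0 go last, and the zero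
-- coefficients of the target make the leading 3 × 3 block triangular.
--
-- Choosing X with all Qᵢ nonzero means avoiding six hyperplanes inside the space where the chosen
-- Pᵢ vanish. The obstacle is that some Qᵢ might vanish on that whole space. For exponents {1, 5}
-- this happens only if A = D = 0 or B = C = 0, and these cases get explicit points. For the other
-- pairs it never happens.
--
-- The root b enters through its conjugate b′ = -1 - b: the relations b + b′ = -1 and b b′ = -1
-- invert the system for the odd coordinates. Oddness of q enters as 2 ≠ 0, and together with the
-- residue modulo 5 it gives q ≥ 5. The field automorphism of a collineation is absorbed by
-- replacing b with its image, again a root in F_q.

module FieldRing (F : Field) where
  open Field F public

  commutativeRing : CommutativeRing _ _
  commutativeRing = record { isCommutativeRing = isCommutativeRing }

  open CommutativeRing commutativeRing public using
    ( +-assoc; +-comm; +-identityˡ; +-identityʳ; -‿inverseˡ; -‿inverseʳ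
    ; *-assoc; *-comm; *-identityˡ; *-identityʳ; distribˡ; distribʳ; zeroˡ; zeroʳ
    ; +-commutativeMonoid; *-commutativeMonoid; semiring; commutativeSemiring; ring; +-abelianGroup )
  open RingProperties ring public using (-‿distribˡ-*; -0#≈0#; -‿involutive)
  open SemiringMultTC semiring public using () renaming (_×_ to _⊠_; ×-homo-+ to ⊠-homo-+; ×1-homo-* to ⊠1-homo-*; 1+× to 1+⊠)

  -- With the optimised multiple, `1 ⊠ 1#` is `1#` itself rather than a sum with zero, so solver
  -- expressions containing `con (pos 1)` match goals definitionally.
  fromℤ : ℤ → K
  fromℤ (pos n)    = n ⊠ 1#
  fromℤ (negsuc n) = - (suc n ⊠ 1#)

  private
    open ≡-Reasoning
    -+ : ∀ x y → - (x + y) ≡ - x + - y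
    -+ x y = sym (AbelianGroupProperties.⁻¹-∙-comm +-abelianGroup x y)

    fromℤ-⊖ : ∀ m n → fromℤ (m ℤ.⊖ n) ≡ m ⊠ 1# + - (n ⊠ 1#)
    fromℤ-⊖ m zero = sym (trans (cong (m ⊠ 1# +_) -0#≈0#) (+-identityʳ _))
    fromℤ-⊖ zero (suc n) = sym (+-identityˡ _)
    fromℤ-⊖ (suc m) (suc n) = begin
      fromℤ (suc m ℤ.⊖ suc n) ≡⟨ cong fromℤ (ℤ.[1+m]⊖[1+n]≡m⊖n m n) ⟩
      fromℤ (m ℤ.⊖ n)         ≡⟨ fromℤ-⊖ m n ⟩
      x + - y                 ≡⟨ cong (x +_) (sym (+-identityˡ _)) ⟩
      x + (0# + - y)          ≡⟨ cong (λ z → x + (z + - y)) (sym (-‿inverseʳ 1#)) ⟩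
      x + (1# + - 1# + - y)   ≡⟨ cong (x +_) (+-assoc _ _ _) ⟩
      x + (1# + (- 1# + - y)) ≡⟨ sym (+-assoc _ _ _) ⟩
      x + 1# + (- 1# + - y)   ≡⟨ cong₂ _+_ (+-comm x 1#) (sym (-+ 1# y)) ⟩
      1# + x + - (1# + y)     ≡⟨ sym (cong₂ (λ a b → a + - b) (1+⊠ m 1#) (1+⊠ n 1#)) ⟩
      suc m ⊠ 1# + - (suc n ⊠ 1#) ∎
      where x = m ⊠ 1# ; y = n ⊠ 1#

    fromℤ-neg : ∀ i → fromℤ (ℤ.- i) ≡ - fromℤ i
    fromℤ-neg (pos zero)  = sym -0#≈0#
    fromℤ-neg (pos (suc n)) = refl
    fromℤ-neg (negsuc n)  = sym (-‿involutive _)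

    fromℤ-+ : ∀ i j → fromℤ (i ℤ.+ j) ≡ fromℤ i + fromℤ j
    fromℤ-+ (pos m) (pos n) = ⊠-homo-+ 1# m n
    fromℤ-+ (pos m) (negsuc n) = fromℤ-⊖ m (suc n)
    fromℤ-+ (negsuc m) (pos n) = trans (fromℤ-⊖ n (suc m)) (+-comm _ _)
    fromℤ-+ (negsuc m) (negsuc n) = begin
      - ((2 ℕ.+ (m ℕ.+ n)) ⊠ 1#)       ≡⟨ cong (λ k → - (k ⊠ 1#)) (cong suc (sym (ℕ.+-suc m n))) ⟩
      - ((suc m ℕ.+ suc n) ⊠ 1#)       ≡⟨ cong -_ (⊠-homo-+ 1# (suc m) (suc n)) ⟩
      - (suc m ⊠ 1# + suc n ⊠ 1#)      ≡⟨ -+ _ _ ⟩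
      - (suc m ⊠ 1#) + - (suc n ⊠ 1#)  ∎

    fromℤ-*⁺ : ∀ m j → fromℤ (pos m ℤ.* j) ≡ m ⊠ 1# * fromℤ j
    fromℤ-*⁺ zero j = sym (zeroˡ _)
    fromℤ-*⁺ (suc m) j = begin
      fromℤ (pos (suc m) ℤ.* j)                 ≡⟨ cong fromℤ (ℤ.suc-* (pos m) j) ⟩
      fromℤ (j ℤ.+ pos m ℤ.* j)               ≡⟨ fromℤ-+ j (pos m ℤ.* j) ⟩
      fromℤ j + fromℤ (pos m ℤ.* j)           ≡⟨ cong₂ _+_ (sym (*-identityˡ _)) (fromℤ-*⁺ m j) ⟩
      1# * fromℤ j + m ⊠ 1# * fromℤ j       ≡⟨ sym (distribʳ _ _ _) ⟩
      (1# + m ⊠ 1#) * fromℤ j               ≡⟨ cong (_* fromℤ j) (sym (1+⊠ m 1#)) ⟩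
      suc m ⊠ 1# * fromℤ j                  ∎

    fromℤ-* : ∀ i j → fromℤ (i ℤ.* j) ≡ fromℤ i * fromℤ j
    fromℤ-* (pos m) j = fromℤ-*⁺ m j
    fromℤ-* (negsuc m) j = begin
      fromℤ ((negsuc m) ℤ.* j)        ≡⟨ cong fromℤ (sym (ℤ.neg-distribˡ-* (pos (suc m)) j)) ⟩
      fromℤ (ℤ.- (pos (suc m) ℤ.* j))   ≡⟨ fromℤ-neg (pos (suc m) ℤ.* j) ⟩
      - fromℤ (pos (suc m) ℤ.* j)       ≡⟨ cong -_ (fromℤ-*⁺ (suc m) j) ⟩
      - (suc m ⊠ 1# * fromℤ j)      ≡⟨ -‿distribˡ-* _ _ ⟩
      - (suc m ⊠ 1#) * fromℤ j      ∎

    ℤ⟶K : ℤ.+-*-rawRing ACR.-Raw-AlmostCommutative⟶ ACR.fromCommutativeRing commutativeRing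
    ℤ⟶K = record
      { ⟦_⟧ = fromℤ ; +-homo = fromℤ-+ ; *-homo = fromℤ-* ; -‿homo = fromℤ-neg
      ; 0-homo = refl ; 1-homo = refl }

    coeff? : ∀ i j → _
    coeff? i j with i ℤ.≟ j
    ... | yes i≡j = just (cong fromℤ i≡j)
    ... | no _    = nothing

  module Solver = RingSolver ℤ.+-*-rawRing (ACR.fromCommutativeRing commutativeRing) ℤ⟶K coeff?

-- Powers and cancellation in a field.

module FieldPowers (F : Field) where
  open FieldRing F public
  open Solver using (solve; _:=_; _:+_; _:*_; _:-_; :-_; con)

  infixl 6 _-_
  _-_ : K → K → K
  x - y = x + - y

  infixr 8 _^_
  _^_ : K → ℕ → K
  _^_ = _^ᶠ_ F

  ^-+ : ∀ x m n → x ^ (m ℕ.+ n) ≡ x ^ m * x ^ n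
  ^-+ x zero n = sym (*-identityˡ _)
  ^-+ x (suc m) n = trans (cong (x *_) (^-+ x m n)) (sym (*-assoc _ _ _))

  ^-* : ∀ x m n → x ^ (m ℕ.* n) ≡ (x ^ n) ^ m
  ^-* x zero n = refl
  ^-* x (suc m) n = trans (^-+ x n (m ℕ.* n)) (cong (x ^ n *_) (^-* x m n))

  *-^ : ∀ x y n → (x * y) ^ n ≡ x ^ n * y ^ n
  *-^ x y zero = sym (*-identityˡ _)
  *-^ x y (suc n) = trans (cong (x * y *_) (*-^ x y n))
    (solve 4 (λ x y a b → x :* y :* (a :* b) := x :* a :* (y :* b)) refl x y _ _)

  1^ : ∀ n → 1# ^ n ≡ 1#
  1^ zero = refl
  1^ (suc n) = trans (*-identityˡ _) (1^ n)

  0^ : ∀ {n} → 0 ℕ.< n → 0# ^ n ≡ 0#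
  0^ (s≤s _) = zeroˡ _

  x-y≡0⇒x≡y : ∀ {x y} → x - y ≡ 0# → x ≡ y
  x-y≡0⇒x≡y {x} {y} p = trans (solve 2 (λ x y → x := x :- y :+ y) refl x y) (trans (cong (_+ y) p) (+-identityˡ y))

  x≡y⇒x-y≡0 : ∀ {x y} → x ≡ y → x - y ≡ 0#
  x≡y⇒x-y≡0 {x} refl = -‿inverseʳ x

  *-cancelˡ-0 : ∀ {x y} → ¬ x ≡ 0# → x * y ≡ 0# → y ≡ 0#
  *-cancelˡ-0 {x} {y} x≢0 xy≡0 with inverse x x≢0
  ... | x⁻¹ , p = begin
    y               ≡⟨ sym (*-identityˡ y) ⟩
    1# * y          ≡⟨ cong (_* y) (sym p) ⟩
    x * x⁻¹ * y     ≡⟨ solve 3 (λ x z y → x :* z :* y := z :* (x :* y)) refl x x⁻¹ y ⟩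
    x⁻¹ * (x * y)   ≡⟨ cong (x⁻¹ *_) xy≡0 ⟩
    x⁻¹ * 0#        ≡⟨ zeroʳ _ ⟩
    0#              ∎
    where open ≡-Reasoning

  *≢0 : ∀ {x y} → ¬ x ≡ 0# → ¬ y ≡ 0# → ¬ x * y ≡ 0#
  *≢0 x≢0 y≢0 xy≡0 = y≢0 (*-cancelˡ-0 x≢0 xy≡0)

  *-cancelˡ : ∀ {x y z} → ¬ x ≡ 0# → x * y ≡ x * z → y ≡ z
  *-cancelˡ {x} {y} {z} x≢0 p = x-y≡0⇒x≡y (*-cancelˡ-0 x≢0
    (trans (solve 3 (λ x y z → x :* (y :- z) := x :* y :- x :* z) refl x y z) (x≡y⇒x-y≡0 p)))

  ^≢0 : ∀ {x} n → ¬ x ≡ 0# → ¬ x ^ n ≡ 0#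
  ^≢0 zero x≢0 = 0≢1 ∘ sym
  ^≢0 (suc n) x≢0 = *≢0 x≢0 (^≢0 n x≢0)

  -≢0 : ∀ {x} → ¬ x ≡ 0# → ¬ - x ≡ 0#
  -≢0 x≢0 p = x≢0 (trans (sym (-‿involutive _)) (trans (cong -_ p) -0#≈0#))

-- Finite fields: n · 1 = 0 and xⁿ = x.

module FiniteField (F : Field) {n : ℕ} (enum : Fin n ↔ Field.K F) where
  open FieldPowers F
  open Inverse enum using (to; from; strictlyInverseˡ; strictlyInverseʳ)

  infix 4 _≟_
  _≟_ : (x y : K) → Dec (x ≡ y)
  x ≟ y = map′ (λ p → trans (sym (strictlyInverseˡ x)) (trans (cong to p) (strictlyInverseˡ y))) (cong from) (from x Fin.≟ from y)

  private
    translate : K ↔ K → Permutation n n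
    translate t = ↔-sym enum ↔-∘ (t ↔-∘ enum)

  -- The translation x ↦ x + 1 permutes the field, so it does not change the sum over all x.
  order⊠1≡0 : n ⊠ 1# ≡ 0#
  order⊠1≡0 = begin
    n ⊠ 1#                                   ≡⟨ solve 2 (λ s t → t := s :+ t :- s) refl (sum to) (n ⊠ 1#) ⟩
    sum to + n ⊠ 1# - sum to                 ≡⟨ cong (λ t → sum to + t - sum to) (sym (trans (sum-replicate n) (MonoidMultTC.×ᵤ≈× +-monoid n 1#))) ⟩
    sum to + sum (Functional.replicate n 1#) - sum to   ≡⟨ cong (_- sum to) (sym (∑-distrib-+ to (Functional.replicate n 1#))) ⟩
    sum (λ i → to i + 1#) - sum to           ≡⟨ cong (_- sum to) (sym (sum-cong-≗ {n} (λ i → strictlyInverseˡ (to i + 1#)))) ⟩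
    sum (λ i → to (from (to i + 1#))) - sum to ≡⟨ cong (_- sum to) (sym (sum-permute to (translate +1))) ⟩
    sum to - sum to                          ≡⟨ -‿inverseʳ _ ⟩
    0#                                       ∎
    where
    open ≡-Reasoning
    open MonoidSum +-commutativeMonoid
    open CommutativeMonoid +-commutativeMonoid using () renaming (monoid to +-monoid)
    open Solver using (solve; _:=_; _:+_; _:*_; _:-_; :-_; con)
    +1 : K ↔ K
    +1 = mk↔ₛ′ (_+ 1#) (_- 1#)
      (λ x → solve 1 (λ x → x :- con (pos 1) :+ con (pos 1) := x) refl x)
      (λ x → solve 1 (λ x → x :+ con (pos 1) :- con (pos 1) := x) refl x)

  private
    module _ (a : K) (a≢0 : ¬ a ≡ 0#) where
      open MonoidSum *-commutativeMonoid renaming (sum to ∏)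
      open CommutativeMonoid *-commutativeMonoid using () renaming (monoid to *-monoid)
      open ≡-Reasoning
      open Solver using (solve; _:=_; _:+_; _:*_; _:-_; :-_; con)

      if0 : K → K → K → K
      if0 u v y with y ≟ 0#
      ... | yes _ = u
      ... | no  _ = v

      if0-yes : ∀ u v {y} → y ≡ 0# → if0 u v y ≡ u
      if0-yes u v {y} p with y ≟ 0#
      ... | yes _ = refl
      ... | no ¬p = ⊥-elim (¬p p)

      if0-no : ∀ u v {y} → ¬ y ≡ 0# → if0 u v y ≡ v
      if0-no u v {y} ¬p with y ≟ 0#
      ... | yes p = ⊥-elim (¬p p)
      ... | no _ = refl

      -- Replacing 0 by 1 lets a product over the whole field stand for the product of its nonzero
      -- elements, which can be cancelled.
      h : K → K
      h y = if0 1# y y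

      h≢0 : ∀ y → ¬ h y ≡ 0#
      h≢0 y with y ≟ 0#
      ... | yes _ = 0≢1 ∘ sym
      ... | no p = p

      ∏≢0 : ∀ {m} (t : Fin m → K) → (∀ i → ¬ t i ≡ 0#) → ¬ ∏ t ≡ 0#
      ∏≢0 {zero} t p = 0≢1 ∘ sym
      ∏≢0 {suc m} t p = *≢0 (p Fin.zero) (∏≢0 (t ∘ Fin.suc) (p ∘ Fin.suc))

      h-* : ∀ y → h (a * y) ≡ if0 1# a y * h y
      h-* y with y ≟ 0#
      ... | yes p = trans (if0-yes 1# (a * y) (trans (cong (a *_) p) (zeroʳ a))) (sym (*-identityˡ _))
      ... | no p  = if0-no 1# (a * y) (*≢0 a≢0 p)

      a* : K ↔ K
      a* with inverse a a≢0
      ... | a⁻¹ , p = mk↔ₛ′ (a *_) (a⁻¹ *_)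
          (λ x → trans (sym (*-assoc a a⁻¹ x)) (trans (cong (_* x) p) (*-identityˡ x)))
          (λ x → trans (sym (*-assoc a⁻¹ a x)) (trans (cong (_* x) (trans (*-comm a⁻¹ a) p)) (*-identityˡ x)))

      to-a* : ∀ x → Inverse.to a* x ≡ a * x
      to-a* x with inverse a a≢0
      ... | _ , _ = refl

      -- Multiplication by a permutes the field, so the product of the nonzero elements is unchanged
      -- although each factor gains an a. This is a^{n-1} = 1.
      ∏if0≡1 : ∏ (if0 1# a ∘ to) ≡ 1#
      ∏if0≡1 = sym (*-cancelˡ (∏≢0 (h ∘ to) (λ i → h≢0 (to i))) (begin
        ∏ (h ∘ to) * 1#                      ≡⟨ *-identityʳ _ ⟩
        ∏ (h ∘ to)                           ≡⟨ sum-permute (h ∘ to) (translate a*) ⟩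
        ∏ (λ i → h (to (from (Inverse.to a* (to i))))) ≡⟨ sum-cong-≗ {n} (λ i → cong h (trans (strictlyInverseˡ _) (to-a* (to i)))) ⟩
        ∏ (λ i → h (a * to i))               ≡⟨ sum-cong-≗ {n} (h-* ∘ to) ⟩
        ∏ (λ i → if0 1# a (to i) * h (to i)) ≡⟨ ∑-distrib-+ {n} _ _ ⟩
        ∏ (if0 1# a ∘ to) * ∏ (h ∘ to)       ≡⟨ *-comm _ _ ⟩
        ∏ (h ∘ to) * ∏ (if0 1# a ∘ to)       ∎))

      ∏-single : ∀ {m} (t : Fin m → K) i → (∀ j → ¬ j ≡ i → t j ≡ 1#) → ∏ t ≡ t i
      ∏-single {suc m} t i p = begin
        ∏ t                                            ≡⟨ sum-remove {i = i} t ⟩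
        t i * ∏ (λ j → t (Fin.punchIn i j))            ≡⟨ cong (t i *_) (sum-cong-≗ {m} (λ j → p _ (λ q → Fin.punchInᵢ≢i i j q))) ⟩
        t i * ∏ (Functional.replicate m 1#)                       ≡⟨ cong (t i *_) (sum-replicate-zero m) ⟩
        t i * 1#                                       ≡⟨ *-identityʳ _ ⟩
        t i                                            ∎

      -- The n factors a split into the n - 1 at nonzero elements, whose product is 1, and the
      -- single one at 0.
      ^order : a ^ n ≡ a
      ^order = begin
        a ^ n                                        ≡⟨ sym (trans (sum-replicate n) (pow n)) ⟩
        ∏ (Functional.replicate n a)                            ≡⟨ sum-cong-≗ {n} (sym ∘ both ∘ to) ⟩
        ∏ (λ i → if0 1# a (to i) * if0 a 1# (to i))  ≡⟨ ∑-distrib-+ {n} _ _ ⟩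
        ∏ (if0 1# a ∘ to) * ∏ (if0 a 1# ∘ to)        ≡⟨ cong₂ _*_ ∏if0≡1 (∏-single (if0 a 1# ∘ to) (from 0#) other) ⟩
        1# * if0 a 1# (to (from 0#))                 ≡⟨ *-identityˡ _ ⟩
        if0 a 1# (to (from 0#))                      ≡⟨ if0-yes a 1# (strictlyInverseˡ 0#) ⟩
        a                                            ∎
        where
        open MonoidMult *-monoid using () renaming (_×_ to _⊗_)
        pow : ∀ m → m ⊗ a ≡ a ^ m
        pow zero = refl
        pow (suc m) = cong (a *_) (pow m)
        both : ∀ y → if0 1# a y * if0 a 1# y ≡ a
        both y with y ≟ 0#
        ... | yes _ = *-identityˡ a
        ... | no  _ = *-identityʳ a
        other : ∀ j → ¬ j ≡ from 0# → if0 a 1# (to j) ≡ 1#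
        other j j≢ = if0-no a 1# (λ p → j≢ (trans (sym (strictlyInverseʳ j)) (cong from p)))

  x^order≡x : ∀ x → x ^ n ≡ x
  x^order≡x x with x ≟ 0#
  ... | no x≢0 = ^order x x≢0
  ... | yes refl = 0^ (ℕ.≤-<-trans z≤n (Fin.toℕ<n (from 0#)))

-- Binomial coefficients modulo a prime and additivity of the Frobenius map.

prime∣p! : ∀ {p} → Prime p → p ∣ p !
prime∣p! {suc p} _ = m∣m*n (p !)
prime∣p! {zero} p-prime = ⊥-elim (ℕ.≢-nonZero⁻¹ 0 {{prime⇒nonZero p-prime}} refl)

prime∤! : ∀ {p} → Prime p → ∀ k → k ℕ.< p → ¬ p ∣ k !
prime∤! p-prime zero k<p p∣1 = ¬prime[1] (subst Prime (∣1⇒≡1 p∣1) p-prime)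
prime∤! p-prime (suc k) k<p p∣ with euclidsLemma (suc k) (k !) p-prime p∣
... | inj₁ p∣k = ℕ.<⇒≱ k<p (∣⇒≤ p∣k)
... | inj₂ p∣k! = prime∤! p-prime k (ℕ.<-trans (ℕ.n<1+n k) k<p) p∣k!

-- In p! = k! (p - k)! C the prime p divides the left side but neither factorial on the right.
prime∣binomial : ∀ {p} → Prime p → ∀ {k} → 0 ℕ.< k → k ℕ.< p → p ∣ p choose k
prime∣binomial {p} p-prime {k} 0<k k<p
  with euclidsLemma (k ! ℕ.* (p ℕ.∸ k) !) (p choose k) p-prime (subst (p ∣_) (sym eq) (prime∣p! p-prime))
  where
  k≤p = ℕ.<⇒≤ k<p
  instance _ = k ℕ.!* (p ℕ.∸ k) !≢0
  eq : k ! ℕ.* (p ℕ.∸ k) ! ℕ.* (p choose k) ≡ p !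
  eq = trans (cong (k ! ℕ.* (p ℕ.∸ k) ! ℕ.*_) (nCk≡n!/k![n-k]! k≤p)) (m*[n/m]≡n (k![n∸k]!∣n! k≤p))
... | inj₂ p∣C = p∣C
... | inj₁ p∣* with euclidsLemma (k !) ((p ℕ.∸ k) !) p-prime p∣*
... | inj₁ p∣k! = ⊥-elim (prime∤! p-prime k k<p p∣k!)
... | inj₂ p∣! = ⊥-elim (prime∤! p-prime (p ℕ.∸ k) (ℕ.∸-monoʳ-< 0<k (ℕ.<⇒≤ k<p)) p∣!)

module Characteristic (F : Field) {p : ℕ} (p-prime : Prime p)
  (p⊠1≡0 : FieldRing._⊠_ F p (Field.1# F) ≡ Field.0# F) where
  open FieldPowers F
  open Solver using (solve; _:=_; _:+_; _:*_; _:-_; :-_; con)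

  private
    open Binomial commutativeSemiring using (theorem; binomialTerm; binomialExpansion)
    open MonoidSum +-commutativeMonoid
    open CommutativeMonoid +-commutativeMonoid using () renaming (monoid to +-monoid)
    open MonoidMult +-monoid using (×-homo-1) renaming (_×_ to _⊡_)
    open SemiringExp semiring using () renaming (_^_ to _^ₛ_)
    open SemiringMult semiring using () renaming (×-assoc-* to ⊡-assoc-*)
    open ≡-Reasoning

    multiple≡0 : ∀ {m} → p ∣ m → ∀ x → m ⊡ x ≡ 0#
    multiple≡0 (divides m refl) x = begin
      (m ℕ.* p) ⊡ x                     ≡⟨ MonoidMultTC.×ᵤ≈× +-monoid (m ℕ.* p) x ⟩
      (m ℕ.* p) ⊠ x                     ≡⟨ cong ((m ℕ.* p) ⊠_) (sym (*-identityˡ x)) ⟩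
      (m ℕ.* p) ⊠ (1# * x)              ≡⟨ sym (MonoidMultTC.×ᵤ≈× +-monoid (m ℕ.* p) _) ⟩
      (m ℕ.* p) ⊡ (1# * x)              ≡⟨ sym (⊡-assoc-* (m ℕ.* p) 1# x) ⟩
      (m ℕ.* p) ⊡ 1# * x                ≡⟨ cong (_* x) (MonoidMultTC.×ᵤ≈× +-monoid (m ℕ.* p) _) ⟩
      (m ℕ.* p) ⊠ 1# * x                ≡⟨ cong (_* x) (⊠1-homo-* m p) ⟩
      m ⊠ 1# * p ⊠ 1# * x               ≡⟨ cong (λ z → m ⊠ 1# * z * x) p⊠1≡0 ⟩
      m ⊠ 1# * 0# * x                   ≡⟨ solve 2 (λ m x → m :* con (pos 0) :* x := con (pos 0)) refl (m ⊠ 1#) x ⟩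
      0#                                ∎

    ^≡^ₛ : ∀ x m → x ^ m ≡ x ^ₛ m
    ^≡^ₛ x zero = refl
    ^≡^ₛ x (suc m) = cong (x *_) (^≡^ₛ x m)

    ends : ∀ {m} (t : Fin (suc (suc m)) → K) → (∀ i → t (Fin.suc (inject₁ i)) ≡ 0#) → sum t ≡ t Fin.zero + t (fromℕ (suc m))
    ends {m} t z = cong (t Fin.zero +_) (begin
      sum (t ∘ Fin.suc)                       ≡⟨ sum-init-last (t ∘ Fin.suc) ⟩
      sum (Functional.init (t ∘ Fin.suc)) + t (fromℕ (suc m)) ≡⟨ cong (_+ t (fromℕ (suc m))) (trans (sum-cong-≗ {m} z) (sum-replicate-zero m)) ⟩
      0# + t (fromℕ (suc m))                  ≡⟨ +-identityˡ _ ⟩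
      t (fromℕ (suc m))                       ∎)

    -- Every inner term of the binomial expansion has a coefficient divisible by p. Writing p as a
    -- double successor exposes the two end terms, which survive.
    frobenius : ∀ {m} → p ≡ suc (suc m) → ∀ x y → (x + y) ^ p ≡ x ^ p + y ^ p
    frobenius {m} refl x y = begin
      (x + y) ^ p                ≡⟨ ^≡^ₛ _ p ⟩
      (x + y) ^ₛ p               ≡⟨ theorem p x y ⟩
      binomialExpansion x y p    ≡⟨ ends (binomialTerm x y p) (λ i → multiple≡0 (prime∣binomial p-prime (s≤s z≤n) (s≤s (subst (ℕ._≤ suc m) (cong suc (sym (Fin.toℕ-inject₁ i))) (Fin.toℕ<n i)))) _) ⟩
      1 ⊡ (1# * y ^ₛ p) + (p choose toℕ (fromℕ p)) ⊡ (x ^ₛ toℕ (fromℕ p) * y ^ₛ (p ℕ.∸ toℕ (fromℕ p)))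
        ≡⟨ cong₂ (λ a k → a + (p choose k) ⊡ (x ^ₛ k * y ^ₛ (p ℕ.∸ k))) (trans (×-homo-1 _) (*-identityˡ _)) (Fin.toℕ-fromℕ p) ⟩
      y ^ₛ p + (p choose p) ⊡ (x ^ₛ p * y ^ₛ (p ℕ.∸ p))  ≡⟨ cong₂ (λ c k → y ^ₛ p + c ⊡ (x ^ₛ p * y ^ₛ k)) (nCn≡1 p) (ℕ.n∸n≡0 p) ⟩
      y ^ₛ p + 1 ⊡ (x ^ₛ p * 1#)      ≡⟨ cong (y ^ₛ p +_) (trans (×-homo-1 _) (*-identityʳ _)) ⟩
      y ^ₛ p + x ^ₛ p                 ≡⟨ +-comm _ _ ⟩
      x ^ₛ p + y ^ₛ p                 ≡⟨ cong₂ _+_ (sym (^≡^ₛ x p)) (sym (^≡^ₛ y p)) ⟩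
      x ^ p + y ^ p                   ∎

  ^p-+ : ∀ x y → (x + y) ^ p ≡ x ^ p + y ^ p
  ^p-+ = go p refl
    where
    go : ∀ m → p ≡ m → ∀ x y → (x + y) ^ p ≡ x ^ p + y ^ p
    go zero refl = ⊥-elim (ℕ.≢-nonZero⁻¹ 0 {{prime⇒nonZero p-prime}} refl)
    go (suc zero) refl = ⊥-elim (¬prime[1] p-prime)
    go (suc (suc m)) eq = frobenius eq

  ^p^k-+ : ∀ k x y → (x + y) ^ (p ℕ.^ k) ≡ x ^ (p ℕ.^ k) + y ^ (p ℕ.^ k)
  ^p^k-+ zero x y = solve 2 (λ x y → (x :+ y) :* con (pos 1) := x :* con (pos 1) :+ y :* con (pos 1)) refl x y
  ^p^k-+ (suc k) x y = begin
    (x + y) ^ (p ℕ.* p ℕ.^ k)              ≡⟨ ^-* (x + y) p (p ℕ.^ k) ⟩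
    ((x + y) ^ (p ℕ.^ k)) ^ p              ≡⟨ cong (_^ p) (^p^k-+ k x y) ⟩
    (x ^ (p ℕ.^ k) + y ^ (p ℕ.^ k)) ^ p    ≡⟨ ^p-+ _ _ ⟩
    (x ^ (p ℕ.^ k)) ^ p + (y ^ (p ℕ.^ k)) ^ p ≡⟨ sym (cong₂ _+_ (^-* x p (p ℕ.^ k)) (^-* y p (p ℕ.^ k))) ⟩
    x ^ (p ℕ.* p ℕ.^ k) + y ^ (p ℕ.* p ℕ.^ k) ∎

-- Polynomials of bounded degree, their roots, and the substitution of conjugates.

module Polynomials (F : Field) where
  open FieldPowers F
  open Solver using (solve; _:=_; _:+_; _:*_; _:-_; :-_; con)
  open ≡-Reasoning

  evalU : ∀ {m} → Vec K m → K → K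
  evalU [] x = 0#
  evalU (c ∷ cs) x = c + x * evalU cs x

  -- Synthetic division by x - a: the coefficients of the quotient are the intermediate values of
  -- Horner's scheme at a.
  quotient : ∀ {m} → K → Vec K (suc m) → Vec K m
  quotient a (c ∷ []) = []
  quotient a (c ∷ cs@(_ ∷ _)) = evalU cs a ∷ quotient a cs

  evalU-quotient : ∀ {m} a (p : Vec K (suc m)) x → evalU p x ≡ evalU p a + (x - a) * evalU (quotient a p) x
  evalU-quotient a (c ∷ []) x = solve 3 (λ a c x → c :+ x :* :0 := c :+ a :* :0 :+ (x :- a) :* :0) refl a c x
    where :0 = con (pos 0)
  evalU-quotient a (c ∷ cs@(_ ∷ _)) x = trans (cong (λ y → c + x * y) (evalU-quotient a cs x))
    (solve 5 (λ a c x p q → c :+ x :* (p :+ (x :- a) :* q) := c :+ a :* p :+ (x :- a) :* (p :+ x :* q)) refl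
      a c x (evalU cs a) (evalU (quotient a cs) x))

  quotient≡0⇒≡0 : ∀ {m} a (p : Vec K (suc m)) → evalU p a ≡ 0# → quotient a p ≡ replicate _ 0# → p ≡ replicate _ 0#
  quotient≡0⇒≡0 a (c ∷ []) pa≡0 _ = cong (_∷ []) (trans (sym (+-identityʳ c)) (trans (cong (c +_) (sym (zeroʳ a))) pa≡0))
  quotient≡0⇒≡0 a (c ∷ cs@(_ ∷ _)) pa≡0 q≡0 = cong₂ _∷_
    (begin
      c                    ≡⟨ sym (+-identityʳ c) ⟩
      c + 0#               ≡⟨ cong (c +_) (sym (zeroʳ a)) ⟩
      c + a * 0#           ≡⟨ cong (λ y → c + a * y) (sym csa≡0) ⟩
      c + a * evalU cs a   ≡⟨ pa≡0 ⟩
      0#                   ∎)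
    (quotient≡0⇒≡0 a cs csa≡0 (cong Vec.tail q≡0))
    where csa≡0 = cong Vec.head q≡0

  -- A vector of m coefficients has degree below m. Dividing by x minus the first root leaves m - 1
  -- coefficients and the remaining roots.
  manyRoots⇒≡0 : ∀ {m} (p : Vec K m) (r : Fin m → K) → Injective _≡_ _≡_ r → (∀ i → evalU p (r i) ≡ 0#) → p ≡ replicate m 0#
  manyRoots⇒≡0 {zero} [] r r-inj roots = refl
  manyRoots⇒≡0 {suc m} p r r-inj roots = quotient≡0⇒≡0 a p (roots Fin.zero)
    (manyRoots⇒≡0 (quotient a p) (r ∘ Fin.suc) (Fin.suc-injective ∘ r-inj) (λ i →
      *-cancelˡ-0 (λ r≡a → Fin.0≢1+n (sym (r-inj (x-y≡0⇒x≡y r≡a)))) (begin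
        (r (Fin.suc i) - a) * evalU (quotient a p) (r (Fin.suc i))                ≡⟨ sym (+-identityˡ _) ⟩
        0# + (r (Fin.suc i) - a) * evalU (quotient a p) (r (Fin.suc i))           ≡⟨ cong (_+ (r (Fin.suc i) - a) * evalU (quotient a p) (r (Fin.suc i))) (sym (roots Fin.zero)) ⟩
        evalU p a + (r (Fin.suc i) - a) * evalU (quotient a p) (r (Fin.suc i))    ≡⟨ sym (evalU-quotient a p _) ⟩
        evalU p (r (Fin.suc i))                                                   ≡⟨ roots (Fin.suc i) ⟩
        0#                                                                        ∎)))
    where a = r Fin.zero

  evalU-++ : ∀ {m n} (u : Vec K m) (v : Vec K n) x → evalU (u ++ v) x ≡ evalU u x + x ^ m * evalU v x
  evalU-++ [] v x = sym (trans (+-identityˡ _) (*-identityˡ _))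
  evalU-++ {suc m} (c ∷ u) v x = trans (cong (λ y → c + x * y) (evalU-++ u v x))
    (solve 5 (λ c x y z w → c :+ x :* (y :+ z :* w) := c :+ x :* y :+ x :* z :* w) refl c x _ (x ^ m) _)

  module _ (q : ℕ) where

    -- Polynomials in n variables of degree < q in each of them.
    Nested : ℕ → Set
    Nested zero = K
    Nested (suc n) = Vec (Nested n) q

    evalN : ∀ n → Nested n → Vec K n → K
    evalH : ∀ n {m} → Vec (Nested n) m → K → Vec K n → K
    evalN zero c [] = c
    evalN (suc n) cs (x ∷ X) = evalH n cs x X
    evalH n [] x X = 0#
    evalH n (c ∷ cs) x X = evalN n c X + x * evalH n cs x X

    -- Kronecker substitution on coefficients: replacing Xᵢ by x^{qⁱ} places the blocks side by
    -- side, without overlap because all degrees are below q.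
    flatten : ∀ n → Nested n → Vec K (q ℕ.^ n)
    flatten zero c = c ∷ []
    flatten (suc n) cs = concat (map (flatten n) cs)

    -- The highest conjugate comes first: the outermost variable of a nested polynomial is the most
    -- significant base-q digit of the flattened exponent.
    conjugates : ∀ n → K → Vec K n
    conjugates zero x = []
    conjugates (suc n) x = x ^ (q ℕ.^ n) ∷ conjugates n x

    -- Base-q digits: the exponents Σ eᵢ qⁱ with eᵢ < q are pairwise distinct.
    evalU-flatten : ∀ n c x → evalU (flatten n c) x ≡ evalN n c (conjugates n x)
    evalU-concat : ∀ n {m} (cs : Vec (Nested n) m) x →
      evalU (concat (map (flatten n) cs)) x ≡ evalH n cs (x ^ (q ℕ.^ n)) (conjugates n x)
    evalU-flatten zero c x = trans (cong (c +_) (zeroʳ x)) (+-identityʳ c)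
    evalU-flatten (suc n) cs x = evalU-concat n cs x
    evalU-concat n [] x = refl
    evalU-concat n (c ∷ cs) x = trans (evalU-++ (flatten n c) _ x)
      (cong₂ (λ a b → a + x ^ (q ℕ.^ n) * b) (evalU-flatten n c x) (evalU-concat n cs x))

    evalN-zero : ∀ n c → flatten n c ≡ replicate _ 0# → ∀ X → evalN n c X ≡ 0#
    evalH-zero : ∀ n {m} (cs : Vec (Nested n) m) → concat (map (flatten n) cs) ≡ replicate _ 0# → ∀ x X → evalH n cs x X ≡ 0#
    evalN-zero zero c p [] = cong Vec.head p
    evalN-zero (suc n) cs p (x ∷ X) = evalH-zero n cs p x X
    evalH-zero n [] p x X = refl
    evalH-zero n (c ∷ cs) p x X = trans
      (cong₂ (λ a b → a + x * b)
        (evalN-zero n c (++-replicateˡ (flatten n c) _ p) X)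
        (evalH-zero n cs (++-replicateʳ (flatten n c) _ p) x X))
      (trans (+-identityˡ _) (zeroʳ x))
      where
      ++-replicateˡ : ∀ {k l} (u : Vec K k) (v : Vec K l) → u ++ v ≡ replicate _ 0# → u ≡ replicate _ 0#
      ++-replicateˡ [] v p = refl
      ++-replicateˡ (a ∷ u) v p = cong₂ _∷_ (cong Vec.head p) (++-replicateˡ u v (cong Vec.tail p))
      ++-replicateʳ : ∀ {k l} (u : Vec K k) (v : Vec K l) → u ++ v ≡ replicate _ 0# → v ≡ replicate _ 0#
      ++-replicateʳ [] v p = p
      ++-replicateʳ (a ∷ u) v p = ++-replicateʳ u v (cong Vec.tail p)

    addN : ∀ n → Nested n → Nested n → Nested n
    addN zero = _+_
    addN (suc n) = zipWith (addN n)

    evalN-add : ∀ n c d X → evalN n (addN n c d) X ≡ evalN n c X + evalN n d X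
    evalH-add : ∀ n {m} (cs ds : Vec (Nested n) m) x X → evalH n (zipWith (addN n) cs ds) x X ≡ evalH n cs x X + evalH n ds x X
    evalN-add zero c d [] = refl
    evalN-add (suc n) cs ds (x ∷ X) = evalH-add n cs ds x X
    evalH-add n [] [] x X = sym (+-identityˡ _)
    evalH-add n (c ∷ cs) (d ∷ ds) x X = trans (cong₂ (λ a b → a + x * b) (evalN-add n c d X) (evalH-add n cs ds x X))
      (solve 5 (λ a b x c d → a :+ b :+ x :* (c :+ d) := a :+ x :* c :+ (b :+ x :* d)) refl _ _ x _ _)

    monomial : ∀ {n} → K → Vec ℕ n → Vec K n → K
    monomial c [] [] = c
    monomial c (e ∷ es) (x ∷ X) = x ^ e * monomial c es X

    zeroN : ∀ n → Nested n
    zeroN zero = 0#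
    zeroN (suc n) = replicate q (zeroN n)

    evalN-zeroN : ∀ n X → evalN n (zeroN n) X ≡ 0#
    evalH-zeroN : ∀ n m x X → evalH n (replicate m (zeroN n)) x X ≡ 0#
    evalN-zeroN zero [] = refl
    evalN-zeroN (suc n) (x ∷ X) = evalH-zeroN n q x X
    evalH-zeroN n zero x X = refl
    evalH-zeroN n (suc m) x X = trans (cong₂ (λ a b → a + x * b) (evalN-zeroN n X) (evalH-zeroN n m x X)) (trans (+-identityˡ _) (zeroʳ x))

    monomialN : ∀ {n} → K → (e : Vec ℕ n) → All (ℕ._< q) e → Nested n
    monomialH : ∀ {n} {m} → K → (es : Vec ℕ n) → All (ℕ._< q) es → ∀ e → e ℕ.< m → Vec (Nested n) m
    monomialN c [] [] = c
    monomialN c (e ∷ es) (e<q ∷ b) = monomialH c es b e e<q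
    monomialH {n} {suc m} c es b zero _ = monomialN c es b ∷ replicate m (zeroN n)
    monomialH {n} {suc m} c es b (suc e) (s≤s e<m) = zeroN n ∷ monomialH c es b e e<m

    evalN-monomial : ∀ {n} c (e : Vec ℕ n) b X → evalN n (monomialN c e b) X ≡ monomial c e X
    evalH-monomial : ∀ {n m} c (es : Vec ℕ n) b e (e<m : e ℕ.< m) x X → evalH n (monomialH c es b e e<m) x X ≡ x ^ e * monomial c es X
    evalN-monomial c [] [] [] = refl
    evalN-monomial c (e ∷ es) (e<q ∷ b) (x ∷ X) = evalH-monomial c es b e e<q x X
    evalH-monomial {n} {suc m} c es b zero e<m x X = trans (cong₂ (λ a b → a + x * b) (evalN-monomial c es b X) (evalH-zeroN n m x X))
      (solve 2 (λ a x → a :+ x :* con (pos 0) := con (pos 1) :* a) refl _ x)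
    evalH-monomial {n} {suc m} c es b (suc e) (s≤s e<m) x X = trans (cong₂ (λ a b → a + x * b) (evalN-zeroN n X) (evalH-monomial c es b e e<m x X))
      (trans (+-identityˡ _) (sym (*-assoc _ _ _)))

    -- A function is certified as polynomial by a sum of monomials that agrees with it pointwise, so
    -- a determinant never has to be expanded into a normal form. The bound `ds` limits the degree
    -- in each variable separately.
    data PolyFn {n} (ds : Vec ℕ n) : (Vec K n → K) → Set where
      mono : ∀ {f} c e → Pointwise ℕ._≤_ e ds → (∀ X → monomial c e X ≡ f X) → PolyFn ds f
      add  : ∀ {f g h} → PolyFn ds f → PolyFn ds g → (∀ X → f X + g X ≡ h X) → PolyFn ds h

    polyFn⇒nested : ∀ {n} {ds : Vec ℕ n} {f} → All (ℕ._< q) ds → PolyFn ds f → Σ (Nested n) λ c → ∀ X → evalN n c X ≡ f X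
    polyFn⇒nested ds<q (mono c e e≤ds eq) = monomialN c e (bound e≤ds ds<q) , λ X → trans (evalN-monomial c e _ X) (eq X)
      where
      bound : ∀ {n} {e d : Vec ℕ n} → Pointwise ℕ._≤_ e d → All (ℕ._< q) d → All (ℕ._< q) e
      bound [] [] = []
      bound (p ∷ ps) (b ∷ bs) = ℕ.≤-<-trans p b ∷ bound ps bs
    polyFn⇒nested {n} ds<q (add p p′ eq) with polyFn⇒nested ds<q p | polyFn⇒nested ds<q p′
    ... | c , f | d , g = addN n c d , λ X → trans (evalN-add n c d X) (trans (cong₂ _+_ (f X) (g X)) (eq X))

    -- The flattened polynomial has qⁿ coefficients and vanishes at the qⁿ distinct elements listed
    -- by `r`. All its coefficients are therefore zero, and they are the coefficients of `f` itself.
    vanishing : ∀ {n} {ds : Vec ℕ n} {f} → All (ℕ._< q) ds → PolyFn ds f →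
      (r : Fin (q ℕ.^ n) → K) → Injective _≡_ _≡_ r → (∀ x → f (conjugates n x) ≡ 0#) → ∀ X → f X ≡ 0#
    vanishing {n} ds<q p r r-inj f≡0 X with polyFn⇒nested ds<q p
    ... | c , eq = trans (sym (eq X)) (evalN-zero n c
      (manyRoots⇒≡0 (flatten n c) r r-inj (λ i → trans (evalU-flatten n c (r i)) (trans (eq _) (f≡0 (r i))))) X)

    polyFn-ext : ∀ {n} {ds : Vec ℕ n} {f g} → PolyFn ds f → (∀ X → f X ≡ g X) → PolyFn ds g
    polyFn-ext (mono c e b eq) p = mono c e b (λ X → trans (eq X) (p X))
    polyFn-ext (add a b eq) p = add a b (λ X → trans (eq X) (p X))

    polyFn-+ : ∀ {n} {ds : Vec ℕ n} {f g} → PolyFn ds f → PolyFn ds g → PolyFn ds (λ X → f X + g X)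
    polyFn-+ p p′ = add p p′ (λ X → refl)

    polyFn-* : ∀ {n} {ds es : Vec ℕ n} {f g} → PolyFn ds f → PolyFn es g → PolyFn (zipWith ℕ._+_ ds es) (λ X → f X * g X)
    polyFn-* (mono c e b eq) (mono c′ e′ b′ eq′) = mono (c * c′) (zipWith ℕ._+_ e e′) (+≤ b b′)
      (λ X → trans (monomial-* c c′ e e′ X) (cong₂ _*_ (eq X) (eq′ X)))
      where
      +≤ : ∀ {n} {d d′ e e′ : Vec ℕ n} → Pointwise ℕ._≤_ e d → Pointwise ℕ._≤_ e′ d′ → Pointwise ℕ._≤_ (zipWith ℕ._+_ e e′) (zipWith ℕ._+_ d d′)
      +≤ [] [] = []
      +≤ (p ∷ ps) (q ∷ qs) = ℕ.+-mono-≤ p q ∷ +≤ ps qs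
      monomial-* : ∀ {n} c c′ (e e′ : Vec ℕ n) X → monomial (c * c′) (zipWith ℕ._+_ e e′) X ≡ monomial c e X * monomial c′ e′ X
      monomial-* c c′ [] [] [] = refl
      monomial-* c c′ (e ∷ es) (e′ ∷ es′) (x ∷ X) = trans (cong₂ _*_ (^-+ x e e′) (monomial-* c c′ es es′ X))
        (solve 4 (λ a b c d → a :* b :* (c :* d) := a :* c :* (b :* d)) refl (x ^ e) (x ^ e′) _ _)
    polyFn-* p@(mono _ _ _ _) (add r s eq) = add (polyFn-* p r) (polyFn-* p s)
      (λ X → trans (sym (distribˡ _ _ _)) (cong (_ *_) (eq X)))
    polyFn-* (add r s eq) p = add (polyFn-* r p) (polyFn-* s p)
      (λ X → trans (sym (distribʳ _ _ _)) (cong (_* _) (eq X)))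

    polyFn-scale : ∀ {n} {ds : Vec ℕ n} {f} a → PolyFn ds f → PolyFn ds (λ X → a * f X)
    polyFn-scale a (add p p′ eq) = add (polyFn-scale a p) (polyFn-scale a p′) (λ X → trans (sym (distribˡ _ _ _)) (cong (a *_) (eq X)))
    polyFn-scale a (mono c e b eq) = mono (a * c) e b (λ X → trans (go e X) (cong (a *_) (eq X)))
      where
      go : ∀ {n} (e : Vec ℕ n) X → monomial (a * c) e X ≡ a * monomial c e X
      go [] [] = refl
      go (e ∷ es) (x ∷ X) = trans (cong (x ^ e *_) (go es X)) (solve 3 (λ x a c → x :* (a :* c) := a :* (x :* c)) refl (x ^ e) a _)

    polyFn-neg : ∀ {n} {ds : Vec ℕ n} {f} → PolyFn ds f → PolyFn ds (λ X → - f X)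
    polyFn-neg p = polyFn-ext (polyFn-scale (- 1#) p) (λ X → solve 1 (λ x → :- con (pos 1) :* x := :- x) refl _)

    polyFn-const : ∀ {n} {ds : Vec ℕ n} c → PolyFn ds (λ _ → c)
    polyFn-const c = mono c (replicate _ 0) 0≤ (go c)
      where
      0≤ : ∀ {n} {ds : Vec ℕ n} → Pointwise ℕ._≤_ (replicate n 0) ds
      0≤ {ds = []} = []
      0≤ {ds = _ ∷ _} = z≤n ∷ 0≤
      go : ∀ {n} c (X : Vec K n) → monomial c (replicate n 0) X ≡ c
      go c [] = refl
      go c (x ∷ X) = trans (*-identityˡ _) (go c X)

    polyFn-var : ∀ {n} {ds : Vec ℕ n} i → 1 ℕ.≤ Vec.lookup ds i → PolyFn ds (λ X → Vec.lookup X i)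
    polyFn-var i 1≤ = mono 1# (e i) (e≤ i 1≤) (go i)
      where
      e : ∀ {n} → Fin n → Vec ℕ n
      e Fin.zero = 1 ∷ replicate _ 0
      e (Fin.suc i) = 0 ∷ e i
      0≤ : ∀ {n} {ds : Vec ℕ n} → Pointwise ℕ._≤_ (replicate n 0) ds
      0≤ {ds = []} = []
      0≤ {ds = _ ∷ _} = z≤n ∷ 0≤
      e≤ : ∀ {n} {ds : Vec ℕ n} i → 1 ℕ.≤ Vec.lookup ds i → Pointwise ℕ._≤_ (e i) ds
      e≤ {ds = _ ∷ _} Fin.zero 1≤ = 1≤ ∷ 0≤
      e≤ {ds = _ ∷ _} (Fin.suc i) 1≤ = z≤n ∷ e≤ i 1≤
      one : ∀ {n} (X : Vec K n) → monomial 1# (replicate n 0) X ≡ 1#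
      one [] = refl
      one (x ∷ X) = trans (*-identityˡ _) (one X)
      go : ∀ {n} i (X : Vec K n) → monomial 1# (e i) X ≡ Vec.lookup X i
      go Fin.zero (x ∷ X) = trans (cong (x * 1# *_) (one X)) (trans (*-identityʳ _) (*-identityʳ _))
      go (Fin.suc i) (x ∷ X) = trans (*-identityˡ _) (go i X)

-- Determinants via the exterior algebra of Kⁿ: contraction with a vector Y is an
-- antiderivation, so if every row is orthogonal to Y then contracting the product
-- of the rows gives 0, while the contraction of det · e₁∧…∧eₙ has a coordinate Y₀ det.
module Determinants (F : Field) where
  open FieldPowers F
  open Solver using (solve; _:=_; _:+_; _:*_; _:-_; :-_; con)
  open ≡-Reasoning

  Row : ℕ → Set
  Row n = Fin n → K

  -- Coordinates are indexed by subsets of the basis: `true` marks a basis vector that occurs in the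
  -- product.
  Ext : ℕ → Set
  Ext n = Vec Bool n → K

  dot : ∀ {n} → Row n → Row n → K
  dot {zero} r Y = 0#
  dot {suc n} r Y = r zero * Y zero + dot (r ∘ suc) (Y ∘ suc)

  -- The minus sign comes from moving the later part of the row past the first basis vector.
  wedge : ∀ {n} → Row n → Ext n → Ext n
  wedge r w [] = 0#
  wedge r w (false ∷ S) = wedge (r ∘ suc) (w ∘ (false ∷_)) S
  wedge r w (true ∷ S) = r zero * w (false ∷ S) - wedge (r ∘ suc) (w ∘ (true ∷_)) S

  contract : ∀ {n} → Row n → Ext n → Ext n
  contract Y w [] = 0#
  contract Y w (false ∷ S) = contract (Y ∘ suc) (w ∘ (false ∷_)) S + Y zero * w (true ∷ S)
  contract Y w (true ∷ S) = - contract (Y ∘ suc) (w ∘ (true ∷_)) S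

  unit : ∀ {n} → Ext n
  unit [] = 1#
  unit (false ∷ S) = unit S
  unit (true ∷ S) = 0#

  wedges : ∀ {m n} → (Fin m → Row n) → Ext n
  wedges {zero} M = unit
  wedges {suc m} M = wedge (M zero) (wedges (M ∘ suc))

  det : ∀ {n} → (Fin n → Row n) → K
  det {n} M = wedges M (replicate n true)

  wedge-linear : ∀ {n} (r : Row n) a b u v S → wedge r (λ T → a * u T + b * v T) S ≡ a * wedge r u S + b * wedge r v S
  wedge-linear r a b u v [] = solve 2 (λ a b → con (pos 0) := a :* con (pos 0) :+ b :* con (pos 0)) refl a b
  wedge-linear r a b u v (false ∷ S) = wedge-linear (r ∘ suc) a b _ _ S
  wedge-linear r a b u v (true ∷ S) = trans (cong (λ z → r zero * (a * u (false ∷ S) + b * v (false ∷ S)) - z) (wedge-linear (r ∘ suc) a b _ _ S))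
    (solve 7 (λ r a b u v x y → r :* (a :* u :+ b :* v) :- (a :* x :+ b :* y) := a :* (r :* u :- x) :+ b :* (r :* v :- y)) refl
      (r zero) a b (u (false ∷ S)) (v (false ∷ S)) _ _)

  contract-linear : ∀ {n} (Y : Row n) a b u v S → contract Y (λ T → a * u T + b * v T) S ≡ a * contract Y u S + b * contract Y v S
  contract-linear Y a b u v [] = solve 2 (λ a b → con (pos 0) := a :* con (pos 0) :+ b :* con (pos 0)) refl a b
  contract-linear Y a b u v (true ∷ S) = trans (cong -_ (contract-linear (Y ∘ suc) a b _ _ S))
    (solve 4 (λ a b x y → :- (a :* x :+ b :* y) := a :* :- x :+ b :* :- y) refl a b _ _)
  contract-linear Y a b u v (false ∷ S) = trans (cong (λ z → z + Y zero * (a * u (true ∷ S) + b * v (true ∷ S))) (contract-linear (Y ∘ suc) a b _ _ S))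
    (solve 7 (λ r a b u v x y → a :* x :+ b :* y :+ r :* (a :* u :+ b :* v) := a :* (x :+ r :* u) :+ b :* (y :+ r :* v)) refl
      (Y zero) a b (u (true ∷ S)) (v (true ∷ S)) _ _)

  wedge-cong : ∀ {n} (r : Row n) {u v} → (∀ S → u S ≡ v S) → ∀ S → wedge r u S ≡ wedge r v S
  wedge-cong r p [] = refl
  wedge-cong r p (false ∷ S) = wedge-cong (r ∘ suc) (p ∘ (false ∷_)) S
  wedge-cong r p (true ∷ S) = cong₂ (λ a b → r zero * a - b) (p (false ∷ S)) (wedge-cong (r ∘ suc) (p ∘ (true ∷_)) S)

  contract-cong : ∀ {n} (Y : Row n) {u v} → (∀ S → u S ≡ v S) → ∀ S → contract Y u S ≡ contract Y v S
  contract-cong r p [] = refl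
  contract-cong r p (true ∷ S) = cong -_ (contract-cong (r ∘ suc) (p ∘ (true ∷_)) S)
  contract-cong r p (false ∷ S) = cong₂ (λ a b → a + r zero * b) (contract-cong (r ∘ suc) (p ∘ (false ∷_)) S) (p (true ∷ S))

  -- The antiderivation rule for a product whose left factor has degree 1, checked by splitting off
  -- the first basis vector.
  contract-wedge : ∀ {n} (Y r : Row n) w S → contract Y (wedge r w) S + wedge r (contract Y w) S ≡ dot r Y * w S
  contract-wedge Y r w [] = trans (+-identityˡ _) (sym (zeroˡ _))
  contract-wedge {suc n} Y r w (false ∷ S) = begin
    c + y * (a * wf - wt) + wedge r′ (λ T → contract Y′ (w ∘ (false ∷_)) T + y * w (true ∷ T)) S
      ≡⟨ cong (λ z → c + y * (a * wf - wt) + z) (trans (wedge-cong r′ (λ T → cong (_+ y * w (true ∷ T)) (sym (*-identityˡ _))) S)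
           (wedge-linear r′ 1# y (contract Y′ (w ∘ (false ∷_))) (w ∘ (true ∷_)) S)) ⟩
    c + y * (a * wf - wt) + (1# * d + y * wt)
      ≡⟨ solve 6 (λ c y a wf wt d → c :+ y :* (a :* wf :- wt) :+ (con (pos 1) :* d :+ y :* wt) := a :* y :* wf :+ (c :+ d)) refl c y a wf wt d ⟩
    a * y * wf + (c + d)             ≡⟨ cong (a * y * wf +_) (contract-wedge Y′ r′ (w ∘ (false ∷_)) S) ⟩
    a * y * wf + dot r′ Y′ * wf      ≡⟨ sym (distribʳ _ _ _) ⟩
    dot r Y * wf                     ∎
    where
    Y′ = Y ∘ suc ; r′ = r ∘ suc ; y = Y zero ; a = r zero
    wf = w (false ∷ S)
    wt = wedge r′ (w ∘ (true ∷_)) S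
    c = contract Y′ (wedge r′ (w ∘ (false ∷_))) S
    d = wedge r′ (contract Y′ (w ∘ (false ∷_))) S
  contract-wedge {suc n} Y r w (true ∷ S) = begin
    - contract Y′ (λ T → a * w (false ∷ T) - wedge r′ (w ∘ (true ∷_)) T) S + (a * (cf + y * wt) - wedge r′ (λ T → - contract Y′ (w ∘ (true ∷_)) T) S)
      ≡⟨ cong₂ (λ z t → - z + (a * (cf + y * wt) - t))
           (trans (contract-cong Y′ (λ T → cong (a * w (false ∷ T) +_) (neg _)) S) (contract-linear Y′ a (- 1#) (w ∘ (false ∷_)) (wedge r′ (w ∘ (true ∷_))) S))
           (trans (wedge-cong r′ (λ T → solve 1 (λ x → :- x := :- con (pos 1) :* x :+ con (pos 0) :* x) refl (contract Y′ (w ∘ (true ∷_)) T)) S)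
             (wedge-linear r′ (- 1#) 0# (contract Y′ (w ∘ (true ∷_))) (contract Y′ (w ∘ (true ∷_))) S)) ⟩
    - (a * cf + - 1# * c) + (a * (cf + y * wt) - (- 1# * d + 0# * d))
      ≡⟨ solve 6 (λ a cf c y wt d → :- (a :* cf :+ :- con (pos 1) :* c) :+ (a :* (cf :+ y :* wt) :- (:- con (pos 1) :* d :+ con (pos 0) :* d)) := a :* y :* wt :+ (c :+ d))
           refl a cf c y wt d ⟩
    a * y * wt + (c + d)             ≡⟨ cong (a * y * wt +_) (contract-wedge Y′ r′ (w ∘ (true ∷_)) S) ⟩
    a * y * wt + dot r′ Y′ * wt      ≡⟨ sym (distribʳ _ _ _) ⟩
    dot r Y * wt                     ∎
    where
    Y′ = Y ∘ suc ; r′ = r ∘ suc ; y = Y zero ; a = r zero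
    wt = w (true ∷ S)
    cf = contract Y′ (w ∘ (false ∷_)) S
    c = contract Y′ (wedge r′ (w ∘ (true ∷_))) S
    d = wedge r′ (contract Y′ (w ∘ (true ∷_))) S
    neg : ∀ x → - x ≡ - 1# * x
    neg x = solve 1 (λ x → :- x := :- con (pos 1) :* x) refl x

  wedge-zero : ∀ {n} (r : Row n) {w} → (∀ S → w S ≡ 0#) → ∀ S → wedge r w S ≡ 0#
  wedge-zero r p [] = refl
  wedge-zero r p (false ∷ S) = wedge-zero (r ∘ suc) (p ∘ (false ∷_)) S
  wedge-zero r p (true ∷ S) = trans (cong₂ (λ a b → r zero * a - b) (p (false ∷ S)) (wedge-zero (r ∘ suc) (p ∘ (true ∷_)) S))
    (solve 1 (λ r → r :* con (pos 0) :- con (pos 0) := con (pos 0)) refl (r zero))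

  contract-zero : ∀ {n} (Y : Row n) {w} → (∀ S → w S ≡ 0#) → ∀ S → contract Y w S ≡ 0#
  contract-zero Y p [] = refl
  contract-zero Y p (true ∷ S) = trans (cong -_ (contract-zero (Y ∘ suc) (p ∘ (true ∷_)) S)) -0#≈0#
  contract-zero Y p (false ∷ S) = trans (cong₂ (λ a b → a + Y zero * b) (contract-zero (Y ∘ suc) (p ∘ (false ∷_)) S) (p (true ∷ S)))
    (trans (+-identityˡ _) (zeroʳ _))

  contract-unit : ∀ {n} (Y : Row n) S → contract Y unit S ≡ 0#
  contract-unit Y [] = refl
  contract-unit Y (false ∷ S) = trans (cong₂ _+_ (contract-unit (Y ∘ suc) S) (zeroʳ _)) (+-identityˡ _)
  contract-unit Y (true ∷ S) = trans (cong -_ (contract-zero (Y ∘ suc) (λ _ → refl) S)) -0#≈0#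

  contract-wedges : ∀ {m n} (Y : Row n) (M : Fin m → Row n) → (∀ i → dot (M i) Y ≡ 0#) → ∀ S → contract Y (wedges M) S ≡ 0#
  contract-wedges {zero} Y M p S = contract-unit Y S
  contract-wedges {suc m} Y M p S = begin
    contract Y (wedge (M zero) w) S                               ≡⟨ sym (+-identityʳ _) ⟩
    contract Y (wedge (M zero) w) S + 0#                          ≡⟨ cong (contract Y (wedge (M zero) w) S +_) (sym (wedge-zero (M zero) (contract-wedges Y (M ∘ suc) (p ∘ suc)) S)) ⟩
    contract Y (wedge (M zero) w) S + wedge (M zero) (contract Y w) S ≡⟨ contract-wedge Y (M zero) w S ⟩
    dot (M zero) Y * w S                                          ≡⟨ cong (_* w S) (p zero) ⟩
    0# * w S                                                      ≡⟨ zeroˡ _ ⟩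
    0#                                                            ∎
    where w = wedges (M ∘ suc)

  contract-top : ∀ {n} (Y : Row n) w → contract Y w (replicate n true) ≡ 0#
  contract-top {zero} Y w = refl
  contract-top {suc n} Y w = trans (cong -_ (contract-top (Y ∘ suc) _)) -0#≈0#

  singular⇒det≡0 : ∀ {n} (M : Fin (suc n) → Row (suc n)) Y → ¬ Y zero ≡ 0# → (∀ i → dot (M i) Y ≡ 0#) → det M ≡ 0#
  singular⇒det≡0 {n} M Y y≢0 p = *-cancelˡ-0 y≢0 (begin
    Y zero * det M                                                    ≡⟨ sym (+-identityˡ _) ⟩
    0# + Y zero * det M                                               ≡⟨ cong (_+ Y zero * det M) (sym (contract-top (Y ∘ suc) _)) ⟩
    contract (Y ∘ suc) (wedges M ∘ (false ∷_)) (replicate n true) + Y zero * det M ≡⟨ contract-wedges Y M p (false ∷ replicate n true) ⟩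
    0#                                                                ∎)

  private
    wedges-false : ∀ {m n} (M : Fin m → Row (suc n)) S → wedges M (false ∷ S) ≡ wedges (λ i → M i ∘ suc) S
    wedges-false {zero} M S = refl
    wedges-false {suc m} M S = wedge-cong (M zero ∘ suc) (wedges-false (M ∘ suc)) S

    wedges-true : ∀ {m n} (M : Fin m → Row (suc n)) → (∀ i → M i zero ≡ 0#) → ∀ S → wedges M (true ∷ S) ≡ 0#
    wedges-true {zero} M p S = refl
    wedges-true {suc m} M p S = trans
      (cong₂ (λ a b → a * wedges (M ∘ suc) (false ∷ S) - b) (p zero) (wedge-zero (M zero ∘ suc) (wedges-true (M ∘ suc) (p ∘ suc)) S))
      (solve 1 (λ x → con (pos 0) :* x :- con (pos 0) := con (pos 0)) refl (wedges (M ∘ suc) (false ∷ S)))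

  -- When the later rows have no first coordinate, their product has no component containing the
  -- first basis vector. Only the leading entry times the determinant of the minor remains.
  triangular⇒det≢0 : ∀ {n} (M : Fin n → Row n) → (∀ i → ¬ M i i ≡ 0#) → (∀ {i j} → j Fin.< i → M i j ≡ 0#) → ¬ det M ≡ 0#
  triangular⇒det≢0 {zero} M d u p = 0≢1 (sym p)
  triangular⇒det≢0 {suc n} M d u p = *≢0 (d zero)
    (triangular⇒det≢0 (λ i → M (suc i) ∘ suc) (d ∘ suc) (u ∘ s≤s))
    (begin
      M zero zero * det M′                                     ≡⟨ solve 1 (λ x → x := x :- con (pos 0)) refl _ ⟩
      M zero zero * det M′ - 0#                                ≡⟨ sym (cong₂ (λ a b → M zero zero * a - b) (wedges-false (M ∘ suc) _)
                                                                   (wedge-zero (M zero ∘ suc) (wedges-true (M ∘ suc) (λ i → u {suc i} {zero} (s≤s z≤n))) (replicate n true))) ⟩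
      det M                                                    ≡⟨ p ⟩
      0#                                                       ∎)
    where M′ = λ i → M (suc i) ∘ suc

  module _ (q : ℕ) where
    open Polynomials F

    polyFn-wedge : ∀ {N n} {ds es : Vec ℕ N} (ρ : Vec K N → Row n) (w : Vec K N → Ext n) →
      (∀ j → PolyFn q ds (λ X → ρ X j)) → (∀ S → PolyFn q es (λ X → w X S)) →
      ∀ S → PolyFn q (zipWith ℕ._+_ ds es) (λ X → wedge (ρ X) (w X) S)
    polyFn-wedge ρ w p p′ [] = polyFn-const q 0#
    polyFn-wedge ρ w p p′ (false ∷ S) = polyFn-wedge (λ X → ρ X ∘ suc) (λ X → w X ∘ (false ∷_)) (p ∘ suc) (p′ ∘ (false ∷_)) S
    polyFn-wedge ρ w p p′ (true ∷ S) = polyFn-+ q (polyFn-* q (p zero) (p′ (false ∷ S)))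
      (polyFn-neg q (polyFn-wedge (λ X → ρ X ∘ suc) (λ X → w X ∘ (true ∷_)) (p ∘ suc) (p′ ∘ (true ∷_)) S))

    -- Every term of a determinant takes one factor from each row, so the degree bounds of the rows
    -- add up.
    totalDegree : ∀ {N m} → (Fin m → Vec ℕ N) → Vec ℕ N
    totalDegree {m = zero} ds = replicate _ 0
    totalDegree {m = suc m} ds = zipWith ℕ._+_ (ds zero) (totalDegree (ds ∘ suc))

    polyFn-wedges : ∀ {N m n} {ds : Fin m → Vec ℕ N} (M : Vec K N → Fin m → Row n) →
      (∀ i j → PolyFn q (ds i) (λ X → M X i j)) → ∀ S → PolyFn q (totalDegree ds) (λ X → wedges (M X) S)
    polyFn-wedges {m = zero} M p S = polyFn-const q (unit S)
    polyFn-wedges {m = suc m} M p S = polyFn-wedge (λ X → M X zero) (λ X → wedges (M X ∘ suc)) (p zero) (polyFn-wedges (λ X → M X ∘ suc) (p ∘ suc)) S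

-- The conjugation maps of the field with q⁶ elements.

module Frobenius (F : Field) {p : ℕ} (p-prime : Prime p) (k : ℕ) (enum : Fin ((p ℕ.^ k) ℕ.^ 6) ↔ Field.K F) where
  open FieldPowers F public
  open FiniteField F enum public
  open Solver using (solve; _:=_; _:+_; _:*_; _:-_; :-_; con)
  open ≡-Reasoning

  q : ℕ
  q = p ℕ.^ k

  -- The multiple q⁶ · 1 is zero and equals (p · 1) raised to the power 6k, while a field has no
  -- nonzero nilpotents.
  p⊠1≡0 : p ⊠ 1# ≡ 0#
  p⊠1≡0 with p ⊠ 1# ≟ 0#
  ... | yes p≡0 = p≡0
  ... | no p≢0 = ⊥-elim (^≢0 6 (^≢0 k p≢0) (trans (sym (trans (power (p ℕ.^ k) 6) (cong (_^ 6) (power p k)))) order⊠1≡0))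
    where
    power : ∀ m j → (m ℕ.^ j) ⊠ 1# ≡ (m ⊠ 1#) ^ j
    power m zero = refl
    power m (suc j) = trans (⊠1-homo-* m (m ℕ.^ j)) (cong (m ⊠ 1# *_) (power m j))

  open Characteristic F p-prime p⊠1≡0

  φ : ℕ → K → K
  φ = frob F q

  φ-+ : ∀ i x y → φ i (x + y) ≡ φ i x + φ i y
  φ-+ i x y = subst (λ m → (x + y) ^ m ≡ x ^ m + y ^ m) (sym (ℕ.^-*-assoc p k i)) (^p^k-+ (k ℕ.* i) x y)

  φ-* : ∀ i x y → φ i (x * y) ≡ φ i x * φ i y
  φ-* i x y = *-^ x y (q ℕ.^ i)

  φ-1 : ∀ i → φ i 1# ≡ 1#
  φ-1 i = 1^ (q ℕ.^ i)

  φ-0 : ∀ i → φ i 0# ≡ 0#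
  φ-0 i = trans (solve 1 (λ a → a := a :+ a :- a) refl (φ i 0#)) (trans (cong (_- φ i 0#) (sym (trans (cong (φ i) (sym (+-identityˡ 0#))) (φ-+ i 0# 0#)))) (-‿inverseʳ _))

  φ-neg : ∀ i x → φ i (- x) ≡ - φ i x
  φ-neg i x = begin
    φ i (- x)                    ≡⟨ solve 2 (λ y z → y := z :+ y :- z) refl (φ i (- x)) (φ i x) ⟩
    φ i x + φ i (- x) - φ i x    ≡⟨ cong (_- φ i x) (trans (sym (φ-+ i x (- x))) (trans (cong (φ i) (-‿inverseʳ x)) (φ-0 i))) ⟩
    0# - φ i x                   ≡⟨ +-identityˡ _ ⟩
    - φ i x                      ∎

  φ-φ : ∀ i j x → φ i (φ j x) ≡ φ (i ℕ.+ j) x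
  φ-φ i j x = trans (sym (^-* x (q ℕ.^ i) (q ℕ.^ j))) (cong (x ^_) (sym (ℕ.^-distribˡ-+-* q i j)))

  φ-suc : ∀ i x → φ 1 (φ i x) ≡ φ (suc i) x
  φ-suc = φ-φ 1

  φ0 : ∀ x → φ 0 x ≡ x
  φ0 x = *-identityʳ x

  φ-6+ : ∀ i x → φ (6 ℕ.+ i) x ≡ φ i x
  φ-6+ i x = trans (sym (φ-φ 6 i x)) (x^order≡x (φ i x))

  φ-%6 : ∀ i x → φ i x ≡ φ (i % 6) x
  φ-%6 i x = trans (cong (λ j → φ j x) (trans (m≡m%n+[m/n]*n i 6) (ℕ.+-comm (i % 6) _))) (go (i / 6))
    where
    go : ∀ m → φ (m ℕ.* 6 ℕ.+ i % 6) x ≡ φ (i % 6) x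
    go zero = refl
    go (suc m) = trans (cong (λ j → φ j x) (ℕ.+-assoc 6 (m ℕ.* 6) (i % 6))) (trans (φ-6+ (m ℕ.* 6 ℕ.+ i % 6) x) (go m))

  φ≢0 : ∀ i {x} → ¬ x ≡ 0# → ¬ φ i x ≡ 0#
  φ≢0 i = ^≢0 (q ℕ.^ i)

  φ≡0⇒≡0 : ∀ i {x} → φ i x ≡ 0# → x ≡ 0#
  φ≡0⇒≡0 i {x} p with x ≟ 0#
  ... | yes x≡0 = x≡0
  ... | no x≢0 = ⊥-elim (φ≢0 i x≢0 p)

  Fixed : K → Set
  Fixed c = φ 1 c ≡ c

  φ-fixed : ∀ {c} → Fixed c → ∀ i → φ i c ≡ c
  φ-fixed fix zero = φ0 _
  φ-fixed fix (suc i) = trans (sym (φ-suc i _)) (trans (cong (φ 1) (φ-fixed fix i)) fix)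

  enum-injective : Injective _≡_ _≡_ (Inverse.to enum)
  enum-injective {i} {j} eq = trans (sym (Inverse.strictlyInverseʳ enum i)) (trans (cong (Inverse.from enum) eq) (Inverse.strictlyInverseʳ enum j))

  fixed-neg : ∀ {x} → Fixed x → Fixed (- x)
  fixed-neg fix = trans (φ-neg 1 _) (cong -_ fix)

  fixed-+ : ∀ {x y} → Fixed x → Fixed y → Fixed (x + y)
  fixed-+ fx fy = trans (φ-+ 1 _ _) (cong₂ _+_ fx fy)

  fixed-* : ∀ {x y} → Fixed x → Fixed y → Fixed (x * y)
  fixed-* fx fy = trans (φ-* 1 _ _) (cong₂ _*_ fx fy)

-- The Dickson matrix and its indices modulo 6.

next : Fin 6 → Fin 6
next 0F = 1F
next 1F = 2F
next 2F = 3F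
next 3F = 4F
next 4F = 5F
next 5F = 0F

prev : Fin 6 → Fin 6
prev 0F = 5F
prev 1F = 0F
prev 2F = 1F
prev 3F = 2F
prev 4F = 3F
prev 5F = 4F

infixl 6 _⊕_ _⊖_
-- Defined by single steps so that closed instances reduce and the case distinctions over indices
-- close by `refl`.
_⊕_ : Fin 6 → ℕ → Fin 6
i ⊕ zero = i
i ⊕ suc n = next (i ⊕ n)

_⊖_ : Fin 6 → Fin 6 → Fin 6
j ⊖ i = go (toℕ i)
  where
  go : ℕ → Fin 6
  go zero = j
  go (suc n) = prev (go n)

module Twisting (F : Field) {p : ℕ} (p-prime : Prime p) (k : ℕ) (enum : Fin ((p ℕ.^ k) ℕ.^ 6) ↔ Field.K F)
  (b : Field.K F) (b-fixed : Frobenius.Fixed F p-prime k enum b) where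
  open Frobenius F p-prime k enum
  open Polynomials F
  open Determinants F
  open Solver using (solve; _:=_; _:+_; _:*_; _:-_; :-_; con)
  open ≡-Reasoning

  g : K → K
  g = gThm F q b

  -- A vector lists the coordinates in the order X₅, …, X₀, matching `conjugates`.
  at : Vec K 6 → Fin 6 → K
  at X i = Vec.lookup X (Fin.opposite i)

  Z : Vec K 6 → Fin 6 → K
  Z X i = at X (i ⊕ 1) + at X (i ⊕ 3) + b * at X (i ⊕ 5)

  form : K → K → Vec K 6 → Fin 6 → K
  form A B X i = φ (toℕ i) A * at X i + φ (toℕ i) B * Z X i

  at-conjugates : ∀ x i → at (conjugates q 6 x) i ≡ φ (toℕ i) x
  at-conjugates x 0F = refl
  at-conjugates x 1F = refl
  at-conjugates x 2F = refl
  at-conjugates x 3F = refl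
  at-conjugates x 4F = refl
  at-conjugates x 5F = refl

  φ-⊕1 : ∀ i x → φ (toℕ (next i)) x ≡ φ (suc (toℕ i)) x
  φ-⊕1 0F x = refl
  φ-⊕1 1F x = refl
  φ-⊕1 2F x = refl
  φ-⊕1 3F x = refl
  φ-⊕1 4F x = refl
  φ-⊕1 5F x = sym (φ-6+ 0 x)

  φ-⊕ : ∀ i n x → φ (toℕ (i ⊕ n)) x ≡ φ (n ℕ.+ toℕ i) x
  φ-⊕ i zero x = refl
  φ-⊕ i (suc n) x = trans (φ-⊕1 (i ⊕ n) x) (trans (sym (φ-suc (toℕ (i ⊕ n)) x)) (trans (cong (φ 1) (φ-⊕ i n x)) (φ-suc (n ℕ.+ toℕ i) x)))

  Z-conjugates : ∀ x i → Z (conjugates q 6 x) i ≡ φ (toℕ i) (g x)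
  Z-conjugates x i = begin
    at X (i ⊕ 1) + at X (i ⊕ 3) + b * at X (i ⊕ 5)
      ≡⟨ cong₂ _+_ (cong₂ _+_ (eq 1) (eq 3)) (cong₂ _*_ (sym (φ-fixed b-fixed m)) (eq 5)) ⟩
    φ m (φ 1 x) + φ m (φ 3 x) + φ m b * φ m (φ 5 x)
      ≡⟨ sym (trans (φ-+ m _ _) (cong₂ _+_ (φ-+ m _ _) (φ-* m _ _))) ⟩
    φ m (g x) ∎
    where
    X = conjugates q 6 x
    m = toℕ i
    eq : ∀ n → at X (i ⊕ n) ≡ φ m (φ n x)
    eq n = trans (at-conjugates x (i ⊕ n)) (trans (φ-⊕ i n x) (trans (cong (λ j → φ j x) (ℕ.+-comm n m)) (sym (φ-φ m n x))))

  form-conjugates : ∀ A B x i → form A B (conjugates q 6 x) i ≡ φ (toℕ i) (A * x + B * g x)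
  form-conjugates A B x i = trans
    (cong₂ (λ y z → φ m A * y + φ m B * z) (at-conjugates x i) (Z-conjugates x i))
    (sym (trans (φ-+ m _ _) (cong₂ _+_ (φ-* m A x) (φ-* m B (g x)))))
    where m = toℕ i

  -- Row i involves the variables with indices i, i+1, i+3 and i+5 modulo 6, marked here in the
  -- order X₅, ..., X₀.
  degrees : Fin 6 → Vec ℕ 6
  degrees 0F = 1 ∷ 0 ∷ 1 ∷ 0 ∷ 1 ∷ 1 ∷ []
  degrees 1F = 0 ∷ 1 ∷ 0 ∷ 1 ∷ 1 ∷ 1 ∷ []
  degrees 2F = 1 ∷ 0 ∷ 1 ∷ 1 ∷ 1 ∷ 0 ∷ []
  degrees 3F = 0 ∷ 1 ∷ 1 ∷ 1 ∷ 0 ∷ 1 ∷ []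
  degrees 4F = 1 ∷ 1 ∷ 1 ∷ 0 ∷ 1 ∷ 0 ∷ []
  degrees 5F = 1 ∷ 1 ∷ 0 ∷ 1 ∷ 0 ∷ 1 ∷ []

  polyFn-form : ∀ A B i → PolyFn q (degrees i) (λ X → form A B X i)
  polyFn-form A B i = polyFn-+ q (polyFn-scale q _ (var i (proj₁ bounds)))
    (polyFn-scale q _ (polyFn-+ q (polyFn-+ q (var (i ⊕ 1) (proj₁ (proj₂ bounds))) (var (i ⊕ 3) (proj₁ (proj₂ (proj₂ bounds)))))
      (polyFn-scale q b (var (i ⊕ 5) (proj₂ (proj₂ (proj₂ bounds)))))))
    where
    var : ∀ j → 1 ℕ.≤ Vec.lookup (degrees i) (Fin.opposite j) → PolyFn q (degrees i) (λ X → at X j)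
    var j = polyFn-var q (Fin.opposite j)
    Occurs : Fin 6 → Fin 6 → Set
    Occurs i j = 1 ℕ.≤ Vec.lookup (degrees i) (Fin.opposite j)
    occurs : ∀ i → Occurs i i × Occurs i (i ⊕ 1) × Occurs i (i ⊕ 3) × Occurs i (i ⊕ 5)
    occurs 0F = s≤s z≤n , s≤s z≤n , s≤s z≤n , s≤s z≤n
    occurs 1F = s≤s z≤n , s≤s z≤n , s≤s z≤n , s≤s z≤n
    occurs 2F = s≤s z≤n , s≤s z≤n , s≤s z≤n , s≤s z≤n
    occurs 3F = s≤s z≤n , s≤s z≤n , s≤s z≤n , s≤s z≤n
    occurs 4F = s≤s z≤n , s≤s z≤n , s≤s z≤n , s≤s z≤n
    occurs 5F = s≤s z≤n , s≤s z≤n , s≤s z≤n , s≤s z≤n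
    bounds = occurs i

  dot-permute : ∀ {n} (τ : Permutation n n) (r Y : Row n) → dot (r ∘ (τ ⟨$⟩ʳ_)) (Y ∘ (τ ⟨$⟩ʳ_)) ≡ dot r Y
  dot-permute τ r Y = trans (dot≡sum (r ∘ (τ ⟨$⟩ʳ_)) (Y ∘ (τ ⟨$⟩ʳ_))) (trans (sym (sum-permute (λ j → r j * Y j) τ)) (sym (dot≡sum r Y)))
    where
    open MonoidSum +-commutativeMonoid
    dot≡sum : ∀ {n} (r Y : Row n) → dot r Y ≡ sum (λ j → r j * Y j)
    dot≡sum {zero} r Y = refl
    dot≡sum {suc n} r Y = cong (r zero * Y zero +_) (dot≡sum (r ∘ suc) (Y ∘ suc))

  δ : Fin 6 → Fin 6 → K
  δ i j with i Fin.≟ j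
  ... | yes _ = 1#
  ... | no _ = 0#

  δ-≡ : ∀ i → δ i i ≡ 1#
  δ-≡ i with i Fin.≟ i
  ... | yes _ = refl
  ... | no i≢i = ⊥-elim (i≢i refl)

  δ-≢ : ∀ {i j} → ¬ i ≡ j → δ i j ≡ 0#
  δ-≢ {i} {j} i≢j with i Fin.≟ j
  ... | yes i≡j = ⊥-elim (i≢j i≡j)
  ... | no _ = refl

  -- The q-polynomials without x and x^{q³} terms.
  record Target : Set where
    field
      c₁ c₂ c₄ c₅ : K
    coeff : Fin 6 → K
    coeff 0F = 0#
    coeff 1F = c₁
    coeff 2F = c₂
    coeff 3F = 0#
    coeff 4F = c₄
    coeff 5F = c₅
    eval : K → K
    eval z = c₁ * φ 1 z + c₂ * φ 2 z + c₄ * φ 4 z + c₅ * φ 5 z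

  module _ (f : Target) (A B C D : K)
    (kernel : ∀ x → ∃[ z ] (¬ z ≡ 0# × (A * x + B * g x) * Target.eval f z ≡ (C * x + D * g x) * z)) where
    open Target f

    -- Raising the kernel equation to the power qⁱ puts the coefficient of z^{qʲ} in column j. The
    -- indices of the target coefficients are thereby shifted by i.
    M : Vec K 6 → Fin 6 → Row 6
    M X i j = φ (toℕ i) (coeff (j ⊖ i)) * form A B X i - δ i j * form C D X i

    private
      row : ∀ x z i → (A * x + B * g x) * eval z ≡ (C * x + D * g x) * z →
        dot (M (conjugates q 6 x) i) (λ j → φ (toℕ j) z) ≡ 0#
      row x z i eq = begin
        dot (M X i) (λ j → φ (toℕ j) z) ≡⟨ expand i ⟩
        P * (φ m c₁ * φ (1 ℕ.+ m) z + φ m c₂ * φ (2 ℕ.+ m) z + φ m c₄ * φ (4 ℕ.+ m) z + φ m c₅ * φ (5 ℕ.+ m) z) - Q * φ m z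
          ≡⟨ cong₂ _-_ (cong₂ _*_ (form-conjugates A B x i) (sym φeval)) (cong (_* φ m z) (form-conjugates C D x i)) ⟩
        φ m (A * x + B * g x) * φ m (eval z) - φ m (C * x + D * g x) * φ m z
          ≡⟨ cong₂ _-_ (trans (sym (φ-* m _ _)) (cong (φ m) eq)) (sym (φ-* m _ _)) ⟩
        φ m ((C * x + D * g x) * z) - φ m ((C * x + D * g x) * z) ≡⟨ -‿inverseʳ _ ⟩
        0# ∎
        where
        X = conjugates q 6 x
        m = toℕ i
        P = form A B X i
        Q = form C D X i
        term : ∀ c n → φ m (c * φ n z) ≡ φ m c * φ (n ℕ.+ m) z
        term c n = trans (φ-* m c (φ n z)) (cong (φ m c *_) (trans (φ-φ m n z) (cong (λ j → φ j z) (ℕ.+-comm m n))))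
        φeval : φ m (eval z) ≡ φ m c₁ * φ (1 ℕ.+ m) z + φ m c₂ * φ (2 ℕ.+ m) z + φ m c₄ * φ (4 ℕ.+ m) z + φ m c₅ * φ (5 ℕ.+ m) z
        φeval = trans (φ-+ m _ _) (cong₂ _+_ (trans (φ-+ m _ _) (cong₂ _+_ (trans (φ-+ m _ _) (cong₂ _+_ (term c₁ 1) (term c₂ 2))) (term c₄ 4))) (term c₅ 5))
        expand : ∀ i → let m = toℕ i ; P = form A B X i ; Q = form C D X i in
          dot (M X i) (λ j → φ (toℕ j) z) ≡ P * (φ m c₁ * φ (1 ℕ.+ m) z + φ m c₂ * φ (2 ℕ.+ m) z + φ m c₄ * φ (4 ℕ.+ m) z + φ m c₅ * φ (5 ℕ.+ m) z) - Q * φ m z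
        -- `φ-0` clears the two absent coefficients. In the later rows `φ-6+` also brings exponents
        -- beyond 5 back to the column order.
        expand 0F rewrite φ-0 0 =
          solve 12 (λ c₁ c₂ c₄ c₅ P Q y0 y1 y2 y3 y4 y5 → (con (pos 0) :* P :- con (pos 1) :* Q) :* y0 :+ ((c₁ :* P :- con (pos 0) :* Q) :* y1 :+ ((c₂ :* P :- con (pos 0) :* Q) :* y2 :+ ((con (pos 0) :* P :- con (pos 0) :* Q) :* y3 :+ ((c₄ :* P :- con (pos 0) :* Q) :* y4 :+ ((c₅ :* P :- con (pos 0) :* Q) :* y5 :+ con (pos 0)))))) := P :* (c₁ :* y1 :+ c₂ :* y2 :+ c₄ :* y4 :+ c₅ :* y5) :- Q :* y0) refl
          (φ 0 c₁) (φ 0 c₂) (φ 0 c₄) (φ 0 c₅) (form A B X 0F) (form C D X 0F) (φ 0 z) (φ 1 z) (φ 2 z) (φ 3 z) (φ 4 z) (φ 5 z)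
        expand 1F rewrite φ-0 1 | φ-6+ 0 z =
          solve 12 (λ c₁ c₂ c₄ c₅ P Q y0 y1 y2 y3 y4 y5 → (c₅ :* P :- con (pos 0) :* Q) :* y0 :+ ((con (pos 0) :* P :- con (pos 1) :* Q) :* y1 :+ ((c₁ :* P :- con (pos 0) :* Q) :* y2 :+ ((c₂ :* P :- con (pos 0) :* Q) :* y3 :+ ((con (pos 0) :* P :- con (pos 0) :* Q) :* y4 :+ ((c₄ :* P :- con (pos 0) :* Q) :* y5 :+ con (pos 0)))))) := P :* (c₁ :* y2 :+ c₂ :* y3 :+ c₄ :* y5 :+ c₅ :* y0) :- Q :* y1) refl
          (φ 1 c₁) (φ 1 c₂) (φ 1 c₄) (φ 1 c₅) (form A B X 1F) (form C D X 1F) (φ 0 z) (φ 1 z) (φ 2 z) (φ 3 z) (φ 4 z) (φ 5 z)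
        expand 2F rewrite φ-0 2 | φ-6+ 0 z | φ-6+ 1 z =
          solve 12 (λ c₁ c₂ c₄ c₅ P Q y0 y1 y2 y3 y4 y5 → (c₄ :* P :- con (pos 0) :* Q) :* y0 :+ ((c₅ :* P :- con (pos 0) :* Q) :* y1 :+ ((con (pos 0) :* P :- con (pos 1) :* Q) :* y2 :+ ((c₁ :* P :- con (pos 0) :* Q) :* y3 :+ ((c₂ :* P :- con (pos 0) :* Q) :* y4 :+ ((con (pos 0) :* P :- con (pos 0) :* Q) :* y5 :+ con (pos 0)))))) := P :* (c₁ :* y3 :+ c₂ :* y4 :+ c₄ :* y0 :+ c₅ :* y1) :- Q :* y2) refl
          (φ 2 c₁) (φ 2 c₂) (φ 2 c₄) (φ 2 c₅) (form A B X 2F) (form C D X 2F) (φ 0 z) (φ 1 z) (φ 2 z) (φ 3 z) (φ 4 z) (φ 5 z)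
        expand 3F rewrite φ-0 3 | φ-6+ 1 z | φ-6+ 2 z =
          solve 12 (λ c₁ c₂ c₄ c₅ P Q y0 y1 y2 y3 y4 y5 → (con (pos 0) :* P :- con (pos 0) :* Q) :* y0 :+ ((c₄ :* P :- con (pos 0) :* Q) :* y1 :+ ((c₅ :* P :- con (pos 0) :* Q) :* y2 :+ ((con (pos 0) :* P :- con (pos 1) :* Q) :* y3 :+ ((c₁ :* P :- con (pos 0) :* Q) :* y4 :+ ((c₂ :* P :- con (pos 0) :* Q) :* y5 :+ con (pos 0)))))) := P :* (c₁ :* y4 :+ c₂ :* y5 :+ c₄ :* y1 :+ c₅ :* y2) :- Q :* y3) refl
          (φ 3 c₁) (φ 3 c₂) (φ 3 c₄) (φ 3 c₅) (form A B X 3F) (form C D X 3F) (φ 0 z) (φ 1 z) (φ 2 z) (φ 3 z) (φ 4 z) (φ 5 z)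
        expand 4F rewrite φ-0 4 | φ-6+ 0 z | φ-6+ 2 z | φ-6+ 3 z =
          solve 12 (λ c₁ c₂ c₄ c₅ P Q y0 y1 y2 y3 y4 y5 → (c₂ :* P :- con (pos 0) :* Q) :* y0 :+ ((con (pos 0) :* P :- con (pos 0) :* Q) :* y1 :+ ((c₄ :* P :- con (pos 0) :* Q) :* y2 :+ ((c₅ :* P :- con (pos 0) :* Q) :* y3 :+ ((con (pos 0) :* P :- con (pos 1) :* Q) :* y4 :+ ((c₁ :* P :- con (pos 0) :* Q) :* y5 :+ con (pos 0)))))) := P :* (c₁ :* y5 :+ c₂ :* y0 :+ c₄ :* y2 :+ c₅ :* y3) :- Q :* y4) refl
          (φ 4 c₁) (φ 4 c₂) (φ 4 c₄) (φ 4 c₅) (form A B X 4F) (form C D X 4F) (φ 0 z) (φ 1 z) (φ 2 z) (φ 3 z) (φ 4 z) (φ 5 z)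
        expand 5F rewrite φ-0 5 | φ-6+ 0 z | φ-6+ 1 z | φ-6+ 3 z | φ-6+ 4 z =
          solve 12 (λ c₁ c₂ c₄ c₅ P Q y0 y1 y2 y3 y4 y5 → (c₁ :* P :- con (pos 0) :* Q) :* y0 :+ ((c₂ :* P :- con (pos 0) :* Q) :* y1 :+ ((con (pos 0) :* P :- con (pos 0) :* Q) :* y2 :+ ((c₄ :* P :- con (pos 0) :* Q) :* y3 :+ ((c₅ :* P :- con (pos 0) :* Q) :* y4 :+ ((con (pos 0) :* P :- con (pos 1) :* Q) :* y5 :+ con (pos 0)))))) := P :* (c₁ :* y0 :+ c₂ :* y1 :+ c₄ :* y3 :+ c₅ :* y4) :- Q :* y5) refl
          (φ 5 c₁) (φ 5 c₂) (φ 5 c₄) (φ 5 c₅) (form A B X 5F) (form C D X 5F) (φ 0 z) (φ 1 z) (φ 2 z) (φ 3 z) (φ 4 z) (φ 5 z)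

    module _ (τ : Permutation 6 6) (degrees<q : All (ℕ._< q) (totalDegree q (degrees ∘ (τ ⟨$⟩ʳ_)))) where

      -- Rows and columns are permuted together: the diagonal entries stay on the diagonal, and the
      -- reindexed conjugates of z still form a kernel vector.
      permuted : Vec K 6 → Fin 6 → Row 6
      permuted X i j = M X (τ ⟨$⟩ʳ i) (τ ⟨$⟩ʳ j)

      det-permuted≡0 : ∀ X → det (permuted X) ≡ 0#
      det-permuted≡0 = vanishing q degrees<q
        (polyFn-wedges q permuted (λ i j → polyFn-+ q (polyFn-scale q _ (polyFn-form A B (τ ⟨$⟩ʳ i)))
          (polyFn-neg q (polyFn-scale q _ (polyFn-form C D (τ ⟨$⟩ʳ i))))) (replicate 6 true))
        (Inverse.to enum) enum-injective
        (λ x → let z , z≢0 , eq = kernel x in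
          singular⇒det≡0 (permuted (conjugates q 6 x)) (λ j → φ (toℕ (τ ⟨$⟩ʳ j)) z) (φ≢0 (toℕ (τ ⟨$⟩ʳ zero)) z≢0)
            (λ i → trans (dot-permute τ (M (conjugates q 6 x) (τ ⟨$⟩ʳ i)) (λ j → φ (toℕ j) z)) (row x z (τ ⟨$⟩ʳ i) eq)))

      -- Off the diagonal an entry is a conjugate of a coefficient times Pᵢ, so it vanishes as soon
      -- as one factor does. On the diagonal only -Qᵢ is left.
      noTriangularPoint : ∀ X → (∀ i → ¬ form C D X i ≡ 0#) →
        (∀ i j → j Fin.< i → form A B X (τ ⟨$⟩ʳ i) ≡ 0# ⊎ coeff ((τ ⟨$⟩ʳ j) ⊖ (τ ⟨$⟩ʳ i)) ≡ 0#) → ⊥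
      noTriangularPoint X Q≢0 below = triangular⇒det≢0 (permuted X) diagonal lower (det-permuted≡0 X)
        where
        coeff-diagonal : ∀ i → coeff (i ⊖ i) ≡ 0#
        coeff-diagonal 0F = refl
        coeff-diagonal 1F = refl
        coeff-diagonal 2F = refl
        coeff-diagonal 3F = refl
        coeff-diagonal 4F = refl
        coeff-diagonal 5F = refl
        M-diagonal : ∀ i → M X i i ≡ - form C D X i
        M-diagonal i = begin
          φ (toℕ i) (coeff (i ⊖ i)) * P - δ i i * Q ≡⟨ cong₂ (λ c d → c * P - d * Q) (trans (cong (φ (toℕ i)) (coeff-diagonal i)) (φ-0 (toℕ i))) (δ-≡ i) ⟩
          0# * P - 1# * Q                           ≡⟨ solve 2 (λ P Q → con (pos 0) :* P :- con (pos 1) :* Q := :- Q) refl P Q ⟩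
          - Q                                       ∎
          where
          P = form A B X i
          Q = form C D X i
        diagonal : ∀ i → ¬ permuted X i i ≡ 0#
        diagonal i eq = -≢0 (Q≢0 (τ ⟨$⟩ʳ i)) (trans (sym (M-diagonal (τ ⟨$⟩ʳ i))) eq)
        τ-injective : ∀ {i j} → τ ⟨$⟩ʳ i ≡ τ ⟨$⟩ʳ j → i ≡ j
        τ-injective eq = trans (sym (Inverse.strictlyInverseʳ τ _)) (trans (cong (Inverse.from τ) eq) (Inverse.strictlyInverseʳ τ _))
        lower : ∀ {i j} → j Fin.< i → permuted X i j ≡ 0#
        lower {i} {j} j<i = begin
          φ m c * P - δ i′ j′ * Q ≡⟨ cong₂ (λ u d → u - d * Q) (vanish (below i j j<i)) (δ-≢ (λ eq → Fin.<⇒≢ j<i (sym (τ-injective eq)))) ⟩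
          0# - 0# * Q             ≡⟨ solve 1 (λ Q → con (pos 0) :- con (pos 0) :* Q := con (pos 0)) refl Q ⟩
          0#                      ∎
          where
          i′ = τ ⟨$⟩ʳ i
          j′ = τ ⟨$⟩ʳ j
          m = toℕ i′
          c = coeff (j′ ⊖ i′)
          P = form A B X i′
          Q = form C D X i′
          vanish : P ≡ 0# ⊎ c ≡ 0# → φ m c * P ≡ 0#
          vanish (inj₁ P≡0) = trans (cong (φ m c *_) P≡0) (zeroʳ _)
          vanish (inj₂ c≡0) = trans (cong (_* P) (trans (cong (φ m) c≡0) (φ-0 m))) (zeroˡ P)

-- Avoiding finitely many hyperplanes over a finite field.

module Avoidance (F : Field) {n : ℕ} (enum : Fin n ↔ Field.K F) where
  open FieldPowers F
  open FiniteField F enum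
  open Determinants F
  open Inverse enum using (to; from; strictlyInverseʳ)
  open Solver using (solve; _:=_; _:+_; _:*_; _:-_; :-_; con)
  open ≡-Reasoning

  -- Each affine function has at most one zero. If every t were bad, the pigeonhole principle would
  -- give two bad values for the same function.
  avoidAffine : ∀ {m} → m ℕ.< n → (α β : Fin m → K) → (∀ i → α i ≡ 0# → ¬ β i ≡ 0#) → ∃[ t ] (∀ i → ¬ α i + t * β i ≡ 0#)
  avoidAffine {m} m<n α β nz with Fin.any? (λ j → Fin.all? (λ i → ¬? (α i + to j * β i ≟ 0#)))
  ... | yes (j , good) = to j , good
  ... | no none = ⊥-elim contradiction
    where
    bad : ∀ j → ∃[ i ] α i + to j * β i ≡ 0#
    bad j with Fin.any? (λ i → α i + to j * β i ≟ 0#)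
    ... | yes b = b
    ... | no ¬b = ⊥-elim (none (j , λ i eq → ¬b (i , eq)))
    contradiction : ⊥
    contradiction with Fin.pigeonhole m<n (proj₁ ∘ bad)
    ... | j , j′ , j<j′ , eq = nz i αi≡0 βi≡0
      where
      i = proj₁ (bad j)
      e = proj₂ (bad j)
      e′ : α i + to j′ * β i ≡ 0#
      e′ = subst (λ i → α i + to j′ * β i ≡ 0#) (sym eq) (proj₂ (bad j′))
      βi≡0 : β i ≡ 0#
      βi≡0 = *-cancelˡ-0 {to j - to j′}
        (λ d → Fin.<⇒≢ j<j′ (trans (sym (strictlyInverseʳ j)) (trans (cong from (x-y≡0⇒x≡y d)) (strictlyInverseʳ j′))))
        (trans (solve 4 (λ a s t b → (s :- t) :* b := a :+ s :* b :- (a :+ t :* b)) refl (α i) (to j) (to j′) (β i))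
          (trans (cong₂ _-_ e e′) (-‿inverseʳ _)))
      αi≡0 : α i ≡ 0#
      αi≡0 = trans (sym (trans (cong (λ x → α i + to j * x) βi≡0) (trans (cong (α i +_) (zeroʳ _)) (+-identityʳ _)))) e

  basis : ∀ {N} → Fin N → Row N
  basis zero zero = 1#
  basis zero (suc i) = 0#
  basis (suc j) zero = 0#
  basis (suc j) (suc i) = basis j i

  dot-zeroʳ : ∀ {N} (l : Row N) → dot l (λ _ → 0#) ≡ 0#
  dot-zeroʳ {zero} l = refl
  dot-zeroʳ {suc N} l = trans (cong₂ _+_ (zeroʳ _) (dot-zeroʳ (l ∘ suc))) (+-identityˡ _)

  dot-linear : ∀ {N} (l u v : Row N) s t → dot l (λ i → s * u i + t * v i) ≡ s * dot l u + t * dot l v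
  dot-linear {zero} l u v s t = solve 2 (λ s t → con (pos 0) := s :* con (pos 0) :+ t :* con (pos 0)) refl s t
  dot-linear {suc N} l u v s t = trans (cong (l zero * (s * u zero + t * v zero) +_) (dot-linear (l ∘ suc) (u ∘ suc) (v ∘ suc) s t))
    (solve 7 (λ l u v s t x y → l :* (s :* u :+ t :* v) :+ (s :* x :+ t :* y) := s :* (l :* u :+ x) :+ t :* (l :* v :+ y)) refl
      (l zero) (u zero) (v zero) s t _ _)

  dot-basis : ∀ {N} (l : Row N) j → dot l (basis j) ≡ l j
  dot-basis l zero = trans (cong₂ _+_ (*-identityʳ _) (dot-zeroʳ (l ∘ suc))) (+-identityʳ _)
  dot-basis l (suc j) = trans (cong₂ _+_ (zeroʳ _) (dot-basis (l ∘ suc) j)) (+-identityˡ _)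

  -- A vector good for all forms but the first is moved along an axis on which the first form is
  -- nonzero.
  avoid : ∀ {N m} → m ℕ.< n → (l : Fin m → Row N) → (∀ i → ¬ (∀ j → l i j ≡ 0#)) → ∃[ u ] (∀ i → ¬ dot (l i) u ≡ 0#)
  avoid {m = zero} m<n l nz = (λ _ → 0#) , λ ()
  avoid {m = suc m} m<n l nz
    with avoid (ℕ.<-trans (ℕ.n<1+n m) m<n) (l ∘ suc) (nz ∘ suc) | Fin.any? (λ j → ¬? (l zero j ≟ 0#))
  ... | _ | no ¬nz = ⊥-elim (nz zero λ j → zeroAt j)
    where
    zeroAt : ∀ j → l zero j ≡ 0#
    zeroAt j with l zero j ≟ 0#
    ... | yes p = p
    ... | no p = ⊥-elim (¬nz (j , p))
  ... | u , good | yes (j , lj≢0) = u′ , good′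
    where
    -- On this line the first form has nonzero slope and the others have nonzero constant term, so
    -- none is identically zero.
    line = avoidAffine m<n (λ i → dot (l i) u) (λ i → l i j) λ { zero _ → lj≢0 ; (suc i) eq → ⊥-elim (good i eq) }
    t = proj₁ line
    u′ : Row _
    u′ k = 1# * u k + t * basis j k
    good′ : ∀ i → ¬ dot (l i) u′ ≡ 0#
    good′ i eq = proj₂ line i (trans (sym (trans (dot-linear (l i) u (basis j) 1# t)
      (cong₂ (λ a b → a + t * b) (*-identityˡ _) (dot-basis (l i) j)))) eq)

  dot-comm : ∀ {N} (u v : Row N) → dot u v ≡ dot v u
  dot-comm {zero} u v = refl
  dot-comm {suc N} u v = cong₂ _+_ (*-comm _ _) (dot-comm (u ∘ suc) (v ∘ suc))

  -- Projecting along the j-th axis onto the kernel of π turns l into π j l - l j π.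
  avoidOnKernel : ∀ {N m} → m ℕ.< n → (π : Row N) → ∀ j → ¬ π j ≡ 0# → (l : Fin m → Row N) →
    (∀ i → ¬ (∀ k → l i k * π j ≡ l i j * π k)) → ∃[ u ] (dot π u ≡ 0# × (∀ i → ¬ dot (l i) u ≡ 0#))
  avoidOnKernel m<n π j πj≢0 l independent = u′ , π-u′ , good
    where
    l′ : ∀ i → Row _
    l′ i k = π j * l i k + - l i j * π k
    avoided = avoid m<n l′ λ i z → independent i λ k → x-y≡0⇒x≡y
      (trans (solve 4 (λ a b c d → a :* b :- c :* d := b :* a :+ :- c :* d) refl (l i k) (π j) (l i j) (π k)) (z k))
    u = proj₁ avoided
    u′ : Row _
    u′ k = π j * u k + - dot π u * basis j k
    dot-u′ : ∀ w → dot w u′ ≡ π j * dot w u + - dot π u * w j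
    dot-u′ w = trans (dot-linear w u (basis j) (π j) (- dot π u)) (cong (λ x → π j * dot w u + - dot π u * x) (dot-basis w j))
    π-u′ : dot π u′ ≡ 0#
    π-u′ = trans (dot-u′ π) (solve 2 (λ a b → a :* b :+ :- b :* a := con (pos 0)) refl (π j) (dot π u))
    good : ∀ i → ¬ dot (l i) u′ ≡ 0#
    good i eq = proj₂ avoided i (begin
      dot (l′ i) u                              ≡⟨ dot-comm (l′ i) u ⟩
      dot u (l′ i)                              ≡⟨ dot-linear u (l i) π (π j) (- l i j) ⟩
      π j * dot u (l i) + - l i j * dot u π     ≡⟨ cong₂ (λ x y → π j * x + - l i j * y) (dot-comm u (l i)) (dot-comm u π) ⟩
      π j * dot (l i) u + - l i j * dot π u     ≡⟨ solve 4 (λ a b c d → a :* b :+ :- c :* d := a :* b :+ :- d :* c) refl (π j) _ (l i j) _ ⟩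
      π j * dot (l i) u + - dot π u * l i j     ≡⟨ sym (dot-u′ (l i)) ⟩
      dot (l i) u′                              ≡⟨ eq ⟩
      0#                                        ∎)


-- Points at which the matrix becomes triangular.

module Nonequivalence (F : Field) {p : ℕ} (p-prime : Prime p) (k : ℕ) (enum : Fin ((p ℕ.^ k) ℕ.^ 6) ↔ Field.K F)
  (5≤q : 5 ℕ.≤ p ℕ.^ k) (b : Field.K F) (b-fixed : Frobenius.Fixed F p-prime k enum b)
  (golden : Field._+_ F (Field._*_ F b b) b ≡ Field.1# F)
  (2≢0 : ¬ Field._+_ F (Field.1# F) (Field.1# F) ≡ Field.0# F) where
  open Frobenius F p-prime k enum
  open Determinants F
  open Avoidance F enum
  open Twisting F p-prime k enum b b-fixed
  open Solver using (solve; _:=_; _:+_; _:*_; _:-_; :-_; con)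
  open ≡-Reasoning

  -- The other root of x² + x = 1.
  b′ : K
  b′ = - 1# - b

  golden′ : b * b + b - 1# ≡ 0#
  golden′ = x≡y⇒x-y≡0 golden

  b*b′ : b * b′ ≡ - 1#
  b*b′ = x-y≡0⇒x≡y (trans (solve 1 (λ b → b :* (:- con (pos 1) :- b) :- :- con (pos 1) := :- (b :* b :+ b :- con (pos 1))) refl b)
    (trans (cong -_ golden′) -0#≈0#))

  golden-b′ : b′ * b′ + b′ - 1# ≡ 0#
  golden-b′ = trans (solve 1 (λ b → let b′ = :- con (pos 1) :- b in b′ :* b′ :+ b′ :- con (pos 1) := b :* b :+ b :- con (pos 1)) refl b) golden′

  golden⇒≢0 : ∀ {x} → x * x + x - 1# ≡ 0# → ¬ x ≡ 0#
  golden⇒≢0 eq refl = 0≢1 (sym (trans (solve 0 (con (pos 1) := :- (con (pos 0) :* con (pos 0) :+ con (pos 0) :- con (pos 1))) refl) (trans (cong -_ eq) -0#≈0#)))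

  golden⇒≢1 : ∀ {x} → x * x + x - 1# ≡ 0# → ¬ x ≡ 1#
  golden⇒≢1 eq refl = 0≢1 (sym (trans (solve 0 (con (pos 1) := con (pos 1) :* con (pos 1) :+ con (pos 1) :- con (pos 1)) refl) eq))

  b≢0 : ¬ b ≡ 0#
  b≢0 = golden⇒≢0 golden′

  b′≢0 : ¬ b′ ≡ 0#
  b′≢0 = golden⇒≢0 golden-b′

  b≢1 : ¬ b ≡ 1#
  b≢1 = golden⇒≢1 golden′

  b′≢1 : ¬ b′ ≡ 1#
  b′≢1 = golden⇒≢1 golden-b′

  b′-fixed : Fixed b′
  b′-fixed = fixed-+ (fixed-neg (φ-1 1)) (fixed-neg b-fixed)

  two-cancel : ∀ {x} → x + x ≡ 0# → x ≡ 0#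
  two-cancel {x} eq = *-cancelˡ-0 2≢0 (trans (solve 1 (λ x → (con (pos 1) :+ con (pos 1)) :* x := x :+ x) refl x) eq)

  -- Modulo b² + b - 1 the factor b² + b + 1 of b³ - 1 is 2, so b³ = 1 would give 2 (b - 1) = 0.
  cube≢1 : ¬ b * (b * b) ≡ 1#
  cube≢1 eq = b≢1 (x-y≡0⇒x≡y (two-cancel (trans
    (solve 1 (λ b → b :- con (pos 1) :+ (b :- con (pos 1)) := b :* (b :* b) :- con (pos 1) :- (b :- con (pos 1)) :* (b :* b :+ b :- con (pos 1))) refl b)
    (trans (cong₂ (λ u v → u - (b - 1#) * v) (x≡y⇒x-y≡0 eq) golden′) (solve 1 (λ x → con (pos 0) :- x :* con (pos 0) := con (pos 0)) refl (b - 1#))))))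

  -- The point with the given even coordinates and the given values of Z at even indices.
  point : (x₀ z₀ x₂ z₂ x₄ z₄ : K) → Vec K 6
  point x₀ z₀ x₂ z₂ x₄ z₄ = (z₂ + z₄ + b′ * z₀) ∷ x₄ ∷ (z₀ + z₂ + b′ * z₄) ∷ x₂ ∷ (z₀ + z₄ + b′ * z₂) ∷ x₀ ∷ []

  module _ (x₀ z₀ x₂ z₂ x₄ z₄ : K) where
    private
      X = point x₀ z₀ x₂ z₂ x₄ z₄

      drop : ∀ z e → e ≡ 0# → z - z * e ≡ z
      drop z e refl = solve 1 (λ z → z :- z :* con (pos 0) := z) refl z

    -- The odd coordinates enter Z₀, Z₂, Z₄ through a circulant matrix with entries 1, 1, b. Since 2
    -- + b b′ = 1 and 1 + b + b′ = 0, its inverse is a circulant with entries 1, 1, b′, which is how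
    -- the odd coordinates of `point` arise.
    Z-point-0 : Z X 0F ≡ z₀
    Z-point-0 = trans (solve 4 (λ b u v w → let b′ = :- con (pos 1) :- b in
      u :+ w :+ b′ :* v :+ (u :+ v :+ b′ :* w) :+ b :* (v :+ w :+ b′ :* u) := u :- u :* (b :* b :+ b :- con (pos 1))) refl b z₀ z₂ z₄)
      (drop z₀ _ golden′)

    Z-point-2 : Z X 2F ≡ z₂
    Z-point-2 = trans (solve 4 (λ b u v w → let b′ = :- con (pos 1) :- b in
      u :+ v :+ b′ :* w :+ (v :+ w :+ b′ :* u) :+ b :* (u :+ w :+ b′ :* v) := v :- v :* (b :* b :+ b :- con (pos 1))) refl b z₀ z₂ z₄)
      (drop z₂ _ golden′)

    Z-point-4 : Z X 4F ≡ z₄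
    Z-point-4 = trans (solve 4 (λ b u v w → let b′ = :- con (pos 1) :- b in
      v :+ w :+ b′ :* u :+ (u :+ w :+ b′ :* v) :+ b :* (u :+ v :+ b′ :* w) := w :- w :* (b :* b :+ b :- con (pos 1))) refl b z₀ z₂ z₄)
      (drop z₄ _ golden′)

  -- The six hyperplanes Qᵢ = 0 are to be avoided, and 5⁶ = 15625 = 7 + 15618.
  6<order : 6 ℕ.< q ℕ.^ 6
  6<order = ℕ.≤-trans (ℕ.m≤m+n 7 15618) (ℕ.^-monoˡ-≤ 6 5≤q)

  -- If β = r α then the hypotheses say r^{q³} = b r^{q⁵}, and iterating gives b³ = 1.
  degenerate : ∀ α β γ ε → ¬ α * ε - β * γ ≡ 0# → γ * φ 5 α ≡ b * (ε * φ 5 β) → γ * φ 3 α ≡ ε * φ 3 β →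
    (α ≡ 0# × ε ≡ 0#) ⊎ (β ≡ 0# × γ ≡ 0#)
  degenerate α β γ ε det≢0 e₅ e₃ with γ ≟ 0# | ε ≟ 0# | α ≟ 0#
  ... | yes refl | yes refl | _ = ⊥-elim (det≢0 (solve 2 (λ α β → α :* con (pos 0) :- β :* con (pos 0) := con (pos 0)) refl α β))
  ... | yes refl | no ε≢0 | _ = inj₂ (φ≡0⇒≡0 3 (*-cancelˡ-0 ε≢0 (trans (sym e₃) (zeroˡ _))) , refl)
  ... | no γ≢0 | yes refl | _ = inj₁ (φ≡0⇒≡0 3 (*-cancelˡ-0 γ≢0 (trans e₃ (zeroˡ _))) , refl)
  ... | no γ≢0 | no ε≢0 | yes refl = ⊥-elim (det≢0 (trans (cong (λ x → 0# * ε - x * γ)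
          (φ≡0⇒≡0 3 (*-cancelˡ-0 ε≢0 (trans (sym e₃) (trans (cong (γ *_) (φ-0 3)) (zeroʳ γ))))))
          (solve 2 (λ ε γ → con (pos 0) :* ε :- con (pos 0) :* γ := con (pos 0)) refl ε γ)))
  ... | no γ≢0 | no ε≢0 | no α≢0 = ⊥-elim (cube≢1 (sym (*-cancelˡ (φ≢0 3 r≢0) (begin
        φ 3 r * 1#                     ≡⟨ *-identityʳ _ ⟩
        φ 3 r                          ≡⟨ r₃ ⟩
        b * φ 5 r                      ≡⟨ cong (b *_) r₅ ⟩
        b * (b * φ 1 r)                ≡⟨ cong (λ x → b * (b * x)) r₁ ⟩
        b * (b * (b * φ 3 r))          ≡⟨ solve 2 (λ b x → b :* (b :* (b :* x)) := x :* (b :* (b :* b))) refl b _ ⟩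
        φ 3 r * (b * (b * b))          ∎))))
    where
    α⁻¹ = proj₁ (inverse α α≢0)
    r = β * α⁻¹
    β≡rα : β ≡ r * α
    β≡rα = trans (trans (sym (*-identityʳ β)) (cong (β *_) (sym (proj₂ (inverse α α≢0))))) (solve 3 (λ β α a → β :* (α :* a) := β :* a :* α) refl β α α⁻¹)
    φβ : ∀ i → φ i β ≡ φ i r * φ i α
    φβ i = trans (cong (φ i) β≡rα) (φ-* i r α)
    r≢0 : ¬ r ≡ 0#
    r≢0 r≡0 = *≢0 γ≢0 (φ≢0 3 α≢0) (trans e₃ (trans (cong (ε *_) (trans (φβ 3) (trans (cong (λ x → φ 3 x * φ 3 α) r≡0) (trans (cong (_* φ 3 α) (φ-0 3)) (zeroˡ _))))) (zeroʳ ε)))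
    r₃ : φ 3 r ≡ b * φ 5 r
    r₃ = *-cancelˡ (*≢0 (*≢0 γ≢0 ε≢0) (*≢0 (φ≢0 3 α≢0) (φ≢0 5 α≢0))) (begin
      γ * ε * (φ 3 α * φ 5 α) * φ 3 r         ≡⟨ solve 5 (λ γ ε x y r → γ :* ε :* (x :* y) :* r := γ :* y :* (ε :* (r :* x))) refl γ ε (φ 3 α) (φ 5 α) (φ 3 r) ⟩
      γ * φ 5 α * (ε * (φ 3 r * φ 3 α))       ≡⟨ cong₂ (λ x y → x * (ε * y)) e₅ (sym (φβ 3)) ⟩
      b * (ε * φ 5 β) * (ε * φ 3 β)           ≡⟨ cong₂ (λ x y → b * (ε * x) * y) (φβ 5) (sym e₃) ⟩
      b * (ε * (φ 5 r * φ 5 α)) * (γ * φ 3 α) ≡⟨ solve 6 (λ γ ε x y r b → b :* (ε :* (r :* y)) :* (γ :* x) := γ :* ε :* (x :* y) :* (b :* r)) refl γ ε (φ 3 α) (φ 5 α) (φ 5 r) b ⟩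
      γ * ε * (φ 3 α * φ 5 α) * (b * φ 5 r)   ∎)
    shift : ∀ i → φ (i ℕ.+ 3) r ≡ b * φ (i ℕ.+ 5) r
    shift i = trans (sym (φ-φ i 3 r)) (trans (cong (φ i) r₃) (trans (φ-* i b _) (cong₂ _*_ (φ-fixed b-fixed i) (φ-φ i 5 r))))
    r₅ : φ 5 r ≡ b * φ 1 r
    r₅ = trans (shift 2) (cong (b *_) (φ-6+ 1 r))
    r₁ : φ 1 r ≡ b * φ 3 r
    r₁ = trans (sym (φ-6+ 1 r)) (trans (shift 4) (cong (b *_) (φ-6+ 3 r)))

  -- Every coordinate occurs in exactly four of the six forms.
  degrees<q : All (ℕ._< q) (replicate 6 4)
  degrees<q = 5≤q ∷ 5≤q ∷ 5≤q ∷ 5≤q ∷ 5≤q ∷ 5≤q ∷ []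

  reorder : (order position : Vec (Fin 6) 6)
    {_ : True (Fin.all? λ i → Vec.lookup order (Vec.lookup position i) Fin.≟ i)}
    {_ : True (Fin.all? λ i → Vec.lookup position (Vec.lookup order i) Fin.≟ i)} → Permutation 6 6
  reorder order position {u} {v} = permutation (Vec.lookup order) (Vec.lookup position) (toWitness u) (toWitness v)

  -- The trailing indices are those where P is made to vanish. The entries below the diagonal of the
  -- leading block carry c₂, c₄ for `oddFirst`, c₃ for `oppositeFirst`, c₂, c₃, c₅ for
  -- `fiveZeroThree`, and c₁, c₃, c₄ for `zeroThreeFive`.
  oddFirst oppositeFirst fiveZeroThree zeroThreeFive : Permutation 6 6
  oddFirst = reorder (1F ∷ 3F ∷ 5F ∷ 0F ∷ 2F ∷ 4F ∷ []) (3F ∷ 0F ∷ 4F ∷ 1F ∷ 5F ∷ 2F ∷ [])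
  oppositeFirst = reorder (0F ∷ 3F ∷ 1F ∷ 2F ∷ 4F ∷ 5F ∷ []) (0F ∷ 2F ∷ 3F ∷ 1F ∷ 4F ∷ 5F ∷ [])
  fiveZeroThree = reorder (5F ∷ 0F ∷ 3F ∷ 1F ∷ 2F ∷ 4F ∷ []) (1F ∷ 3F ∷ 4F ∷ 2F ∷ 5F ∷ 0F ∷ [])
  zeroThreeFive = reorder (0F ∷ 3F ∷ 5F ∷ 1F ∷ 2F ∷ 4F ∷ []) (0F ∷ 3F ∷ 4F ∷ 1F ∷ 5F ∷ 2F ∷ [])

  module _ (f : Target) (A B C D : K) (det≢0 : ¬ A * D - B * C ≡ 0#)
    (kernel : ∀ x → ∃[ z ] (¬ z ≡ 0# × (A * x + B * g x) * Target.eval f z ≡ (C * x + D * g x) * z)) where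
    open Target f

    φdet≢0 : ∀ i → ¬ φ i A * φ i D - φ i B * φ i C ≡ 0#
    φdet≢0 i eq = φ≢0 i det≢0 (trans (trans (φ-+ i _ _) (cong₂ _+_ (φ-* i A D) (trans (φ-neg i _) (cong -_ (φ-* i B C))))) eq)

    -- Indices of equal parity do not interact, so rows 1, 3, 5 form a diagonal block and it
    -- suffices that P₀ = P₂ = P₄ = 0. These equations leave a three-dimensional space of points on
    -- which to avoid the zeros of the Qᵢ.
    noTwoTermTarget : c₂ ≡ 0# → c₄ ≡ 0# → ⊥
    noTwoTermTarget c₂≡0 c₄≡0 = split
      where
      A₀ = φ 0 A ; A₂ = φ 2 A ; A₄ = φ 4 A
      B₀ = φ 0 B ; B₂ = φ 2 B ; B₄ = φ 4 B
      C₁ = φ 1 C ; C₃ = φ 3 C ; C₅ = φ 5 C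
      D₁ = φ 1 D ; D₃ = φ 3 D ; D₅ = φ 5 D

      antidiagonal : A ≡ 0# → D ≡ 0# → ⊥
      antidiagonal refl refl = noTriangularPoint f A B C D kernel oppositeFirst degrees<q X Q≢0 below
        where
        -- Here Pᵢ and Qᵢ are multiples of Zᵢ and Xᵢ. The vector has period 3 and nonzero entries,
        -- and 1 + b + b′ = 0 makes Z vanish at 1, 2, 4, 5.
        X = b′ ∷ 1# ∷ 1# ∷ b′ ∷ 1# ∷ 1# ∷ []
        C≢0 : ¬ C ≡ 0#
        C≢0 refl = det≢0 (solve 1 (λ B → con (pos 0) :* con (pos 0) :- B :* con (pos 0) := con (pos 0)) refl B)
        Q : ∀ i → form C D X i ≡ φ (toℕ i) C * at X i
        Q i = trans (cong (λ d → φ (toℕ i) C * at X i + d * Z X i) (φ-0 (toℕ i))) (trans (cong (φ (toℕ i) C * at X i +_) (zeroˡ _)) (+-identityʳ _))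
        X≢0 : ∀ i → ¬ at X i ≡ 0#
        X≢0 0F = 0≢1 ∘ sym
        X≢0 1F = 0≢1 ∘ sym
        X≢0 2F = b′≢0
        X≢0 3F = 0≢1 ∘ sym
        X≢0 4F = 0≢1 ∘ sym
        X≢0 5F = b′≢0
        Q≢0 : ∀ i → ¬ form C D X i ≡ 0#
        Q≢0 i eq = *≢0 (φ≢0 (toℕ i) C≢0) (X≢0 i) (trans (sym (Q i)) eq)
        P≡0 : ∀ i → Z X i ≡ 0# → form A B X i ≡ 0#
        P≡0 i Z≡0 = trans (cong₂ (λ a z → a * at X i + φ (toℕ i) B * z) (φ-0 (toℕ i)) Z≡0)
          (solve 2 (λ x y → con (pos 0) :* x :+ y :* con (pos 0) := con (pos 0)) refl (at X i) _)
        Z₁ : b′ + 1# + b * 1# ≡ 0#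
        Z₁ = solve 1 (λ b → :- con (pos 1) :- b :+ con (pos 1) :+ b :* con (pos 1) := con (pos 0)) refl b
        Z₂ : 1# + b′ + b * 1# ≡ 0#
        Z₂ = solve 1 (λ b → con (pos 1) :+ (:- con (pos 1) :- b) :+ b :* con (pos 1) := con (pos 0)) refl b
        below : ∀ i j → j Fin.< i → form A B X (oppositeFirst ⟨$⟩ʳ i) ≡ 0# ⊎ coeff ((oppositeFirst ⟨$⟩ʳ j) ⊖ (oppositeFirst ⟨$⟩ʳ i)) ≡ 0#
        below 0F j ()
        below 1F 0F _ = inj₂ refl
        below 1F (suc _) (s≤s ())
        below 2F j _ = inj₁ (P≡0 1F Z₁)
        below 3F j _ = inj₁ (P≡0 2F Z₂)
        below 4F j _ = inj₁ (P≡0 4F Z₁)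
        below 5F j _ = inj₁ (P≡0 5F Z₂)

      diagonal : B ≡ 0# → C ≡ 0# → ⊥
      diagonal refl refl = noTriangularPoint f A B C D kernel oppositeFirst degrees<q X Q≢0 below
        where
        -- Now Pᵢ and Qᵢ are multiples of Xᵢ and Zᵢ. With only X₀ = X₃ = 1 nonzero, each Zᵢ is 1 or
        -- b.
        X = 0# ∷ 0# ∷ 1# ∷ 0# ∷ 0# ∷ 1# ∷ []
        D≢0 : ¬ D ≡ 0#
        D≢0 refl = det≢0 (solve 1 (λ A → A :* con (pos 0) :- con (pos 0) :* con (pos 0) := con (pos 0)) refl A)
        Q : ∀ i → form C D X i ≡ φ (toℕ i) D * Z X i
        Q i = trans (cong (λ c → c * at X i + φ (toℕ i) D * Z X i) (φ-0 (toℕ i))) (trans (cong (_+ φ (toℕ i) D * Z X i) (zeroˡ _)) (+-identityˡ _))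
        Z-1 : ∀ {x y z} → x + y ≡ 1# → z ≡ 0# → ¬ x + y + b * z ≡ 0#
        Z-1 {x} {y} xy refl eq = 0≢1 (sym (trans (sym xy) (trans (solve 2 (λ w b → w := w :+ b :* con (pos 0)) refl (x + y) b) eq)))
        Z-b : ¬ 0# + 0# + b * 1# ≡ 0#
        Z-b eq = b≢0 (trans (solve 1 (λ b → b := con (pos 0) :+ con (pos 0) :+ b :* con (pos 1)) refl b) eq)
        Z≢0 : ∀ i → ¬ Z X i ≡ 0#
        Z≢0 0F = Z-1 (+-identityˡ _) refl
        Z≢0 1F = Z-b
        Z≢0 2F = Z-1 (+-identityʳ _) refl
        Z≢0 3F = Z-1 (+-identityˡ _) refl
        Z≢0 4F = Z-b
        Z≢0 5F = Z-1 (+-identityʳ _) refl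
        Q≢0 : ∀ i → ¬ form C D X i ≡ 0#
        Q≢0 i eq = *≢0 (φ≢0 (toℕ i) D≢0) (Z≢0 i) (trans (sym (Q i)) eq)
        P≡0 : ∀ i → at X i ≡ 0# → form A B X i ≡ 0#
        P≡0 i X≡0 = trans (cong₂ (λ x y → φ (toℕ i) A * x + y * Z X i) X≡0 (φ-0 (toℕ i)))
          (solve 2 (λ x y → x :* con (pos 0) :+ con (pos 0) :* y := con (pos 0)) refl _ (Z X i))
        below : ∀ i j → j Fin.< i → form A B X (oppositeFirst ⟨$⟩ʳ i) ≡ 0# ⊎ coeff ((oppositeFirst ⟨$⟩ʳ j) ⊖ (oppositeFirst ⟨$⟩ʳ i)) ≡ 0#
        below 0F j ()
        below 1F 0F _ = inj₂ refl
        below 1F (suc _) (s≤s ())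
        below 2F j _ = inj₁ (P≡0 1F refl)
        below 3F j _ = inj₁ (P≡0 2F refl)
        below 4F j _ = inj₁ (P≡0 4F refl)
        below 5F j _ = inj₁ (P≡0 5F refl)

      -- The restrictions of the forms Qᵢ to P₀ = P₂ = P₄ = 0, parametrised by Xᵢ = - sᵢ Bᵢ and Zᵢ = sᵢ Aᵢ for even i.
      Q : Fin 6 → Row 3
      Q 0F = Vec.lookup ((A₀ * φ 0 D - B₀ * φ 0 C) ∷ 0# ∷ 0# ∷ [])
      Q 1F = Vec.lookup ((C₁ * A₀ - b * (D₁ * B₀)) ∷ (b′ * (C₁ * A₂) - D₁ * B₂) ∷ (C₁ * A₄ - D₁ * B₄) ∷ [])
      Q 2F = Vec.lookup (0# ∷ (A₂ * φ 2 D - B₂ * φ 2 C) ∷ 0# ∷ [])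
      Q 3F = Vec.lookup ((C₃ * A₀ - D₃ * B₀) ∷ (C₃ * A₂ - b * (D₃ * B₂)) ∷ (b′ * (C₃ * A₄) - D₃ * B₄) ∷ [])
      Q 4F = Vec.lookup (0# ∷ 0# ∷ (A₄ * φ 4 D - B₄ * φ 4 C) ∷ [])
      Q 5F = Vec.lookup ((b′ * (C₅ * A₀) - D₅ * B₀) ∷ (C₅ * A₂ - D₅ * B₂) ∷ (C₅ * A₄ - b * (D₅ * B₄)) ∷ [])

      module _ (s : Row 3) where
        private
          s₀ = s 0F ; s₂ = s 1F ; s₄ = s 2F

        X : Vec K 6
        X = point (- (s₀ * B₀)) (s₀ * A₀) (- (s₂ * B₂)) (s₂ * A₂) (- (s₄ * B₄)) (s₄ * A₄)

        private
          Z₀ = Z-point-0 (- (s₀ * B₀)) (s₀ * A₀) (- (s₂ * B₂)) (s₂ * A₂) (- (s₄ * B₄)) (s₄ * A₄)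
          Z₂ = Z-point-2 (- (s₀ * B₀)) (s₀ * A₀) (- (s₂ * B₂)) (s₂ * A₂) (- (s₄ * B₄)) (s₄ * A₄)
          Z₄ = Z-point-4 (- (s₀ * B₀)) (s₀ * A₀) (- (s₂ * B₂)) (s₂ * A₂) (- (s₄ * B₄)) (s₄ * A₄)

          even-P : ∀ s A B → A * (- (s * B)) + B * (s * A) ≡ 0#
          even-P = solve 3 (λ s A B → A :* :- (s :* B) :+ B :* (s :* A) := con (pos 0)) refl

        P₀≡0 : form A B X 0F ≡ 0#
        P₀≡0 = trans (cong (λ z → A₀ * - (s₀ * B₀) + B₀ * z) Z₀) (even-P s₀ A₀ B₀)

        P₂≡0 : form A B X 2F ≡ 0#
        P₂≡0 = trans (cong (λ z → A₂ * - (s₂ * B₂) + B₂ * z) Z₂) (even-P s₂ A₂ B₂)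

        P₄≡0 : form A B X 4F ≡ 0#
        P₄≡0 = trans (cong (λ z → A₄ * - (s₄ * B₄) + B₄ * z) Z₄) (even-P s₄ A₄ B₄)

        Q≡form : ∀ i → dot (Q i) s ≡ form C D X i
        Q≡form 0F = trans (solve 7 (λ A B C D s t u → (A :* D :- B :* C) :* s :+ (con (pos 0) :* t :+ (con (pos 0) :* u :+ con (pos 0))) := C :* :- (s :* B) :+ D :* (s :* A)) refl
          A₀ B₀ (φ 0 C) (φ 0 D) s₀ s₂ s₄) (cong (λ z → φ 0 C * - (s₀ * B₀) + φ 0 D * z) (sym Z₀))
        Q≡form 2F = trans (solve 7 (λ A B C D s t u → con (pos 0) :* s :+ ((A :* D :- B :* C) :* t :+ (con (pos 0) :* u :+ con (pos 0))) := C :* :- (t :* B) :+ D :* (t :* A)) refl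
          A₂ B₂ (φ 2 C) (φ 2 D) s₀ s₂ s₄) (cong (λ z → φ 2 C * - (s₂ * B₂) + φ 2 D * z) (sym Z₂))
        Q≡form 4F = trans (solve 7 (λ A B C D s t u → con (pos 0) :* s :+ (con (pos 0) :* t :+ ((A :* D :- B :* C) :* u :+ con (pos 0))) := C :* :- (u :* B) :+ D :* (u :* A)) refl
          A₄ B₄ (φ 4 C) (φ 4 D) s₀ s₂ s₄) (cong (λ z → φ 4 C * - (s₄ * B₄) + φ 4 D * z) (sym Z₄))
        Q≡form 1F = solve 13 (λ A₀ A₂ A₄ B₀ B₂ B₄ C D s t u b b′ →
            (C :* A₀ :- b :* (D :* B₀)) :* s :+ ((b′ :* (C :* A₂) :- D :* B₂) :* t :+ ((C :* A₄ :- D :* B₄) :* u :+ con (pos 0)))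
            := C :* (s :* A₀ :+ u :* A₄ :+ b′ :* (t :* A₂)) :+ D :* (:- (t :* B₂) :+ :- (u :* B₄) :+ b :* :- (s :* B₀))) refl
          A₀ A₂ A₄ B₀ B₂ B₄ C₁ D₁ s₀ s₂ s₄ b b′
        Q≡form 3F = solve 13 (λ A₀ A₂ A₄ B₀ B₂ B₄ C D s t u b b′ →
            (C :* A₀ :- D :* B₀) :* s :+ ((C :* A₂ :- b :* (D :* B₂)) :* t :+ ((b′ :* (C :* A₄) :- D :* B₄) :* u :+ con (pos 0)))
            := C :* (s :* A₀ :+ t :* A₂ :+ b′ :* (u :* A₄)) :+ D :* (:- (u :* B₄) :+ :- (s :* B₀) :+ b :* :- (t :* B₂))) refl
          A₀ A₂ A₄ B₀ B₂ B₄ C₃ D₃ s₀ s₂ s₄ b b′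
        Q≡form 5F = solve 13 (λ A₀ A₂ A₄ B₀ B₂ B₄ C D s t u b b′ →
            (b′ :* (C :* A₀) :- D :* B₀) :* s :+ ((C :* A₂ :- D :* B₂) :* t :+ ((C :* A₄ :- b :* (D :* B₄)) :* u :+ con (pos 0)))
            := C :* (t :* A₂ :+ u :* A₄ :+ b′ :* (s :* A₀)) :+ D :* (:- (s :* B₀) :+ :- (t :* B₂) :+ b :* :- (u :* B₄))) refl
          A₀ A₂ A₄ B₀ B₂ B₄ C₅ D₅ s₀ s₂ s₄ b b′

      degenerate′ : (A ≡ 0# × D ≡ 0#) ⊎ (B ≡ 0# × C ≡ 0#) → ⊥
      degenerate′ (inj₁ (A≡0 , D≡0)) = antidiagonal A≡0 D≡0
      degenerate′ (inj₂ (B≡0 , C≡0)) = diagonal B≡0 C≡0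

      -- For odd i, two of the three coefficients of the restricted Qᵢ are the hypotheses of
      -- `degenerate` for the i-th conjugates of A, B, C, D. Its conclusion descends because `φ i`
      -- has no nonzero zeros.
      twisted : ∀ i → φ i C * φ (5 ℕ.+ i) A ≡ b * (φ i D * φ (5 ℕ.+ i) B) → φ i C * φ (3 ℕ.+ i) A ≡ φ i D * φ (3 ℕ.+ i) B → ⊥
      twisted i e₅ e₃ = degenerate′ (untwist (degenerate (φ i A) (φ i B) (φ i C) (φ i D) (φdet≢0 i)
        (trans (cong (φ i C *_) (φ-φ 5 i A)) (trans e₅ (cong (λ x → b * (φ i D * x)) (sym (φ-φ 5 i B)))))
        (trans (cong (φ i C *_) (φ-φ 3 i A)) (trans e₃ (cong (φ i D *_) (sym (φ-φ 3 i B)))))))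
        where
        untwist : (φ i A ≡ 0# × φ i D ≡ 0#) ⊎ (φ i B ≡ 0# × φ i C ≡ 0#) → (A ≡ 0# × D ≡ 0#) ⊎ (B ≡ 0# × C ≡ 0#)
        untwist (inj₁ (u , v)) = inj₁ (φ≡0⇒≡0 i u , φ≡0⇒≡0 i v)
        untwist (inj₂ (u , v)) = inj₂ (φ≡0⇒≡0 i u , φ≡0⇒≡0 i v)

      Q≢0 : ∀ i → ¬ (∀ j → Q i j ≡ 0#)
      Q≢0 0F z = φdet≢0 0 (z 0F)
      Q≢0 2F z = φdet≢0 2 (z 1F)
      Q≢0 4F z = φdet≢0 4 (z 2F)
      Q≢0 1F z = twisted 1
        (trans (cong (C₁ *_) (φ-6+ 0 A)) (trans (x-y≡0⇒x≡y (z 0F)) (cong (λ x → b * (D₁ * x)) (sym (φ-6+ 0 B)))))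
        (x-y≡0⇒x≡y (z 2F))
      Q≢0 3F z = twisted 3
        (trans (cong (C₃ *_) (φ-6+ 2 A)) (trans (x-y≡0⇒x≡y (z 1F)) (cong (λ x → b * (D₃ * x)) (sym (φ-6+ 2 B)))))
        (trans (cong (C₃ *_) (φ-6+ 0 A)) (trans (x-y≡0⇒x≡y (z 0F)) (cong (D₃ *_) (sym (φ-6+ 0 B)))))
      Q≢0 5F z = twisted 5
        (trans (cong (C₅ *_) (φ-6+ 4 A)) (trans (x-y≡0⇒x≡y (z 2F)) (cong (λ x → b * (D₅ * x)) (sym (φ-6+ 4 B)))))
        (trans (cong (C₅ *_) (φ-6+ 2 A)) (trans (x-y≡0⇒x≡y (z 1F)) (cong (D₅ *_) (sym (φ-6+ 2 B)))))

      split : ⊥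
      split = noTriangularPoint f A B C D kernel oddFirst degrees<q (X s) (λ i eq → good i (trans (Q≡form s i) eq)) below
        where
        avoided = avoid 6<order Q Q≢0
        s = proj₁ avoided
        good = proj₂ avoided
        below : ∀ i j → j Fin.< i → form A B (X s) (oddFirst ⟨$⟩ʳ i) ≡ 0# ⊎ coeff ((oddFirst ⟨$⟩ʳ j) ⊖ (oddFirst ⟨$⟩ʳ i)) ≡ 0#
        below 0F j ()
        below 1F 0F _ = inj₂ c₄≡0
        below 1F (suc _) (s≤s ())
        below 2F 0F _ = inj₂ c₂≡0
        below 2F 1F _ = inj₂ c₄≡0
        below 2F (suc (suc _)) (s≤s (s≤s ()))
        below 3F j _ = inj₁ (P₀≡0 s)
        below 4F j _ = inj₁ (P₂≡0 s)
        below 5F j _ = inj₁ (P₄≡0 s)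

    -- The leading indices are now 0, 3, 5, so P must vanish at 1, 2, 4. The conditions at 2 and 4
    -- are solved by parameters. The one at 1 mixes all coordinates and stays as the kernel of a
    -- linear form `π`, of which no Qᵢ may be a multiple.
    noOppositePairTarget : (c₂ ≡ 0# × c₅ ≡ 0#) ⊎ (c₁ ≡ 0# × c₄ ≡ 0#) → ⊥
    noOppositePairTarget = conclude
      where
      A₁ = φ 1 A ; A₂ = φ 2 A ; A₄ = φ 4 A
      B₁ = φ 1 B ; B₂ = φ 2 B ; B₄ = φ 4 B
      C₀ = φ 0 C ; C₁ = φ 1 C ; C₃ = φ 3 C ; C₅ = φ 5 C
      D₀ = φ 0 D ; D₁ = φ 1 D ; D₃ = φ 3 D ; D₅ = φ 5 D

      row₁ : K → K → Row 4
      row₁ C D = Vec.lookup (b * D ∷ C ∷ (b′ * (C * A₂) - D * B₂) ∷ (C * A₄ - D * B₄) ∷ [])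

      -- The restrictions of the forms Pᵢ and Qᵢ to P₂ = P₄ = 0, in the coordinates X₀, Z₀, s₂, s₄.
      π : Row 4
      π = row₁ A₁ B₁

      Q : Fin 6 → Row 4
      Q 0F = Vec.lookup (C₀ ∷ D₀ ∷ 0# ∷ 0# ∷ [])
      Q 1F = row₁ C₁ D₁
      Q 2F = Vec.lookup (0# ∷ 0# ∷ (A₂ * φ 2 D - B₂ * φ 2 C) ∷ 0# ∷ [])
      Q 3F = Vec.lookup (D₃ ∷ C₃ ∷ (C₃ * A₂ - b * (D₃ * B₂)) ∷ (b′ * (C₃ * A₄) - D₃ * B₄) ∷ [])
      Q 4F = Vec.lookup (0# ∷ 0# ∷ 0# ∷ (A₄ * φ 4 D - B₄ * φ 4 C) ∷ [])
      Q 5F = Vec.lookup (D₅ ∷ b′ * C₅ ∷ (C₅ * A₂ - D₅ * B₂) ∷ (C₅ * A₄ - b * (D₅ * B₄)) ∷ [])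

      module _ (s : Row 4) where
        private
          x₀ = s 0F ; z₀ = s 1F ; s₂ = s 2F ; s₄ = s 3F

        X : Vec K 6
        X = point x₀ z₀ (- (s₂ * B₂)) (s₂ * A₂) (- (s₄ * B₄)) (s₄ * A₄)

        private
          Z₀ = Z-point-0 x₀ z₀ (- (s₂ * B₂)) (s₂ * A₂) (- (s₄ * B₄)) (s₄ * A₄)
          Z₂ = Z-point-2 x₀ z₀ (- (s₂ * B₂)) (s₂ * A₂) (- (s₄ * B₄)) (s₄ * A₄)
          Z₄ = Z-point-4 x₀ z₀ (- (s₂ * B₂)) (s₂ * A₂) (- (s₄ * B₄)) (s₄ * A₄)

          even-P : ∀ s A B → A * (- (s * B)) + B * (s * A) ≡ 0#
          even-P = solve 3 (λ s A B → A :* :- (s :* B) :+ B :* (s :* A) := con (pos 0)) refl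

        P₂≡0 : form A B X 2F ≡ 0#
        P₂≡0 = trans (cong (λ z → A₂ * - (s₂ * B₂) + B₂ * z) Z₂) (even-P s₂ A₂ B₂)

        P₄≡0 : form A B X 4F ≡ 0#
        P₄≡0 = trans (cong (λ z → A₄ * - (s₄ * B₄) + B₄ * z) Z₄) (even-P s₄ A₄ B₄)

        row₁≡form : ∀ C D → dot (row₁ (φ 1 C) (φ 1 D)) s ≡ form C D X 1F
        row₁≡form C D = solve 12 (λ A₂ A₄ B₂ B₄ C D x z t u b b′ →
            b :* D :* x :+ (C :* z :+ ((b′ :* (C :* A₂) :- D :* B₂) :* t :+ ((C :* A₄ :- D :* B₄) :* u :+ con (pos 0))))
            := C :* (z :+ u :* A₄ :+ b′ :* (t :* A₂)) :+ D :* (:- (t :* B₂) :+ :- (u :* B₄) :+ b :* x)) refl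
          A₂ A₄ B₂ B₄ (φ 1 C) (φ 1 D) x₀ z₀ s₂ s₄ b b′

        Q≡form : ∀ i → dot (Q i) s ≡ form C D X i
        Q≡form 0F = trans (solve 6 (λ C D s t u v → C :* s :+ (D :* t :+ (con (pos 0) :* u :+ (con (pos 0) :* v :+ con (pos 0)))) := C :* s :+ D :* t) refl
          C₀ D₀ x₀ z₀ s₂ s₄) (cong (λ z → C₀ * x₀ + D₀ * z) (sym Z₀))
        Q≡form 1F = row₁≡form C D
        Q≡form 2F = trans (solve 8 (λ A B C D s t u v → con (pos 0) :* s :+ (con (pos 0) :* t :+ ((A :* D :- B :* C) :* u :+ (con (pos 0) :* v :+ con (pos 0)))) := C :* :- (u :* B) :+ D :* (u :* A)) refl
          A₂ B₂ (φ 2 C) (φ 2 D) x₀ z₀ s₂ s₄) (cong (λ z → φ 2 C * - (s₂ * B₂) + φ 2 D * z) (sym Z₂))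
        Q≡form 4F = trans (solve 8 (λ A B C D s t u v → con (pos 0) :* s :+ (con (pos 0) :* t :+ (con (pos 0) :* u :+ ((A :* D :- B :* C) :* v :+ con (pos 0)))) := C :* :- (v :* B) :+ D :* (v :* A)) refl
          A₄ B₄ (φ 4 C) (φ 4 D) x₀ z₀ s₂ s₄) (cong (λ z → φ 4 C * - (s₄ * B₄) + φ 4 D * z) (sym Z₄))
        Q≡form 3F = solve 12 (λ A₂ A₄ B₂ B₄ C D x z t u b b′ →
            D :* x :+ (C :* z :+ ((C :* A₂ :- b :* (D :* B₂)) :* t :+ ((b′ :* (C :* A₄) :- D :* B₄) :* u :+ con (pos 0))))
            := C :* (z :+ t :* A₂ :+ b′ :* (u :* A₄)) :+ D :* (:- (u :* B₄) :+ x :+ b :* :- (t :* B₂))) refl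
          A₂ A₄ B₂ B₄ C₃ D₃ x₀ z₀ s₂ s₄ b b′
        Q≡form 5F = solve 12 (λ A₂ A₄ B₂ B₄ C D x z t u b b′ →
            D :* x :+ (b′ :* C :* z :+ ((C :* A₂ :- D :* B₂) :* t :+ ((C :* A₄ :- b :* (D :* B₄)) :* u :+ con (pos 0))))
            := C :* (t :* A₂ :+ u :* A₄ :+ b′ :* z) :+ D :* (x :+ :- (t :* B₂) :+ b :* :- (u :* B₄))) refl
          A₂ A₄ B₂ B₄ C₅ D₅ x₀ z₀ s₂ s₄ b b′

      combine : ∀ {x y x′ y′} c → x ≡ y → x′ ≡ y′ → x - y + c * (x′ - y′) ≡ 0#
      combine {x} {_} {x′} c refl refl = solve 3 (λ x x′ c → x :- x :+ c :* (x′ :- x′) := con (pos 0)) refl x x′ c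

      vanish : ∀ {x y z w p q r s} → x ≡ 0# → y ≡ 0# → z ≡ 0# → w ≡ 0# → x * p + y * q + z * r + w * s ≡ 0#
      vanish {p = p} {q} {r} {s} refl refl refl refl = solve 4 (λ p q r s →
        con (pos 0) :* p :+ con (pos 0) :* q :+ con (pos 0) :* r :+ con (pos 0) :* s := con (pos 0)) refl p q r s

      det≡0 : ∀ i → φ i C ≡ 0# → φ i D ≡ 0# → ⊥
      det≡0 i c d = φdet≢0 i (trans (cong₂ (λ c d → φ i A * d - φ i B * c) c d)
        (solve 2 (λ a b → a :* con (pos 0) :- b :* con (pos 0) := con (pos 0)) refl (φ i A) (φ i B)))

      -- For r = B / A the quotients u / E and v / G are r^{q+q²} and r^{q+q⁴}, so u G = v E says
      -- that these two powers agree.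
      E = A₁ * A₂
      G = A₁ * A₄
      u = B₁ * B₂
      v = B₁ * B₄

      module _ (A≢0 : ¬ A ≡ 0#) where

        φA≢0 : ∀ i → ¬ φ i A ≡ 0#
        φA≢0 i = φ≢0 i A≢0

        EG≢0 : ¬ E * G ≡ 0#
        EG≢0 = *≢0 (*≢0 (φA≢0 1) (φA≢0 2)) (*≢0 (φA≢0 1) (φA≢0 4))

        -- With r = B / A the hypothesis says that r^q r^{q²} lies in F_q, whence r^{q²} = r^{q⁴}.
        proportion : ∀ {e f} → Fixed e → Fixed f → ¬ e ≡ 0# → e * u ≡ f * E → u * G ≡ v * E
        proportion {e} {f} e-fixed f-fixed e≢0 eq = begin
          B₁ * B₂ * (A₁ * A₄)                              ≡⟨ cong₂ (λ x y → x * y * (A₁ * A₄)) (φB 1) (φB 2) ⟩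
          φ 1 r * A₁ * (φ 2 r * A₂) * (A₁ * A₄)            ≡⟨ cong (λ x → φ 1 r * A₁ * (x * A₂) * (A₁ * A₄)) r₂≡r₄ ⟩
          φ 1 r * A₁ * (φ 4 r * A₂) * (A₁ * A₄)            ≡⟨ solve 5 (λ r s x y z → r :* x :* (s :* y) :* (x :* z) := r :* x :* (s :* z) :* (x :* y)) refl (φ 1 r) (φ 4 r) A₁ A₂ A₄ ⟩
          φ 1 r * A₁ * (φ 4 r * A₄) * (A₁ * A₂)            ≡⟨ sym (cong₂ (λ x y → x * y * (A₁ * A₂)) (φB 1) (φB 4)) ⟩
          B₁ * B₄ * (A₁ * A₂)                              ∎
          where
          A⁻¹ = proj₁ (inverse A A≢0)
          r = B * A⁻¹
          φB : ∀ i → φ i B ≡ φ i r * φ i A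
          φB i = trans (cong (φ i) (trans (trans (sym (*-identityʳ B)) (cong (B *_) (sym (proj₂ (inverse A A≢0)))))
            (solve 3 (λ B A a → B :* (A :* a) := B :* a :* A) refl B A A⁻¹))) (φ-* i r A)
          e-r₁r₂ : e * (φ 1 r * φ 2 r) ≡ f
          e-r₁r₂ = *-cancelˡ (*≢0 (φA≢0 1) (φA≢0 2)) (begin
            E * (e * (φ 1 r * φ 2 r))                      ≡⟨ solve 5 (λ e r s x y → x :* y :* (e :* (r :* s)) := e :* (r :* x :* (s :* y))) refl e (φ 1 r) (φ 2 r) A₁ A₂ ⟩
            e * (φ 1 r * A₁ * (φ 2 r * A₂))                ≡⟨ sym (cong₂ (λ x y → e * (x * y)) (φB 1) (φB 2)) ⟩
            e * u                                          ≡⟨ eq ⟩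
            f * E                                          ≡⟨ *-comm f E ⟩
            E * f                                          ∎)
          e-r₂r₃ : e * (φ 2 r * φ 3 r) ≡ f
          e-r₂r₃ = trans (sym (trans (φ-* 1 e _) (cong₂ _*_ e-fixed (trans (φ-* 1 _ _) (cong₂ _*_ (φ-suc 1 r) (φ-suc 2 r))))))
            (trans (cong (φ 1) e-r₁r₂) f-fixed)
          r₂≡r₄ : φ 2 r ≡ φ 4 r
          r₂≡r₄ with r ≟ 0#
          ... | yes r≡0 = trans (trans (cong (φ 2) r≡0) (φ-0 2)) (sym (trans (cong (φ 4) r≡0) (φ-0 4)))
          ... | no r≢0 = trans (sym (φ-suc 1 r)) (trans (cong (φ 1) r₁≡r₃) (φ-suc 3 r))
            where
            r₁≡r₃ : φ 1 r ≡ φ 3 r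
            r₁≡r₃ = *-cancelˡ (*≢0 e≢0 (φ≢0 2 r≢0)) (trans (solve 3 (λ e r s → e :* s :* r := e :* (r :* s)) refl e (φ 1 r) (φ 2 r))
              (trans e-r₁r₂ (trans (sym e-r₂r₃) (sym (*-assoc _ _ _)))))

        -- For i = 1, 2, 4 proportionality contradicts AD ≠ BC at once. For i = 0, 3, 5, eliminating
        -- C and D leaves one relation between u and E and one between v and G, with coefficients in
        -- F_q. `proportion` couples them, and the equation of b refutes the result.
        independent : ∀ i → ¬ (∀ k → Q i k * π 1F ≡ Q i 1F * π k)
        -- Here u = b′ E and v = G, so u G = v E would give b′ = 1.
        independent 0F h = b′≢1 (x-y≡0⇒x≡y (*-cancelˡ-0 EG≢0 (trans
            (solve 5 (λ b′ E G u v → E :* G :* (b′ :- con (pos 1)) := u :* G :- v :* E :+ (b′ :* E :- u) :* G :- (G :- v) :* E) refl b′ E G u v)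
            (trans (cong₂ (λ x y → u * G - v * E + x * G - y * E) π₂≡0 π₃≡0) (trans
              (solve 3 (λ w E G → w :+ con (pos 0) :* G :- con (pos 0) :* E := w) refl (u * G - v * E) E G)
              (x≡y⇒x-y≡0 (proportion (φ-1 1) b′-fixed (0≢1 ∘ sym) (trans (*-identityˡ u) (trans (sym (x-y≡0⇒x≡y π₂≡0)) (cong (b′ *_) refl))))))))))
          where
          D₀≢0 : ¬ D₀ ≡ 0#
          D₀≢0 d = det≡0 0 (*-cancelˡ-0 (φA≢0 1) (trans (*-comm _ _) (trans (h 0F) (trans (cong (_* (b * B₁)) d) (zeroˡ _))))) d
          π₂≡0 : π 2F ≡ 0#
          π₂≡0 = *-cancelˡ-0 D₀≢0 (trans (sym (h 2F)) (zeroˡ _))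
          π₃≡0 : π 3F ≡ 0#
          π₃≡0 = *-cancelˡ-0 D₀≢0 (trans (sym (h 3F)) (zeroˡ _))
        independent 1F h = φdet≢0 1 (*-cancelˡ-0 b≢0 (trans
          (solve 5 (λ b A B C D → b :* (A :* D :- B :* C) := b :* D :* A :- C :* (b :* B)) refl b A₁ B₁ C₁ D₁) (x≡y⇒x-y≡0 (h 0F))))
        independent 2F h = *≢0 (φdet≢0 2) (φA≢0 1) (trans (h 2F) (zeroˡ _))
        independent 4F h = *≢0 (φdet≢0 4) (φA≢0 1) (trans (h 3F) (zeroˡ _))
        -- Adding the two relations, multiplied by G and E, gives (2 - b - b²) u G = 0, and 2 - b -
        -- b² = 1. Then u G = 0 and the first relation forces b′ = 1.
        independent 3F h = b′≢1 (x-y≡0⇒x≡y (*-cancelˡ-0 EG≢0 (trans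
            (solve 5 (λ b b′ E G u → E :* G :* (b′ :- con (pos 1)) := (con (pos 1) :- b :* b) :* (u :* G) :- ((con (pos 1) :- b :* b) :* u :- (b′ :- con (pos 1)) :* E) :* G) refl b b′ E G u)
            (trans (cong₂ (λ x y → (1# - b * b) * x - y * G) uG≡0 first)
              (solve 2 (λ x G → x :* con (pos 0) :- con (pos 0) :* G := con (pos 0)) refl (1# - b * b) G)))))
          where
          C₃≢0 : ¬ C₃ ≡ 0#
          C₃≢0 c = det≡0 3 c (*-cancelˡ-0 (φA≢0 1) (trans (*-comm _ _) (trans (h 0F) (trans (cong (_* (b * B₁)) c) (zeroˡ _)))))
          first : (1# - b * b) * u - (b′ - 1#) * E ≡ 0#
          first = *-cancelˡ-0 C₃≢0 (trans
            (solve 8 (λ b b′ A₁ A₂ B₁ B₂ C D → C :* ((con (pos 1) :- b :* b) :* (B₁ :* B₂) :- (b′ :- con (pos 1)) :* (A₁ :* A₂))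
              := (C :* A₂ :- b :* (D :* B₂)) :* A₁ :- C :* (b′ :* (A₁ :* A₂) :- B₁ :* B₂) :+ b :* B₂ :* (D :* A₁ :- C :* (b :* B₁))) refl b b′ A₁ A₂ B₁ B₂ C₃ D₃)
            (combine (b * B₂) (h 2F) (h 0F)))
          second : (1# - b) * v - (1# - b′) * G ≡ 0#
          second = *-cancelˡ-0 C₃≢0 (trans
            (solve 8 (λ b b′ A₁ A₄ B₁ B₄ C D → C :* ((con (pos 1) :- b) :* (B₁ :* B₄) :- (con (pos 1) :- b′) :* (A₁ :* A₄))
              := (b′ :* (C :* A₄) :- D :* B₄) :* A₁ :- C :* (A₁ :* A₄ :- B₁ :* B₄) :+ B₄ :* (D :* A₁ :- C :* (b :* B₁))) refl b b′ A₁ A₄ B₁ B₄ C₃ D₃)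
            (combine B₄ (h 3F) (h 0F)))
          1-b*b≡b : 1# - b * b ≡ b
          1-b*b≡b = trans (cong (_- b * b) (sym golden)) (solve 1 (λ b → b :* b :+ b :- b :* b := b) refl b)
          ratio : u * G - v * E ≡ 0#
          ratio = x≡y⇒x-y≡0 (proportion (fixed-+ (φ-1 1) (fixed-neg (fixed-* b-fixed b-fixed))) (fixed-+ b′-fixed (fixed-neg (φ-1 1)))
            (λ eq → b≢0 (trans (sym 1-b*b≡b) eq)) (x-y≡0⇒x≡y first))
          uG≡0 : u * G ≡ 0#
          uG≡0 = trans (solve 6 (λ b b′ E G u v → u :* G := ((con (pos 1) :- b :* b) :* u :- (b′ :- con (pos 1)) :* E) :* G
              :+ ((con (pos 1) :- b) :* v :- (con (pos 1) :- b′) :* G) :* E :+ (u :* G :- v :* E) :* (con (pos 1) :- b) :+ (b :* b :+ b :- con (pos 1)) :* (u :* G)) refl b b′ E G u v)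
            (vanish first second ratio golden′)
        -- The relations give (1 + b′) u G and (1 + b′) v E opposite values (b′² - 1) E G and (1 -
        -- b′²) E G. Their equality forces b′² = 1, whence b′ = 0 from b′² + b′ = 1.
        independent 5F h = b′≢0 (trans
            (solve 1 (λ b′ → b′ := b′ :* b′ :+ b′ :- con (pos 1) :- (b′ :* b′ :- con (pos 1))) refl b′)
            (trans (cong₂ _-_ golden-b′ (*-cancelˡ-0 EG≢0 (two-cancel (trans
              (solve 5 (λ b′ E G u v → E :* G :* (b′ :* b′ :- con (pos 1)) :+ E :* G :* (b′ :* b′ :- con (pos 1)) :=
                  ((con (pos 1) :+ b′) :* u :- (b′ :* b′ :- con (pos 1)) :* E) :* :- G
                  :+ (v :- (con (pos 1) :- b′) :* G) :* ((con (pos 1) :+ b′) :* E) :+ (u :* G :- v :* E) :* (con (pos 1) :+ b′) :+ con (pos 0) :* con (pos 0)) refl b′ E G u v)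
              (vanish first second ratio refl))))) (-‿inverseʳ _)))
          where
          h₀ : D₅ * A₁ ≡ - (C₅ * B₁)
          h₀ = begin
            D₅ * A₁                ≡⟨ h 0F ⟩
            b′ * C₅ * (b * B₁)     ≡⟨ solve 4 (λ b b′ C B → b′ :* C :* (b :* B) := b :* b′ :* (C :* B)) refl b b′ C₅ B₁ ⟩
            b * b′ * (C₅ * B₁)     ≡⟨ cong (_* (C₅ * B₁)) b*b′ ⟩
            - 1# * (C₅ * B₁)       ≡⟨ solve 1 (λ x → :- con (pos 1) :* x := :- x) refl (C₅ * B₁) ⟩
            - (C₅ * B₁)            ∎
          C₅≢0 : ¬ C₅ ≡ 0#
          C₅≢0 c = det≡0 5 c (*-cancelˡ-0 (φA≢0 1) (trans (*-comm _ _) (trans h₀ (trans (cong (λ c → - (c * B₁)) c) (trans (cong -_ (zeroˡ B₁)) -0#≈0#)))))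
          first : (1# + b′) * u - (b′ * b′ - 1#) * E ≡ 0#
          first = *-cancelˡ-0 C₅≢0 (trans
            (solve 7 (λ b′ A₁ A₂ B₁ B₂ C D → C :* ((con (pos 1) :+ b′) :* (B₁ :* B₂) :- (b′ :* b′ :- con (pos 1)) :* (A₁ :* A₂))
              := (C :* A₂ :- D :* B₂) :* A₁ :- b′ :* C :* (b′ :* (A₁ :* A₂) :- B₁ :* B₂) :+ B₂ :* (D :* A₁ :- :- (C :* B₁))) refl b′ A₁ A₂ B₁ B₂ C₅ D₅)
            (combine B₂ (h 2F) h₀))
          second : v - (1# - b′) * G ≡ 0#
          second = *-cancelˡ-0 C₅≢0 (trans
            (solve 7 (λ b A₁ A₄ B₁ B₄ C D → let b′ = :- con (pos 1) :- b in C :* (B₁ :* B₄ :- (con (pos 1) :- b′) :* (A₁ :* A₄))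
              := :- ((C :* A₄ :- b :* (D :* B₄)) :* A₁ :- b′ :* C :* (A₁ :* A₄ :- B₁ :* B₄) :+ b :* B₄ :* (D :* A₁ :- :- (C :* B₁)))) refl b A₁ A₄ B₁ B₄ C₅ D₅)
            (trans (cong -_ (combine (b * B₄) (h 3F) h₀)) -0#≈0#))
          1+b′≢0 : ¬ 1# + b′ ≡ 0#
          1+b′≢0 eq = -≢0 b≢0 (trans (solve 1 (λ b → :- b := con (pos 1) :+ (:- con (pos 1) :- b)) refl b) eq)
          ratio : u * G - v * E ≡ 0#
          ratio = x≡y⇒x-y≡0 (proportion (fixed-+ (φ-1 1) b′-fixed) (fixed-+ (fixed-* b′-fixed b′-fixed) (fixed-neg (φ-1 1))) 1+b′≢0 (x-y≡0⇒x≡y first))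

      -- With A = 0 both B and C are nonzero and `π` has no Z₀ coordinate, so a multiple of `π` has
      -- none either. For i = 1, 3, 5 the Z₀ coordinate of Qᵢ is a nonzero multiple of a conjugate
      -- of C.
      independent-A≡0 : A ≡ 0# → ∀ i → ¬ (∀ k → Q i k * π 0F ≡ Q i 0F * π k)
      independent-A≡0 A≡0 = cases
        where
        A₁≡0 : A₁ ≡ 0#
        A₁≡0 = trans (cong (φ 1) A≡0) (φ-0 1)
        BC≢0 : ¬ B * C ≡ 0#
        BC≢0 eq = det≢0 (trans (cong₂ (λ a y → a * D - y) A≡0 eq) (solve 1 (λ D → con (pos 0) :* D :- con (pos 0) := con (pos 0)) refl D))
        B≢0 : ¬ B ≡ 0#
        B≢0 eq = BC≢0 (trans (cong (_* C) eq) (zeroˡ C))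
        C≢0 : ¬ C ≡ 0#
        C≢0 eq = BC≢0 (trans (cong (B *_) eq) (zeroʳ B))
        π₀≢0 : ¬ π 0F ≡ 0#
        π₀≢0 = *≢0 b≢0 (φ≢0 1 B≢0)
        kill : ∀ {x y} → x * π 0F ≡ y * A₁ → x ≡ 0#
        kill eq = *-cancelˡ-0 π₀≢0 (trans (*-comm _ _) (trans eq (trans (cong (_ *_) A₁≡0) (zeroʳ _))))
        cases : ∀ i → ¬ (∀ k → Q i k * π 0F ≡ Q i 0F * π k)
        -- Q₀ has no s₂ coordinate, whereas that of `π` is now -B₁ B₂.
        cases 0F h = *≢0 (φ≢0 0 C≢0) (*≢0 (φ≢0 1 B≢0) (φ≢0 2 B≢0)) (begin
          C₀ * (B₁ * B₂)                                  ≡⟨ solve 5 (λ C B B′ b′ A → C :* (B :* B′) := C :* (b′ :* (con (pos 0) :* A)) :- C :* (b′ :* (con (pos 0) :* A) :- B :* B′)) refl C₀ B₁ B₂ b′ A₂ ⟩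
          C₀ * (b′ * (0# * A₂)) - C₀ * (b′ * (0# * A₂) - B₁ * B₂) ≡⟨ cong (λ a → C₀ * (b′ * (0# * A₂)) - C₀ * (b′ * (a * A₂) - B₁ * B₂)) (sym A₁≡0) ⟩
          C₀ * (b′ * (0# * A₂)) - C₀ * π 2F               ≡⟨ cong (λ x → C₀ * (b′ * (0# * A₂)) - x) (sym (h 2F)) ⟩
          C₀ * (b′ * (0# * A₂)) - 0# * π 0F               ≡⟨ solve 4 (λ C b′ A x → C :* (b′ :* (con (pos 0) :* A)) :- con (pos 0) :* x := con (pos 0)) refl C₀ b′ A₂ (π 0F) ⟩
          0#                                              ∎)
        cases 1F h = φ≢0 1 C≢0 (kill (h 1F))
        cases 2F h = φdet≢0 2 (*-cancelˡ-0 π₀≢0 (trans (*-comm _ _) (trans (h 2F) (zeroˡ _))))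
        cases 3F h = φ≢0 3 C≢0 (kill (h 1F))
        cases 4F h = φdet≢0 4 (*-cancelˡ-0 π₀≢0 (trans (*-comm _ _) (trans (h 3F) (zeroˡ _))))
        cases 5F h = *≢0 b′≢0 (φ≢0 5 C≢0) (kill (h 1F))

      avoided : ∃[ s ] (dot π s ≡ 0# × (∀ i → ¬ dot (Q i) s ≡ 0#))
      avoided with A ≟ 0#
      -- The axis of projection must be one on which `π` is nonzero: Z₀ with coefficient A₁, or X₀
      -- with coefficient b B₁ when A = 0.
      ... | no A≢0 = avoidOnKernel 6<order π 1F (φ≢0 1 A≢0) Q (independent A≢0)
      ... | yes A≡0 = avoidOnKernel 6<order π 0F
        (*≢0 b≢0 (φ≢0 1 (λ B≡0 → det≢0 (trans (cong₂ (λ a b → a * D - b * C) A≡0 B≡0)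
          (solve 2 (λ C D → con (pos 0) :* D :- con (pos 0) :* C := con (pos 0)) refl C D))))) Q (independent-A≡0 A≡0)

      conclude : (c₂ ≡ 0# × c₅ ≡ 0#) ⊎ (c₁ ≡ 0# × c₄ ≡ 0#) → ⊥
      conclude shape with avoided | shape
      ... | s , πs≡0 , good | inj₁ (c₂≡0 , c₅≡0) =
          noTriangularPoint f A B C D kernel fiveZeroThree degrees<q (X s) (λ i eq → good i (trans (Q≡form s i) eq)) below
        where
        below : ∀ i j → j Fin.< i → form A B (X s) (fiveZeroThree ⟨$⟩ʳ i) ≡ 0# ⊎ coeff ((fiveZeroThree ⟨$⟩ʳ j) ⊖ (fiveZeroThree ⟨$⟩ʳ i)) ≡ 0#
        below 0F j ()
        below 1F 0F _ = inj₂ c₅≡0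
        below 1F (suc _) (s≤s ())
        below 2F 0F _ = inj₂ c₂≡0
        below 2F 1F _ = inj₂ refl
        below 2F (suc (suc _)) (s≤s (s≤s ()))
        below 3F j _ = inj₁ (trans (sym (row₁≡form s A B)) πs≡0)
        below 4F j _ = inj₁ (P₂≡0 s)
        below 5F j _ = inj₁ (P₄≡0 s)
      ... | s , πs≡0 , good | inj₂ (c₁≡0 , c₄≡0) =
          noTriangularPoint f A B C D kernel zeroThreeFive degrees<q (X s) (λ i eq → good i (trans (Q≡form s i) eq)) below
        where
        below : ∀ i j → j Fin.< i → form A B (X s) (zeroThreeFive ⟨$⟩ʳ i) ≡ 0# ⊎ coeff ((zeroThreeFive ⟨$⟩ʳ j) ⊖ (zeroThreeFive ⟨$⟩ʳ i)) ≡ 0#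
        below 0F j ()
        below 1F 0F _ = inj₂ refl
        below 1F (suc _) (s≤s ())
        below 2F 0F _ = inj₂ c₁≡0
        below 2F 1F _ = inj₂ c₄≡0
        below 2F (suc (suc _)) (s≤s (s≤s ()))
        below 3F j _ = inj₁ (trans (sym (row₁≡form s A B)) πs≡0)
        below 4F j _ = inj₁ (P₂≡0 s)
        below 5F j _ = inj₁ (P₄≡0 s)

-- Counting with lists and bounding numbers of roots.

lookup-injective : ∀ {A : Set} {xs : List A} → Unique xs → ∀ {i j} → List.lookup xs i ≡ List.lookup xs j → i ≡ j
lookup-injective (_ ∷ _) {zero} {zero} _ = refl
lookup-injective (x∉ ∷ _) {zero} {suc j} eq = ⊥-elim (ListAll.lookup x∉ (∈-lookup j) eq)
lookup-injective (x∉ ∷ _) {suc i} {zero} eq = ⊥-elim (ListAll.lookup x∉ (∈-lookup i) (sym eq))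
lookup-injective (_ ∷ u) {suc i} {suc j} eq = cong suc (lookup-injective u eq)

unique-⊆⇒length≤ : ∀ {A : Set} {xs ys : List A} → Unique xs → (∀ {x} → x ∈ xs → x ∈ ys) → length xs ℕ.≤ length ys
unique-⊆⇒length≤ {xs = xs} u sub = Fin.injective⇒≤ {f = λ i → Any.index (sub (∈-lookup {xs = xs} i))}
  (λ eq → lookup-injective u (Membership.index-injective (setoid _) (sub (∈-lookup _)) (sub (∈-lookup _)) eq))

length-concatMap≤ : ∀ {A B : Set} (f : A → List B) {m} → (∀ x → length (f x) ℕ.≤ m) → ∀ xs → length (concatMap f xs) ℕ.≤ length xs ℕ.* m
length-concatMap≤ f b [] = z≤n
length-concatMap≤ f b (x ∷ xs) = subst (ℕ._≤ _) (sym (List.length-++ (f x))) (ℕ.+-mono-≤ (b x) (length-concatMap≤ f b xs))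

suc^6 : ∀ m → suc m ℕ.^ 6 ≡ suc (m ℕ.* θ (suc m))
suc^6 = solve 1 (λ m → let q = con 1 :+ m in
  q :^ 6 := con 1 :+ m :* (con 1 :+ q :+ q :^ 2 :+ q :^ 3 :+ q :^ 4 :+ q :^ 5)) refl
  where open ℕSolver.+-*-Solver using (solve; con; _:+_; _:*_; _:^_; _:=_)

module Roots (F : Field) where
  open FieldPowers F
  open Polynomials F
  open Solver using (solve; _:=_; _:+_; _:*_; _:-_; :-_; con)

  private
    evalU-∷ʳ : ∀ m a x → evalU (replicate m 0# ∷ʳ a) x ≡ x ^ m * a
    evalU-∷ʳ zero a x = solve 2 (λ a x → a :+ x :* con (pos 0) := con (pos 1) :* a) refl a x
    evalU-∷ʳ (suc m) a x = trans (+-identityˡ _) (trans (cong (x *_) (evalU-∷ʳ m a x)) (sym (*-assoc _ _ _)))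

    ∷ʳ≢0 : ∀ m → ¬ replicate m 0# ∷ʳ 1# ≡ replicate (suc m) 0#
    ∷ʳ≢0 zero eq = 0≢1 (sym (cong Vec.head eq))
    ∷ʳ≢0 (suc m) eq = ∷ʳ≢0 m (cong Vec.tail eq)

  -- One more root would annihilate X^{m+1} - c, whose leading coefficient is 1.
  length-roots≤ : ∀ {xs m c} → Unique xs → (∀ {x} → x ∈ xs → x ^ suc m ≡ c) → length xs ℕ.≤ suc m
  length-roots≤ {xs} {m} {c} u roots with length xs ℕ.≤? suc m
  ... | yes p = p
  ... | no p = ⊥-elim (∷ʳ≢0 m (cong Vec.tail (manyRoots⇒≡0 (- c ∷ (replicate m 0# ∷ʳ 1#)) r
        (λ eq → Fin.inject≤-injective _ _ _ _ (lookup-injective u eq)) root)))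
    where
    r : Fin (suc (suc m)) → K
    r i = List.lookup xs (Fin.inject≤ i (ℕ.≰⇒> p))
    root : ∀ i → evalU (- c ∷ (replicate m 0# ∷ʳ 1#)) (r i) ≡ 0#
    root i = trans (cong (λ y → - c + r i * y) (evalU-∷ʳ m 1# (r i)))
      (trans (solve 3 (λ c x y → :- c :+ x :* (y :* con (pos 1)) := x :* y :- c) refl c (r i) (r i ^ m))
        (x≡y⇒x-y≡0 (roots (∈-lookup {xs = xs} _))))

-- The linear set of g is maximum scattered.

module Scattered (F : Field) {p : ℕ} (p-prime : Prime p) (k : ℕ) (enum : Fin ((p ℕ.^ k) ℕ.^ 6) ↔ Field.K F)
  (5≤q : 5 ℕ.≤ p ℕ.^ k) (b : Field.K F) (b-fixed : Frobenius.Fixed F p-prime k enum b)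
  (golden : Field._+_ F (Field._*_ F b b) b ≡ Field.1# F)
  (2≢0 : ¬ Field._+_ F (Field.1# F) (Field.1# F) ≡ Field.0# F) where
  open Frobenius F p-prime k enum
  open Twisting F p-prime k enum b b-fixed using (g)
  open Nonequivalence F p-prime k enum 5≤q b b-fixed golden 2≢0 using (golden′; b≢1; two-cancel)
  open Roots F
  open Solver using (solve; _:=_; _:+_; _:*_; _:-_; :-_; con)
  open ≡-Reasoning

  det₃≡0 : ∀ {a₁ a₂ a₃ b₁ b₂ b₃ c₁ c₂ c₃ y₁ y₂ y₃} → ¬ y₁ ≡ 0# →
    a₁ * y₁ + a₂ * y₂ + a₃ * y₃ ≡ 0# → b₁ * y₁ + b₂ * y₂ + b₃ * y₃ ≡ 0# → c₁ * y₁ + c₂ * y₂ + c₃ * y₃ ≡ 0# →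
    a₁ * (b₂ * c₃ - b₃ * c₂) - a₂ * (b₁ * c₃ - b₃ * c₁) + a₃ * (b₁ * c₂ - b₂ * c₁) ≡ 0#
  det₃≡0 {a₁} {a₂} {a₃} {b₁} {b₂} {b₃} {c₁} {c₂} {c₃} {y₁} {y₂} {y₃} y≢0 p q r = *-cancelˡ-0 y≢0 (trans
    (solve 12 (λ a₁ a₂ a₃ b₁ b₂ b₃ c₁ c₂ c₃ y₁ y₂ y₃ →
      y₁ :* (a₁ :* (b₂ :* c₃ :- b₃ :* c₂) :- a₂ :* (b₁ :* c₃ :- b₃ :* c₁) :+ a₃ :* (b₁ :* c₂ :- b₂ :* c₁)) :=
      (b₂ :* c₃ :- b₃ :* c₂) :* (a₁ :* y₁ :+ a₂ :* y₂ :+ a₃ :* y₃) :- (a₂ :* c₃ :- a₃ :* c₂) :* (b₁ :* y₁ :+ b₂ :* y₂ :+ b₃ :* y₃)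
      :+ (a₂ :* b₃ :- a₃ :* b₂) :* (c₁ :* y₁ :+ c₂ :* y₂ :+ c₃ :* y₃)) refl a₁ a₂ a₃ b₁ b₂ b₃ c₁ c₂ c₃ y₁ y₂ y₃)
    (trans (cong₂ _+_ (cong₂ (λ x y → (b₂ * c₃ - b₃ * c₂) * x - (a₂ * c₃ - a₃ * c₂) * y) p q) (cong ((a₂ * b₃ - a₃ * b₂) *_) r))
      (solve 3 (λ x y z → x :* con (pos 0) :- y :* con (pos 0) :+ z :* con (pos 0) := con (pos 0)) refl _ _ _)))

  -- The expression no longer contains b, which makes its values for even and for odd conjugates
  -- comparable.
  S : (a c e u v w : K) → K
  S a c e u v w = (u - a) * (v - c) * (w - e) + (v - a) * (w - c) * (u - e) - (w - a) * (u - c) * (v - e)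

  -- The determinant is (1 - b) S modulo b² + b - 1.
  determinant⇒S≡0 : ∀ {a c e u v w y₁ y₂ y₃} → ¬ y₁ ≡ 0# →
    (u - a) * y₁ + (v - a) * y₂ + b * (w - a) * y₃ ≡ 0# →
    b * (u - c) * y₁ + (v - c) * y₂ + (w - c) * y₃ ≡ 0# →
    (u - e) * y₁ + b * (v - e) * y₂ + (w - e) * y₃ ≡ 0# → S a c e u v w ≡ 0#
  determinant⇒S≡0 {a} {c} {e} {u} {v} {w} y≢0 p q r = *-cancelˡ-0 {1# - b} (λ eq → b≢1 (sym (x-y≡0⇒x≡y eq))) (trans
    (solve 7 (λ a c e u v w b →
      (con (pos 1) :- b) :* ((u :- a) :* (v :- c) :* (w :- e) :+ (v :- a) :* (w :- c) :* (u :- e) :- (w :- a) :* (u :- c) :* (v :- e)) :=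
      (u :- a) :* ((v :- c) :* (w :- e) :- (w :- c) :* (b :* (v :- e))) :- (v :- a) :* (b :* (u :- c) :* (w :- e) :- (w :- c) :* (u :- e))
        :+ b :* (w :- a) :* (b :* (u :- c) :* (b :* (v :- e)) :- (v :- c) :* (u :- e))
        :- (b :- con (pos 1)) :* (w :- a) :* (u :- c) :* (v :- e) :* (b :* b :+ b :- con (pos 1))) refl a c e u v w b)
    (trans (cong₂ (λ x y → x - (b - 1#) * (w - a) * (u - c) * (v - e) * y) (det₃≡0 y≢0 p q r) golden′)
      (solve 1 (λ x → con (pos 0) :- x :* con (pos 0) := con (pos 0)) refl _)))

  product≡0 : ∀ {x y z} → x * y * z ≡ 0# → x ≡ 0# ⊎ y ≡ 0# ⊎ z ≡ 0#
  product≡0 {x} {y} {z} eq with x ≟ 0# | y ≟ 0#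
  ... | yes x≡0 | _ = inj₁ x≡0
  ... | no _ | yes y≡0 = inj₂ (inj₁ y≡0)
  ... | no x≢0 | no y≢0 = inj₂ (inj₂ (*-cancelˡ-0 (*≢0 x≢0 y≢0) eq))

  scattered : ∀ l x → ¬ x ≡ 0# → g (l * x) ≡ l * g x → Fixed l
  scattered l x x≢0 eq = trans l₁≡l₀ (φ0 l)
    where
    l₀ = φ 0 l ; l₁ = φ 1 l ; l₂ = φ 2 l ; l₃ = φ 3 l ; l₄ = φ 4 l ; l₅ = φ 5 l

    E : (l₁ - l₀) * φ 1 x + (l₃ - l₀) * φ 3 x + b * (l₅ - l₀) * φ 5 x ≡ 0#
    E = begin
      (l₁ - l₀) * φ 1 x + (l₃ - l₀) * φ 3 x + b * (l₅ - l₀) * φ 5 x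
        ≡⟨ solve 8 (λ l₁ l₃ l₅ l₀ x₁ x₃ x₅ b → (l₁ :- l₀) :* x₁ :+ (l₃ :- l₀) :* x₃ :+ b :* (l₅ :- l₀) :* x₅ :=
             l₁ :* x₁ :+ l₃ :* x₃ :+ b :* (l₅ :* x₅) :- l₀ :* (x₁ :+ x₃ :+ b :* x₅)) refl l₁ l₃ l₅ l₀ (φ 1 x) (φ 3 x) (φ 5 x) b ⟩
      l₁ * φ 1 x + l₃ * φ 3 x + b * (l₅ * φ 5 x) - l₀ * g x
        ≡⟨ cong₂ (λ y z → y - z * g x) (sym (cong₂ _+_ (cong₂ _+_ (φ-* 1 l x) (φ-* 3 l x)) (cong (b *_) (φ-* 5 l x)))) (φ0 l) ⟩
      g (l * x) - l * g x  ≡⟨ x≡y⇒x-y≡0 eq ⟩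
      0#                   ∎

    -- For even i only the odd conjugates of x occur, and for odd i only the even ones. Each parity
    -- yields three equations in three nonzero unknowns.
    twist : ∀ i → (φ (i ℕ.+ 1) l - φ (i ℕ.+ 0) l) * φ (i ℕ.+ 1) x + (φ (i ℕ.+ 3) l - φ (i ℕ.+ 0) l) * φ (i ℕ.+ 3) x
      + b * (φ (i ℕ.+ 5) l - φ (i ℕ.+ 0) l) * φ (i ℕ.+ 5) x ≡ 0#
    twist i = trans (sym (begin
      φ i ((l₁ - l₀) * φ 1 x + (l₃ - l₀) * φ 3 x + b * (l₅ - l₀) * φ 5 x)
        ≡⟨ trans (φ-+ i _ _) (cong (_+ φ i (b * (l₅ - l₀) * φ 5 x)) (φ-+ i _ _)) ⟩
      φ i ((l₁ - l₀) * φ 1 x) + φ i ((l₃ - l₀) * φ 3 x) + φ i (b * (l₅ - l₀) * φ 5 x)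
        ≡⟨ cong₂ _+_ (cong₂ _+_ (term 1) (term 3)) (trans (φ-* i _ _) (cong₂ _*_ (trans (φ-* i b _) (cong₂ _*_ (φ-fixed b-fixed i) (difference 5))) (φ-φ i 5 x))) ⟩
      _ ∎)) (trans (cong (φ i) E) (φ-0 i))
      where
      difference : ∀ j → φ i (φ j l - l₀) ≡ φ (i ℕ.+ j) l - φ (i ℕ.+ 0) l
      difference j = trans (φ-+ i _ _) (cong₂ _+_ (φ-φ i j l) (trans (φ-neg i _) (cong -_ (φ-φ i 0 l))))
      term : ∀ j → φ i ((φ j l - l₀) * φ j x) ≡ (φ (i ℕ.+ j) l - φ (i ℕ.+ 0) l) * φ (i ℕ.+ j) x
      term j = trans (φ-* i _ _) (cong₂ _*_ (difference j) (φ-φ i j x))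

    wrap : ∀ {s t s′ t′ c} r r′ → s′ ≡ s → t′ ≡ t → r + (s - c) * t + r′ ≡ 0# → r + (s′ - c) * t′ + r′ ≡ 0#
    wrap _ _ refl refl p = p

    wrap-b : ∀ {s t s′ t′ c} r → s′ ≡ s → t′ ≡ t → r + b * (s - c) * t ≡ 0# → r + b * (s′ - c) * t′ ≡ 0#
    wrap-b _ refl refl p = p

    wrap-first : ∀ {s t s′ t′ c} r r′ → s′ ≡ s → t′ ≡ t → (s - c) * t + r + r′ ≡ 0# → (s′ - c) * t′ + r + r′ ≡ 0#
    wrap-first _ _ refl refl p = p

    rotate : ∀ {x y z} → x + y + z ≡ 0# → z + x + y ≡ 0#
    rotate {x} {y} {z} p = trans (solve 3 (λ x y z → z :+ x :+ y := x :+ y :+ z) refl x y z) p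

    fold : ∀ i {y} → φ i y ≡ φ (6 ℕ.+ i) y
    fold i {y} = sym (φ-6+ i y)

    S-even : S l₀ l₂ l₄ l₁ l₃ l₅ ≡ 0#
    S-even = determinant⇒S≡0 (φ≢0 1 x≢0) (twist 0)
      (rotate (wrap-b _ (fold 1) (fold 1) (twist 2)))
      (rotate (rotate (wrap _ _ (fold 1) (fold 1) (wrap-b _ (fold 3) (fold 3) (twist 4)))))

    S-odd : S l₁ l₃ l₅ l₂ l₄ l₀ ≡ 0#
    S-odd = determinant⇒S≡0 (φ≢0 2 x≢0) (wrap-b _ (fold 0) (fold 0) (twist 1))
      (rotate (wrap _ _ (fold 0) (fold 0) (wrap-b _ (fold 2) (fold 2) (twist 3))))
      (rotate (rotate (wrap-first _ _ (fold 0) (fold 0) (wrap _ _ (fold 2) (fold 2) (wrap-b _ (fold 4) (fold 4) (twist 5))))))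

    difference≡0 : (l₁ - l₄) * (l₃ - l₀) * (l₅ - l₂) ≡ 0#
    difference≡0 = two-cancel (trans
      (solve 6 (λ a c e u v w →
        let S = λ a c e u v w → (u :- a) :* (v :- c) :* (w :- e) :+ (v :- a) :* (w :- c) :* (u :- e) :- (w :- a) :* (u :- c) :* (v :- e)
            X = (u :- e) :* (v :- a) :* (w :- c) in X :+ X := S a c e u v w :- S u v w c e a) refl l₀ l₂ l₄ l₁ l₃ l₅)
      (trans (cong₂ _-_ S-even S-odd) (-‿inverseʳ _)))

    sum≡0 : (l₁ - l₀) * (l₃ - l₂) * (l₅ - l₄) - (l₁ - l₂) * (l₃ - l₄) * (l₅ - l₀) ≡ 0#
    sum≡0 = two-cancel (trans
      (solve 6 (λ a c e u v w →
        let S = λ a c e u v w → (u :- a) :* (v :- c) :* (w :- e) :+ (v :- a) :* (w :- c) :* (u :- e) :- (w :- a) :* (u :- c) :* (v :- e)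
            X = (u :- a) :* (v :- c) :* (w :- e) :- (u :- c) :* (v :- e) :* (w :- a) in X :+ X := S a c e u v w :+ S u v w c e a) refl l₀ l₂ l₄ l₁ l₃ l₅)
      (trans (cong₂ _+_ S-even S-odd) (+-identityˡ _)))

    shift : ∀ i m n → φ m l ≡ φ n l → φ (i ℕ.+ m) l ≡ φ (i ℕ.+ n) l
    shift i m n eq = trans (sym (φ-φ i m l)) (trans (cong (φ i) eq) (φ-φ i n l))

    oneOf : ∀ {A B C G : Set} → A ⊎ B ⊎ C → (A → G) → (B → G) → (C → G) → G
    oneOf (inj₁ a) f _ _ = f a
    oneOf (inj₂ (inj₁ b)) _ g _ = g b
    oneOf (inj₂ (inj₂ c)) _ _ h = h c

    -- Up to sign each of the three factors is a conjugate of l₃ - l₀.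
    l₃≡l₀ : l₃ ≡ l₀
    l₃≡l₀ = oneOf (product≡0 difference≡0)
      (λ p → trans (sym (φ-6+ 3 l)) (trans (sym (shift 5 1 4 (x-y≡0⇒x≡y p))) (φ-6+ 0 l)))
      (λ p → x-y≡0⇒x≡y p)
      (λ p → trans (sym (shift 1 5 2 (x-y≡0⇒x≡y p))) (φ-6+ 0 l))

    l₄≡l₁ : l₄ ≡ l₁
    l₄≡l₁ = shift 1 3 0 l₃≡l₀

    l₅≡l₂ : l₅ ≡ l₂
    l₅≡l₂ = shift 2 3 0 l₃≡l₀

    -- Once l lies in F_{q³}, the two products in `sum≡0` are negatives of each other. The factors
    -- that remain are, up to sign, conjugates of l₁ - l₀.
    cycle≡0 : (l₁ - l₀) * (l₀ - l₂) * (l₂ - l₁) ≡ 0#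
    cycle≡0 = two-cancel (begin
      (l₁ - l₀) * (l₀ - l₂) * (l₂ - l₁) + (l₁ - l₀) * (l₀ - l₂) * (l₂ - l₁)
        ≡⟨ solve 3 (λ a u c → (u :- a) :* (a :- c) :* (c :- u) :+ (u :- a) :* (a :- c) :* (c :- u) :=
             (u :- a) :* (a :- c) :* (c :- u) :- (u :- c) :* (a :- u) :* (c :- a)) refl l₀ l₁ l₂ ⟩
      (l₁ - l₀) * (l₀ - l₂) * (l₂ - l₁) - (l₁ - l₂) * (l₀ - l₁) * (l₂ - l₀)
        ≡⟨ sym (cong₂ (λ e v → (l₁ - l₀) * (v - l₂) * (l₂ - e) - (l₁ - l₂) * (v - e) * (l₂ - l₀)) l₄≡l₁ l₃≡l₀) ⟩
      (l₁ - l₀) * (l₃ - l₂) * (l₂ - l₄) - (l₁ - l₂) * (l₃ - l₄) * (l₂ - l₀)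
        ≡⟨ sym (cong (λ w → (l₁ - l₀) * (l₃ - l₂) * (w - l₄) - (l₁ - l₂) * (l₃ - l₄) * (w - l₀)) l₅≡l₂) ⟩
      (l₁ - l₀) * (l₃ - l₂) * (l₅ - l₄) - (l₁ - l₂) * (l₃ - l₄) * (l₅ - l₀) ≡⟨ sum≡0 ⟩
      0# ∎)

    l₁≡l₀ : l₁ ≡ l₀
    l₁≡l₀ = oneOf (product≡0 cycle≡0)
      (λ p → x-y≡0⇒x≡y p)
      (λ p → trans (shift 1 0 2 (x-y≡0⇒x≡y p)) l₃≡l₀)
      (λ p → trans (sym (φ-6+ 1 l)) (trans (shift 5 2 1 (x-y≡0⇒x≡y p)) (φ-6+ 0 l)))

  -- This is q - 1: an element is in F_q* exactly when its m-th power is 1, which turns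
  -- F_q-proportionality into equality of m-th powers.
  m : ℕ
  m = ℕ.pred q

  q≡1+m : q ≡ suc m
  q≡1+m = sym (ℕ.suc-pred q {{ℕ.>-nonZero (ℕ.≤-trans (s≤s z≤n) 5≤q)}})

  order≡ : q ℕ.^ 6 ≡ suc (m ℕ.* θ q)
  order≡ = subst (λ q → q ℕ.^ 6 ≡ suc (m ℕ.* θ q)) (sym q≡1+m)
    (suc^6 m)

  φ1 : ∀ x → φ 1 x ≡ x * x ^ m
  φ1 x = cong (x ^_) (trans (ℕ.*-identityʳ q) q≡1+m)

  fixed⇒^m≡1 : ∀ {x} → ¬ x ≡ 0# → Fixed x → x ^ m ≡ 1#
  fixed⇒^m≡1 {x} x≢0 fix = *-cancelˡ x≢0 (trans (sym (φ1 x)) (trans fix (sym (*-identityʳ x))))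

  ^m≡1⇒fixed : ∀ {x} → x ^ m ≡ 1# → Fixed x
  ^m≡1⇒fixed {x} eq = trans (φ1 x) (trans (cong (x *_) eq) (*-identityʳ x))

  ^m^θ≡1 : ∀ {x} → ¬ x ≡ 0# → (x ^ m) ^ θ q ≡ 1#
  ^m^θ≡1 {x} x≢0 = *-cancelˡ x≢0 (begin
    x * (x ^ m) ^ θ q      ≡⟨ cong (x *_) (sym (^-* x (θ q) m)) ⟩
    x ^ suc (θ q ℕ.* m)    ≡⟨ cong (x ^_) (trans (cong suc (ℕ.*-comm (θ q) m)) (sym order≡)) ⟩
    x ^ (q ℕ.^ 6)          ≡⟨ x^order≡x x ⟩
    x                      ≡⟨ sym (*-identityʳ x) ⟩
    x * 1#                 ∎)

  elements nonzeros values : List K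
  elements = List.tabulate (Inverse.to enum)
  nonzeros = List.filter (λ x → ¬? (x ≟ 0#)) elements
  -- The values of x^{q-1}, which separate the classes of K* modulo F_q*.
  values = List.deduplicate _≟_ (List.map (_^ m) nonzeros)

  ∈-elements : ∀ x → x ∈ elements
  ∈-elements x = subst (_∈ elements) (Inverse.strictlyInverseˡ enum x) (∈-tabulate⁺ (Inverse.from enum x))

  ∈-values : ∀ {x} → ¬ x ≡ 0# → x ^ m ∈ values
  ∈-values x≢0 = Equivalence.to (deduplicate-∈⇔ _≟_) (∈-map⁺ (_^ m) (∈-filter⁺ (λ x → ¬? (x ≟ 0#)) (∈-elements _) x≢0))

  representative : ∀ {v} → v ∈ values → ∃[ x ] (¬ x ≡ 0# × v ≡ x ^ m)
  representative v∈ with ∈-map⁻ (_^ m) (Equivalence.from (deduplicate-∈⇔ _≟_) v∈)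
  ... | x , x∈ , eq = x , proj₂ (∈-filter⁻ (λ x → ¬? (x ≟ 0#)) {xs = elements} x∈) , eq

  unique-values : Unique values
  unique-values = deduplicate-! _≟_ (List.map (_^ m) nonzeros)

  -- By q⁶ - 1 = (q - 1) θ(q), the values are roots of v^{θ(q)} = 1.
  length-values≤ : length values ℕ.≤ θ q
  length-values≤ = length-roots≤ unique-values λ v∈ → let x , x≢0 , eq = representative v∈ in trans (cong (_^ θ q) eq) (^m^θ≡1 x≢0)

  fiber : K → List K
  fiber v = List.filter (λ x → x ^ m ≟ v) elements

  unique-elements : Unique elements
  unique-elements = Unique.tabulate⁺ enum-injective

  length-fiber≤ : ∀ v → length (fiber v) ℕ.≤ m
  length-fiber≤ v = subst (length (fiber v) ℕ.≤_) (sym m≡) (length-roots≤ {m = ℕ.pred m} (Unique.filter⁺ _ unique-elements)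
    (λ {x} x∈ → trans (cong (x ^_) (sym m≡)) (proj₂ (∈-filter⁻ (λ x → x ^ m ≟ v) {xs = elements} x∈))))
    where
    m≡ : m ≡ suc (ℕ.pred m)
    m≡ = sym (ℕ.suc-pred m {{ℕ.>-nonZero (ℕ.s≤s⁻¹ (subst (2 ℕ.≤_) q≡1+m (ℕ.≤-trans (s≤s (s≤s z≤n)) 5≤q)))}})

  -- The fibres of x ↦ x^{q-1} have at most q - 1 elements and cover all (q - 1) θ(q) nonzero ones.
  -- Counting thus replaces the cyclicity of the multiplicative group.
  ≤length-values : θ q ℕ.≤ length values
  ≤length-values = ℕ.*-cancelˡ-≤ m {{ℕ.>-nonZero (ℕ.s≤s⁻¹ (subst (2 ℕ.≤_) q≡1+m (ℕ.≤-trans (s≤s (s≤s z≤n)) 5≤q)))}} (ℕ.s≤s⁻¹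
    (ℕ.≤-trans (ℕ.≤-reflexive (trans (sym order≡) (sym (List.length-tabulate (Inverse.to enum)))))
    (ℕ.≤-trans (unique-⊆⇒length≤ unique-elements (λ {x} _ → cover x))
    (ℕ.≤-trans (s≤s (length-concatMap≤ fiber length-fiber≤ values))
    (ℕ.≤-reflexive (cong suc (ℕ.*-comm (length values) m)))))))
    where
    cover : ∀ x → x ∈ 0# ∷ concatMap fiber values
    cover x with x ≟ 0#
    ... | yes x≡0 = here x≡0
    ... | no x≢0 = there (∈-concatMap⁺ fiber (Any.map (λ { refl → ∈-filter⁺ (λ y → y ^ m ≟ x ^ m) (∈-elements x) refl }) (∈-values x≢0)))

  g-linear : ∀ {l} x → Fixed l → g (l * x) ≡ l * g x
  g-linear {l} x fix = trans (cong₂ _+_ (cong₂ _+_ (pull 1) (pull 3)) (cong (b *_) (pull 5)))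
    (solve 5 (λ l x y z b → l :* x :+ l :* y :+ b :* (l :* z) := l :* (x :+ y :+ b :* z)) refl l (φ 1 x) (φ 3 x) (φ 5 x) b)
    where
    pull : ∀ i → φ i (l * x) ≡ l * φ i x
    pull i = trans (φ-* i l x) (cong (_* φ i x) (φ-fixed fix i))

  private
    rep : Fin (length values) → K
    rep i = proj₁ (representative (∈-lookup {xs = values} i))

    rep≢0 : ∀ i → ¬ rep i ≡ 0#
    rep≢0 i = proj₁ (proj₂ (representative (∈-lookup {xs = values} i)))

    rep^m : ∀ i → List.lookup values i ≡ rep i ^ m
    rep^m i = proj₂ (proj₂ (representative (∈-lookup {xs = values} i)))

    pt : K → V F
    pt x = x , g x

    vs : Vec (V F) (length values)
    vs = Vec.tabulate (pt ∘ rep)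

    lookup-vs : ∀ i → Vec.lookup vs i ≡ pt (rep i)
    lookup-vs = Vec.lookup∘tabulate (pt ∘ rep)

    -- By `scattered` the factor of proportionality lies in F_q, so it does not change the (q -
    -- 1)-th power.
    distinct : ∀ i j → SamePoint F (pt (rep i)) (pt (rep j)) → i ≡ j
    distinct i j (l , l≢0 , eq) = lookup-injective unique-values (begin
      List.lookup values i       ≡⟨ rep^m i ⟩
      rep i ^ m                  ≡⟨ sym (*-identityˡ _) ⟩
      1# * rep i ^ m             ≡⟨ cong (_* rep i ^ m) (sym (fixed⇒^m≡1 l≢0 (scattered l (rep i) (rep≢0 i) (trans (cong g (sym (cong proj₁ eq))) (cong proj₂ eq))))) ⟩
      l ^ m * rep i ^ m          ≡⟨ sym (*-^ l (rep i) m) ⟩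
      (l * rep i) ^ m            ≡⟨ cong (_^ m) (sym (cong proj₁ eq)) ⟩
      rep j ^ m                  ≡⟨ sym (rep^m j) ⟩
      List.lookup values j       ∎)

    -- The quotient of x by its representative has (q - 1)-th power 1, so it lies in F_q and g
    -- commutes with it.
    covered : ∀ v → LinSet F g v → ∃[ i ] SamePoint F (pt (rep i)) v
    covered v (x , x≢0 , l , l≢0 , refl) = i , l * μ , *≢0 l≢0 μ≢0 , cong₂ _,_
      (trans (cong (l *_) x≡μr) (sym (*-assoc l μ r)))
      (trans (cong (λ y → l * g y) x≡μr) (trans (cong (l *_) (g-linear r μ-fixed)) (sym (*-assoc l μ (g r)))))
      where
      i = Any.index (∈-values x≢0)
      r = rep i
      r^m≡x^m : r ^ m ≡ x ^ m
      r^m≡x^m = trans (sym (rep^m i)) (sym (lookup-index′ (∈-values x≢0)))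
        where
        lookup-index′ : ∀ {y} {ys : List K} (p : y ∈ ys) → y ≡ List.lookup ys (Any.index p)
        lookup-index′ (here eq) = eq
        lookup-index′ (there p) = lookup-index′ p
      r⁻¹ = proj₁ (inverse r (rep≢0 i))
      μ = x * r⁻¹
      x≡μr : x ≡ μ * r
      x≡μr = trans (trans (sym (*-identityʳ x)) (cong (x *_) (sym (proj₂ (inverse r (rep≢0 i))))))
        (solve 3 (λ x r s → x :* (r :* s) := x :* s :* r) refl x r r⁻¹)
      μ≢0 : ¬ μ ≡ 0#
      μ≢0 μ≡0 = x≢0 (trans x≡μr (trans (cong (_* r) μ≡0) (zeroˡ r)))
      μ-fixed : Fixed μ
      μ-fixed = ^m≡1⇒fixed (*-cancelˡ (^≢0 m (rep≢0 i)) (begin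
        r ^ m * μ ^ m    ≡⟨ *-comm _ _ ⟩
        μ ^ m * r ^ m    ≡⟨ sym (*-^ μ r m) ⟩
        (μ * r) ^ m      ≡⟨ cong (_^ m) (sym x≡μr) ⟩
        x ^ m            ≡⟨ sym r^m≡x^m ⟩
        r ^ m            ≡⟨ sym (*-identityʳ _) ⟩
        r ^ m * 1#       ∎))

  maxScattered : MaxScattered F q g
  maxScattered = subst (HasNPoints F (LinSet F g)) (ℕ.≤-antisym length-values≤ ≤length-values)
    ( vs
    , (λ i → subst (λ v → NonZeroV F v × LinSet F g v) (sym (lookup-vs i))
        ((λ z → rep≢0 i (proj₁ z)) , rep i , rep≢0 i , 1# , 0≢1 ∘ sym , sym (cong₂ _,_ (*-identityˡ _) (*-identityˡ _))))
    , (λ i j same → distinct i j (subst₂ (SamePoint F) (lookup-vs i) (lookup-vs j) same))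
    , (λ v _ v∈L → let i , same = covered v v∈L in i , subst (λ w → SamePoint F w v) (sym (lookup-vs i)) same))

-- Exponents modulo 6 and the bound on q.

∣%⇒∣ : ∀ {d n} m .{{_ : ℕ.NonZero n}} → d ∣ n → d ∣ m % n → d ∣ m
∣%⇒∣ {d} {n} m d∣n d∣% = subst (d ∣_) (sym (m≡m%n+[m/n]*n m n)) (∣m∣n⇒∣m+n d∣% (∣-trans d∣n (n∣m*n (m / n))))

coprime⇒∤ : ∀ {d m n} → gcd m n ≡ 1 → d ∣ m → d ∣ n → d ≡ 1
coprime⇒∤ {d} eq d∣m d∣n = ∣1⇒≡1 (subst (d ∣_) eq (gcd-greatest d∣m d∣n))

coprime-6⇒% : ∀ s → gcd s 6 ≡ 1 → s % 6 ≡ 1 ⊎ s % 6 ≡ 5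
coprime-6⇒% s eq = go (s % 6) refl (m%n<n s 6)
  where
  even : ∀ {r} → s % 6 ≡ r → 2 ∣ r → ⊥
  even s%6≡r 2∣r with coprime⇒∤ eq (∣%⇒∣ s (from-yes (2 ∣? 6)) (subst (2 ∣_) (sym s%6≡r) 2∣r)) (from-yes (2 ∣? 6))
  ... | ()
  triple : s % 6 ≡ 3 → ⊥
  triple s%6≡r with coprime⇒∤ eq (∣%⇒∣ s (from-yes (3 ∣? 6)) (subst (3 ∣_) (sym s%6≡r) (from-yes (3 ∣? 3)))) (from-yes (3 ∣? 6))
  ... | ()
  go : ∀ r → s % 6 ≡ r → r < 6 → s % 6 ≡ 1 ⊎ s % 6 ≡ 5
  go 0 r _ = ⊥-elim (even r (from-yes (2 ∣? 0)))
  go 1 r _ = inj₁ r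
  go 2 r _ = ⊥-elim (even r (from-yes (2 ∣? 2)))
  go 3 r _ = ⊥-elim (triple r)
  go 4 r _ = ⊥-elim (even r (from-yes (2 ∣? 4)))
  go 5 r _ = inj₂ r
  go (suc (suc (suc (suc (suc (suc _)))))) r (s≤s (s≤s (s≤s (s≤s (s≤s (s≤s ()))))))

coprime-3⇒% : ∀ h → gcd h 3 ≡ 1 → h % 6 ≡ 1 ⊎ h % 6 ≡ 2 ⊎ h % 6 ≡ 4 ⊎ h % 6 ≡ 5
coprime-3⇒% h eq = go (h % 6) refl (m%n<n h 6)
  where
  triple : ∀ {r} → h % 6 ≡ r → 3 ∣ r → ⊥
  triple h%6≡r 3∣r with coprime⇒∤ {n = 3} eq (∣%⇒∣ h (from-yes (3 ∣? 6)) (subst (3 ∣_) (sym h%6≡r) 3∣r)) (from-yes (3 ∣? 3))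
  ... | ()
  go : ∀ r → h % 6 ≡ r → r < 6 → h % 6 ≡ 1 ⊎ h % 6 ≡ 2 ⊎ h % 6 ≡ 4 ⊎ h % 6 ≡ 5
  go 0 r _ = ⊥-elim (triple r (from-yes (3 ∣? 0)))
  go 1 r _ = inj₁ r
  go 2 r _ = inj₂ (inj₁ r)
  go 3 r _ = ⊥-elim (triple r (from-yes (3 ∣? 3)))
  go 4 r _ = inj₂ (inj₂ (inj₁ r))
  go 5 r _ = inj₂ (inj₂ (inj₂ r))
  go (suc (suc (suc (suc (suc (suc _)))))) r (s≤s (s≤s (s≤s (s≤s (s≤s (s≤s ()))))))

-- The degree 4 of the determinant in each variable has to stay below q. The residue condition
-- excludes 3, the one odd number between 1 and 5.
5≤odd : ∀ q → ¬ q ≡ 1 → ¬ 2 ∣ q → (q % 5 ≡ 0 ⊎ q % 5 ≡ 1 ⊎ q % 5 ≡ 4) → 5 ℕ.≤ q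
5≤odd 0 _ odd _ = ⊥-elim (odd (from-yes (2 ∣? 0)))
5≤odd 1 q≢1 _ _ = ⊥-elim (q≢1 refl)
5≤odd 2 _ odd _ = ⊥-elim (odd (from-yes (2 ∣? 2)))
5≤odd 3 _ _ (inj₁ ())
5≤odd 3 _ _ (inj₂ (inj₁ ()))
5≤odd 3 _ _ (inj₂ (inj₂ ()))
5≤odd 4 _ odd _ = ⊥-elim (odd (from-yes (2 ∣? 4)))
5≤odd (suc (suc (suc (suc (suc q))))) _ _ _ = s≤s (s≤s (s≤s (s≤s (s≤s z≤n))))

-- From a collineation to the kernel condition, and the three families.

module Equivalences (F : Field) {p : ℕ} (p-prime : Prime p) (k : ℕ) (enum : Fin ((p ℕ.^ k) ℕ.^ 6) ↔ Field.K F)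
  (5≤q : 5 ℕ.≤ p ℕ.^ k) (2≢0 : ¬ Field._+_ F (Field.1# F) (Field.1# F) ≡ Field.0# F)
  (b : Field.K F) (b-fixed : Frobenius.Fixed F p-prime k enum b)
  (golden : Field._+_ F (Field._*_ F b b) b ≡ Field.1# F) where
  open Frobenius F p-prime k enum
  open Solver using (solve; _:=_; _:+_; _:*_; _:-_; :-_; con)

  module _ (f : K → K) (Φ : PΓLEquivalent F (LinSet F (gThm F q b)) (LinSet F f)) where
    open PΓL2 (proj₁ Φ) renaming (a to A; b to B; c to C; d to D)
    open Automorphism aut

    σ-0 : σ 0# ≡ 0#
    σ-0 = trans (solve 1 (λ a → a := a :+ a :- a) refl (σ 0#))
      (trans (cong (_- σ 0#) (trans (sym (hom-+ 0# 0#)) (cong σ (+-identityˡ 0#)))) (-‿inverseʳ _))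

    σ-^ : ∀ x n → σ (x ^ n) ≡ σ x ^ n
    σ-^ x zero = hom-1
    σ-^ x (suc n) = trans (hom-* x _) (cong (σ x *_) (σ-^ x n))

    -- Conjugating g by σ changes only its coefficient b, into another element of F_q with β² + β =
    -- 1. The semilinear case thus becomes the linear one for β.
    β : K
    β = σ b

    β-fixed : Fixed β
    β-fixed = trans (sym (σ-^ b (q ℕ.^ 1))) (cong σ b-fixed)

    β-golden : β * β + β ≡ 1#
    β-golden = trans (cong (_+ β) (sym (hom-* b b))) (trans (sym (hom-+ _ _)) (trans (cong σ golden) hom-1))

    open Twisting F p-prime k enum β β-fixed using (g; Target)

    σ-g : ∀ x → σ (gThm F q b x) ≡ g (σ x)
    σ-g x = trans (hom-+ _ _) (cong₂ _+_ (trans (hom-+ _ _) (cong₂ _+_ (σ-^ x (q ℕ.^ 1)) (σ-^ x (q ℕ.^ 3)))) (trans (hom-* _ _) (cong (β *_) (σ-^ x (q ℕ.^ 5)))))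

    g-0 : g 0# ≡ 0#
    g-0 = trans (cong₂ _+_ (cong₂ _+_ (φ-0 1) (φ-0 3)) (cong (β *_) (φ-0 5))) (solve 1 (λ b → con (pos 0) :+ con (pos 0) :+ b :* con (pos 0) := con (pos 0)) refl β)

    -- The image of the point of L_g over σ⁻¹ y is represented by `w`. Its membership in L_f makes
    -- `w` proportional to (z, f z), and cross-multiplication removes the factor.
    kernel : (t : Target) → (∀ z → f z ≡ Target.eval t z) →
      ∀ y → ∃[ z ] (¬ z ≡ 0# × (A * y + B * g y) * Target.eval t z ≡ (C * y + D * g y) * z)
    kernel t f≡t y with y ≟ 0#
    -- At y = 0 both sides vanish and any nonzero z serves. This value counts among the q⁶ roots on
    -- which `vanishing` relies.
    ... | yes refl = 1# , 0≢1 ∘ sym , trans (vanish A B _) (sym (vanish C D 1#))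
      where
      vanish : ∀ u v w → (u * 0# + v * g 0#) * w ≡ 0#
      vanish u v w = trans (cong (λ x → (u * 0# + v * x) * w) g-0) (solve 3 (λ u v w → (u :* con (pos 0) :+ v :* con (pos 0)) :* w := con (pos 0)) refl u v w)
    ... | no y≢0 = image (proj₁ (proj₂ Φ w w≢0) (_ , (σ⁻¹ y , x≢0 , 1# , 0≢1 ∘ sym , sym (cong₂ _,_ (*-identityˡ _) (*-identityˡ _))) , w≡))
      where
      w = A * y + B * g y , C * y + D * g y
      x≢0 : ¬ σ⁻¹ y ≡ 0#
      x≢0 eq = y≢0 (trans (sym (inv₁ y)) (trans (cong σ eq) σ-0))
      w≡ : w ≡ act (σ⁻¹ y , gThm F q b (σ⁻¹ y))
      w≡ = sym (cong₂ (λ u v → A * u + B * v , C * u + D * v) (inv₁ y) (trans (σ-g (σ⁻¹ y)) (cong g (inv₁ y))))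
      w≢0 : NonZeroV F w
      w≢0 (w₁≡0 , w₂≡0) = y≢0 (*-cancelˡ-0 det≢0 (trans
        (solve 6 (λ A B C D y z → (A :* D :- B :* C) :* y := D :* (A :* y :+ B :* z) :- B :* (C :* y :+ D :* z)) refl A B C D y (g y))
        (trans (cong₂ (λ u v → D * u - B * v) w₁≡0 w₂≡0) (solve 2 (λ B D → D :* con (pos 0) :- B :* con (pos 0) := con (pos 0)) refl B D))))
      image : LinSet F f w → ∃[ z ] (¬ z ≡ 0# × (A * y + B * g y) * Target.eval t z ≡ (C * y + D * g y) * z)
      image (z , z≢0 , l , _ , eq) = z , z≢0 , trans
        (cong₂ _*_ (cong proj₁ eq) (sym (f≡t z)))
        (trans (solve 3 (λ l z y → l :* z :* y := l :* y :* z) refl l z (f z)) (cong (_* z) (sym (cong proj₂ eq))))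

    open Nonequivalence F p-prime k enum 5≤q β β-fixed β-golden 2≢0

    twoTerm : ∀ c c′ → ¬ (∀ z → f z ≡ c * φ 1 z + c′ * φ 5 z)
    twoTerm c c′ eq = noTwoTermTarget t A B C D det≢0
      (kernel t (λ z → trans (eq z) (solve 6 (λ c c′ u v w x → c :* u :+ c′ :* x := c :* u :+ con (pos 0) :* v :+ con (pos 0) :* w :+ c′ :* x) refl
        c c′ (φ 1 z) (φ 2 z) (φ 4 z) (φ 5 z)))) refl refl
      where
      t : Target
      t = record { c₁ = c ; c₂ = 0# ; c₄ = 0# ; c₅ = c′ }

    oneFour : ∀ c c′ → ¬ (∀ z → f z ≡ c * φ 1 z + c′ * φ 4 z)
    oneFour c c′ eq = noOppositePairTarget t A B C D det≢0
      (kernel t (λ z → trans (eq z) (solve 6 (λ c c′ u v w x → c :* u :+ c′ :* w := c :* u :+ con (pos 0) :* v :+ c′ :* w :+ con (pos 0) :* x) refl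
        c c′ (φ 1 z) (φ 2 z) (φ 4 z) (φ 5 z)))) (inj₁ (refl , refl))
      where
      t : Target
      t = record { c₁ = c ; c₂ = 0# ; c₄ = c′ ; c₅ = 0# }

    twoFive : ∀ c c′ → ¬ (∀ z → f z ≡ c * φ 2 z + c′ * φ 5 z)
    twoFive c c′ eq = noOppositePairTarget t A B C D det≢0
      (kernel t (λ z → trans (eq z) (solve 6 (λ c c′ u v w x → c :* v :+ c′ :* x := con (pos 0) :* u :+ c :* v :+ con (pos 0) :* w :+ c′ :* x) refl
        c c′ (φ 1 z) (φ 2 z) (φ 4 z) (φ 5 z)))) (inj₂ (refl , refl))
      where
      t : Target
      t = record { c₁ = 0# ; c₂ = c ; c₄ = 0# ; c₅ = c′ }

  φ-≡% : ∀ n {r} → n % 6 ≡ r → ∀ z → φ n z ≡ φ r z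
  φ-≡% n eq z = trans (φ-%6 n z) (cong (λ j → φ j z) eq)

  φ-+3 : ∀ h {r} → h % 6 ≡ r → ∀ z → φ (h ℕ.+ 3) z ≡ φ (r ℕ.+ 3) z
  φ-+3 h {r} eq z = trans (sym (φ-φ h 3 z)) (trans (φ-≡% h eq (φ 3 z)) (φ-φ r 3 z))

  notType1 : ∀ s → gcd s 6 ≡ 1 → ¬ PΓLEquivalent F (LinSet F (gThm F q b)) (LinSet F (g1 F q s))
  notType1 s coprime Φ with coprime-6⇒% s coprime
  ... | inj₁ r = twoTerm _ Φ 1# 0# (λ z → trans (φ-≡% s r z) (solve 2 (λ u v → u := con (pos 1) :* u :+ con (pos 0) :* v) refl (φ 1 z) (φ 5 z)))
  ... | inj₂ r = twoTerm _ Φ 0# 1# (λ z → trans (φ-≡% s r z) (solve 2 (λ u v → v := con (pos 0) :* u :+ con (pos 1) :* v) refl (φ 1 z) (φ 5 z)))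

  -- Since t < 6, the truncated `6 ∸ t` is the true difference. For t = 1 and t = 5 alike the
  -- exponents are 1 and 5, with ρ changing place.
  notType2 : ∀ t ρ → gcd t 6 ≡ 1 → t < 6 → ¬ PΓLEquivalent F (LinSet F (gThm F q b)) (LinSet F (g2 F q t ρ))
  notType2 0 ρ () _
  notType2 1 ρ _ _ Φ = twoTerm _ Φ ρ 1# (λ z → solve 3 (λ ρ u v → ρ :* u :+ v := ρ :* u :+ con (pos 1) :* v) refl ρ (φ 1 z) (φ 5 z))
  notType2 2 ρ () _
  notType2 3 ρ () _
  notType2 4 ρ () _
  notType2 5 ρ _ _ Φ = twoTerm _ Φ 1# ρ (λ z → solve 3 (λ ρ u v → ρ :* v :+ u := con (pos 1) :* u :+ ρ :* v) refl ρ (φ 1 z) (φ 5 z))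
  notType2 (suc (suc (suc (suc (suc (suc _)))))) ρ _ (s≤s (s≤s (s≤s (s≤s (s≤s (s≤s ()))))))

  -- Modulo 6 the exponents h and h + 3 form {1, 4} or {2, 5}. For h congruent to 4 or 5 the second
  -- one wraps around and the coefficients change places.
  notType3 : ∀ h ξ → gcd h 3 ≡ 1 → ¬ PΓLEquivalent F (LinSet F (gThm F q b)) (LinSet F (g3 F q h ξ))
  notType3 h ξ coprime Φ with coprime-3⇒% h coprime
  ... | inj₁ r = oneFour _ Φ ξ 1# (λ z → trans (cong₂ (λ u v → ξ * u + v) (φ-≡% h r z) (φ-+3 h r z))
        (solve 3 (λ ξ u v → ξ :* u :+ v := ξ :* u :+ con (pos 1) :* v) refl ξ (φ 1 z) (φ 4 z)))
  ... | inj₂ (inj₁ r) = twoFive _ Φ ξ 1# (λ z → trans (cong₂ (λ u v → ξ * u + v) (φ-≡% h r z) (φ-+3 h r z))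
        (solve 3 (λ ξ u v → ξ :* u :+ v := ξ :* u :+ con (pos 1) :* v) refl ξ (φ 2 z) (φ 5 z)))
  ... | inj₂ (inj₂ (inj₁ r)) = oneFour _ Φ 1# ξ (λ z → trans (cong₂ (λ u v → ξ * u + v) (φ-≡% h r z) (trans (φ-+3 h r z) (φ-6+ 1 z)))
        (solve 3 (λ ξ u v → ξ :* v :+ u := con (pos 1) :* u :+ ξ :* v) refl ξ (φ 1 z) (φ 4 z)))
  ... | inj₂ (inj₂ (inj₂ r)) = twoFive _ Φ 1# ξ (λ z → trans (cong₂ (λ u v → ξ * u + v) (φ-≡% h r z) (trans (φ-+3 h r z) (φ-6+ 2 z)))
        (solve 3 (λ ξ u v → ξ :* v :+ u := con (pos 1) :* u :+ ξ :* v) refl ξ (φ 2 z) (φ 5 z)))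

-- If 1 + 1 = 0 and p is odd, then p · 1 = 1, against p · 1 = 0.
odd-characteristic : (F : Field) {p : ℕ} (p-prime : Prime p) (k : ℕ) (enum : Fin ((p ℕ.^ k) ℕ.^ 6) ↔ Field.K F) →
  ¬ 2 ∣ p → ¬ Field._+_ F (Field.1# F) (Field.1# F) ≡ Field.0# F
odd-characteristic F {p} p-prime k enum odd 2≡0 = odd (go (p % 2) refl (m%n<n p 2))
  where
  open Frobenius F p-prime k enum
  2n≡0 : ∀ n → (n ℕ.* 2) ⊠ 1# ≡ 0#
  2n≡0 n = trans (⊠1-homo-* n 2) (trans (cong (n ⊠ 1# *_) 2≡0) (zeroʳ _))
  go : ∀ r → p % 2 ≡ r → r < 2 → 2 ∣ p
  go 0 r _ = ∣%⇒∣ p (from-yes (2 ∣? 2)) (subst (2 ∣_) (sym r) (from-yes (2 ∣? 0)))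
  go 1 r _ = ⊥-elim (0≢1 (begin
    0#                               ≡⟨ sym p⊠1≡0 ⟩
    p ⊠ 1#                           ≡⟨ cong (_⊠ 1#) (trans (m≡m%n+[m/n]*n p 2) (cong (ℕ._+ p / 2 ℕ.* 2) r)) ⟩
    (1 ℕ.+ p / 2 ℕ.* 2) ⊠ 1#         ≡⟨ ⊠-homo-+ 1# 1 (p / 2 ℕ.* 2) ⟩
    1# + (p / 2 ℕ.* 2) ⊠ 1#          ≡⟨ cong (1# +_) (2n≡0 (p / 2)) ⟩
    1# + 0#                          ≡⟨ +-identityʳ 1# ⟩
    1#                               ∎))
    where open ≡-Reasoning
  go (suc (suc _)) _ (s≤s (s≤s ()))

open import Data.Nat using (_^_)

theorem5p4 : (q : ℕ) → IsPrimePower q → ¬ (2 ∣ q)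
    → (q % 5 ≡ 0 ⊎ q % 5 ≡ 1 ⊎ q % 5 ≡ 4)
    → (F : Field) → (Fin (q ^ 6) ↔ Field.K F)
    → (b : Field.K F)
    → _^ᶠ_ F b q ≡ b
    → Field._+_ F (Field._*_ F b b) b ≡ Field.1# F
    → MaxScattered F q (gThm F q b)
    × (∀ s → gcd s 6 ≡ 1
    → ¬ PΓLEquivalent F (LinSet F (gThm F q b)) (LinSet F (g1 F q s)))
    × (∀ t ρ → gcd t 6 ≡ 1 → t < 6
    → ¬ N6/1 F q ρ ≡ Field.0# F → ¬ N6/1 F q ρ ≡ Field.1# F
    → ¬ PΓLEquivalent F (LinSet F (gThm F q b)) (LinSet F (g2 F q t ρ)))
    × (∀ h ξ → gcd h 3 ≡ 1
    → ¬ N6/3 F q ξ ≡ Field.0# F → ¬ N6/3 F q ξ ≡ Field.1# F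
    → MaxScattered F q (g3 F q h ξ)
    → ¬ PΓLEquivalent F (LinSet F (gThm F q b)) (LinSet F (g3 F q h ξ)))
theorem5p4 _ (p , zero , p-prime , () , refl)
theorem5p4 _ (p , suc k , p-prime , _ , refl) odd residue F enum b b^q≡b golden =
    Scattered.maxScattered F p-prime (suc k) enum 5≤q b b-fixed golden 2≢0
  , notType1
  , (λ t ρ coprime t<6 _ _ → notType2 t ρ coprime t<6)
  , (λ h ξ coprime _ _ _ → notType3 h ξ coprime)
  where
  q = p ^ suc k
  p∣q : p ∣ q
  p∣q = m∣m*n (p ^ k)
  5≤q : 5 ℕ.≤ q
  5≤q = 5≤odd q (λ q≡1 → ¬prime[1] (subst Prime (∣1⇒≡1 (subst (p ∣_) q≡1 p∣q)) p-prime)) odd residue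
  b-fixed : Frobenius.Fixed F p-prime (suc k) enum b
  -- The exponent `q ^ 1` in `frob` unfolds to `q * 1`.
  b-fixed = trans (cong (_^ᶠ_ F b) (ℕ.*-identityʳ q)) b^q≡b
  2≢0 : ¬ Field._+_ F (Field.1# F) (Field.1# F) ≡ Field.0# F
  2≢0 = odd-characteristic F p-prime (suc k) enum (λ 2∣p → odd (∣-trans 2∣p p∣q))
  open Equivalences F p-prime (suc k) enum 5≤q 2≢0 b b-fixed golden
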